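{- For every positive integer $\ell$ there is $\varepsilon_\ell>0$ such that for every finite abelian group $H$ of exponent at most $\ell$ and every STPP construction $(A_i,B_i,C_i)_{i\in I}$ in $H$, the bound on $\omega$ it yields via the inequality $\sum_{i\in I}(\lvert A_i\rvert\lvert B_i\rvert\lvert C_i\rvert)^{\omega/3}\leq\lvert H\rvert$ is no better than $2+\varepsilon_\ell$; that is, \[ \tau:=\sup\Big\{c\in\mathbb{R}:\ \sum_{i\in I}(\lvert A_i\rvert\lvert B_i\rvert\lvert C_i\rvert)^{c/3}\leq \lvert H\rvert\Big\}\ \geq\ 2+\varepsilon_\ell . \]
   Context: Let $H$ be a finite abelian group written additively. For $X,Y\subseteq H$ write $X-Y=\{x-y:x\in X,y\in Y\}$. Subsets $A,B,C\subseteq H$ satisfy the triple product property if for all $a\in A-A$, $b\in B-B$, $c\in C-C$ we have $a+b+c=0$ if and only if $a=b=c=0$. An STPP construction in $H$ is a finite collection of triples $(A_i,B_i,C_i)_{i\in I}$ of nonempty subsets of $H$ such that (1) for each $i$, $A_i,B_i,C_i$ satisfy the triple product property, and (2) setting $S_i=A_i-B_i$, $T_j=B_j-C_j$, $U_k=C_k-A_k$, whenever $s+t+u=0$ with $s\in S_i$, $t\in T_j$, $u\in U_k$, we have $i=j=k$. (Here $\omega$ denotes the exponent of matrix multiplication; the displayed inequality is known to hold for every STPP construction in an abelian group, and $\tau$ is the strongest upper bound on $\omega$ it can give.) -}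

module Defs where

open import Level using (0ℓ)
open import Data.Nat as ℕ using (ℕ; zero; suc)
open import Data.Integer as ℤ using (ℤ; +_)
open import Data.Rational as ℚ using (ℚ; 0ℚ; 1ℚ)
open import Data.Fin using (Fin; zero; suc)
open import Data.List using (List; length)
open import Data.List.Relation.Unary.Any using (Any)
open import Data.List.Relation.Unary.AllPairs using (AllPairs)
open import Data.Product using (Σ; _×_; ∃; ∃-syntax; _,_)
open import Data.Sum using (_⊎_)
open import Relation.Nullary using (¬_)
open import Relation.Binary.PropositionalEquality using (_≡_)
open import Algebra.Bundles using (AbelianGroup)

record FiniteAbelianGroup : Set₁ where
  field
    grp      : AbelianGroup 0ℓ 0ℓ
  open AbelianGroup grp public
    renaming (_∙_ to _+ᴴ_; ε to 0ᴴ; _⁻¹ to -ᴴ_)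
  field
    elems    : List Carrier
    complete : ∀ x → Any (x ≈_) elems
    distinct : AllPairs (λ x y → ¬ (x ≈ y)) elems

  order : ℕ
  order = length elems

  _-ᴴ_ : Carrier → Carrier → Carrier
  x -ᴴ y = x +ᴴ (-ᴴ y)

  _·ᴴ_ : ℕ → Carrier → Carrier
  zero  ·ᴴ x = 0ᴴ
  suc m ·ᴴ x = x +ᴴ (m ·ᴴ x)

  -- exponent of H is at most ℓ : some 1 ≤ m ≤ ℓ kills every element
  -- (the exponent is the least such m)
  ExponentAtMost : ℕ → Set
  ExponentAtMost ℓ = ∃[ m ] (1 ℕ.≤ m × m ℕ.≤ ℓ × (∀ x → (m ·ᴴ x) ≈ 0ᴴ))

  record Subset : Set where
    field
      members  : List Carrier
      nodup    : AllPairs (λ x y → ¬ (x ≈ y)) members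
    size : ℕ
    size = length members
    _∈S : Carrier → Set
    _∈S x = Any (x ≈_) members

  open Subset public

  NonEmpty : Subset → Set
  NonEmpty X = 1 ℕ.≤ size X

  _∈_-_ : Carrier → Subset → Subset → Set
  z ∈ X - Y = ∃[ x ] ∃[ y ] (_∈S X x × _∈S Y y × z ≈ (x -ᴴ y))

  TPP : Subset → Subset → Subset → Set
  TPP A B C =
    ∀ a b c → a ∈ A - A → b ∈ B - B → c ∈ C - C →
      (((a +ᴴ b) +ᴴ c) ≈ 0ᴴ → (a ≈ 0ᴴ × b ≈ 0ᴴ × c ≈ 0ᴴ))
      × ((a ≈ 0ᴴ × b ≈ 0ᴴ × c ≈ 0ᴴ) → ((a +ᴴ b) +ᴴ c) ≈ 0ᴴ)

  record STPP (k : ℕ) : Set where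
    field
      A B C    : Fin k → Subset
      neA      : ∀ i → NonEmpty (A i)
      neB      : ∀ i → NonEmpty (B i)
      neC      : ∀ i → NonEmpty (C i)
      tpp      : ∀ i → TPP (A i) (B i) (C i)
      separate : ∀ i j l s t u →
                 s ∈ A i - B i → t ∈ B j - C j → u ∈ C l - A l →
                 ((s +ᴴ t) +ᴴ u) ≈ 0ᴴ → (i ≡ j × j ≡ l)

    volume : Fin k → ℕ
    volume i = size (A i) ℕ.* size (B i) ℕ.* size (C i)

powℚ : ℚ → ℕ → ℚ
powℚ q zero    = 1ℚ
powℚ q (suc n) = q ℚ.* powℚ q n

ℕtoℚ : ℕ → ℚ
ℕtoℚ n = + n ℚ./ 1

sumℚ : ∀ k → (Fin k → ℚ) → ℚ
sumℚ zero    f = 0ℚ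
sumℚ (suc k) f = f zero ℚ.+ sumℚ k (λ i → f (suc i))

-- q ≤ x ^ (n / d)  (the real number x^(n/d), x ≥ 0, described by its
-- lower Dedekind cut of rationals), for d ≥ 1
BelowPow : ℚ → ℕ → ℕ → ℕ → Set
BelowPow q x n d = q ℚ.≤ 0ℚ ⊎ (0ℚ ℚ.≤ q × powℚ q d ℚ.≤ ℕtoℚ (x ℕ.^ n))

third : ℚ → ℚ
third c = c ℚ.* (+ 1 ℚ./ 3)

-- Σ_{i<k} (x_i)^r ≤ N, for a rational r ≥ 0 (written r = n/d in lowest
-- terms): every family of rationals q_i ≤ x_i^r has Σ q_i ≤ N.
-- (For r ≥ 0 the numerator is nonnegative, so ∣numerator∣ is it.)
SumPowLe : ∀ k → (Fin k → ℕ) → ℚ → ℕ → Set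
SumPowLe k x r N =
  (q : Fin k → ℚ) →
  (∀ i → BelowPow (q i) (x i) ℤ.∣ ℚ.numerator r ∣ (ℚ.denominatorℕ r)) →
  sumℚ k q ℚ.≤ ℕtoℚ N

Admissible : (H : FiniteAbelianGroup) → ∀ k → FiniteAbelianGroup.STPP H k → ℚ → Set
Admissible H k S c = SumPowLe k (FiniteAbelianGroup.STPP.volume S) (third c) (FiniteAbelianGroup.order H)

-- τ ≥ t, i.e. sup of admissible c is ≥ t: every rational c < t is
-- exceeded (weakly) by some admissible c' ≥ 0 (rationals are dense, and
-- restricting to c' ≥ 0 loses nothing since the admissible set is
-- downward closed)
TauAtLeast : (H : FiniteAbelianGroup) → ∀ k → FiniteAbelianGroup.STPP H k → ℚ → Set
TauAtLeast H k S t =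
  ∀ c → c ℚ.< t → ∃[ c' ] (c ℚ.≤ c' × 0ℚ ℚ.≤ c' × Admissible H k S c')

{-# OPTIONS --safe #-}
-- The slice rank method, with finite differences in place of polynomials and counting in place of slice rank.
--
-- Let G be a power of H and p a prime for which the p-torsion of H, of rank r, has size at least |H|^(1/ℓ). On functions
-- G → 𝔽ₚ, translation by a p-torsion element g is 1 + D with Dᵖ = 0, so any r(p−1) + 1 differences along r generators
-- compose to zero. Expanding translations in differences, a convolution operator Σ uₐ f(· + xₐ) whose coefficients of
-- degree ≤ t = ⌊r(p−1)/3⌋ all vanish lowers the degree by t + 1; a Chernoff bound shows that the number R of these
-- coefficients is at most |G|^(1−1/g), with g depending only on ℓ.
--
-- If G carries N disjoint m × m × m matrix multiplications, then applying the operators of u and v, supported on the sets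
-- Aᵢ − Bᵢ and Bᵢ − Cᵢ, to the delta function computes the matrix products Uᵢ Vᵢ. Fixing 3R residues therefore leaves at
-- least p^(2Nm² − 3R) tuples with Uᵢ Vᵢ = 0 for all i, whereas only p^(7m²/4) pairs of m × m matrices multiply to zero.
-- Hence N m² ≤ 12 R.
--
-- For a general construction, take the words of length n in the most weighted type class and the product with the two
-- rotations of (A, B, C), which makes all blocks cubes; the factors polynomial in n disappear as n → ∞. This gives
-- Σ (|Aᵢ||Bᵢ||Cᵢ|)^((2 + 1/g)/3) ≤ |H|, i.e. ε = 1/g.

module Submission where

-- The cut at a third of the maximal degree `r * n` saves exponentially because the mean degree of a
-- digit vector is `r * n / 2`; the rate per generator depends on `p` alone. Counting has to do the
-- work of linear algebra, and the obstacle is that the low differences of the product are bilinear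
-- in the two coefficient functions: pairs with equal residues cannot simply be subtracted. Hence a
-- base point is fixed for `u` first; with `u - u₀` fixed, the low differences of its product with
-- `v` are linear in `v`, so a second base point can be subtracted. The three lists of residues are
-- the moments of `u`, the moments of `v` and these differences. All estimates live in the naturals,
-- so each fractional exponent is cleared by a power: cubes for the third, fourth powers for `7/4`,
-- `3g`-th powers for `(2 + 1/g)/3`. The saving is `(Q/P)^(r/3)`; if `(Q/P)^h ≥ p^ℓ`, it is at least
-- the `3h`-th root of the order of the group, whence `g = 3h`.

-- Growth of powers of natural numbers.

module Powers where

  open import Data.Nat
  open import Data.Nat.Properties
  open import Data.Nat.Tactic.RingSolver using (solve-∀)
  open import Relation.Nullary using (yes; no; contradiction)
  open import Relation.Binary.PropositionalEquality
  open ≤-Reasoning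

  ^-distribʳ-* : ∀ x y q → (x * y) ^ q ≡ x ^ q * y ^ q
  ^-distribʳ-* x y zero    = refl
  ^-distribʳ-* x y (suc q) = trans (cong (x * y *_) (^-distribʳ-* x y q)) (lemma x y (x ^ q) (y ^ q))
    where
    lemma : ∀ x y u v → x * y * (u * v) ≡ x * u * (y * v)
    lemma = solve-∀

  ^-cancelʳ-≤ : ∀ d .{{_ : NonZero d}} {x y} → x ^ d ≤ y ^ d → x ≤ y
  ^-cancelʳ-≤ d {x} {y} h with x ≤? y
  ... | yes x≤y = x≤y
  ... | no  x≰y = contradiction (^-monoˡ-< d (≰⇒> x≰y)) (≤⇒≯ h)

  -- Bernoulli's inequality `1 + h/P ≤ (1 + 1/P)^h ≤ (Q/P)^h` with denominators cleared.
  bernoulli-< : ∀ {P Q} → P < Q → ∀ h → (P + h) * P ^ h ≤ P * Q ^ h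
  bernoulli-< {P} {Q} P<Q zero    = ≤-reflexive (cong (_* 1) (+-identityʳ P))
  bernoulli-< {P} {Q} P<Q (suc h) = begin
    (P + suc h) * P ^ suc h ≤⟨ m≤m+n _ (h * P ^ h) ⟩
    (P + suc h) * P ^ suc h + h * P ^ h ≡⟨ lemma P h (P ^ h) ⟩
    suc P * ((P + h) * P ^ h) ≤⟨ *-mono-≤ P<Q (bernoulli-< P<Q h) ⟩
    Q * (P * Q ^ h) ≡⟨ swap Q P (Q ^ h) ⟩
    P * Q ^ suc h ∎
    where
    lemma : ∀ P h x → (P + suc h) * (P * x) + h * x ≡ suc P * ((P + h) * x)
    lemma = solve-∀
    swap : ∀ x y z → x * (y * z) ≡ y * (x * z)
    swap = solve-∀

  -- By Bernoulli, `h ≥ P * M` suffices for `(Q/P)^h ≥ M`. A strict inequality of integers thus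
  -- yields an explicit exponent; `saving` is one.
  outgrow : ∀ {P Q} → .{{_ : NonZero P}} → P < Q → ∀ M {h} → P * M ≤ h → M * P ^ h ≤ Q ^ h
  outgrow {P} {Q} P<Q M {h} PM≤h = *-cancelˡ-≤ P (begin
    P * (M * P ^ h) ≡⟨ *-assoc P M (P ^ h) ⟨
    P * M * P ^ h ≤⟨ *-monoˡ-≤ (P ^ h) (≤-trans PM≤h (m≤n+m h P)) ⟩
    (P + h) * P ^ h ≤⟨ bernoulli-< P<Q h ⟩
    P * Q ^ h ∎)

  n<2^n : ∀ n → suc n ≤ 2 ^ n
  n<2^n zero    = ≤-refl
  n<2^n (suc n) = begin
    suc (suc n) ≤⟨ s≤s (m≤m+n (suc n) n) ⟩
    suc (suc n + n) ≡⟨ lemma n ⟩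
    2 * suc n ≤⟨ *-monoʳ-≤ 2 (n<2^n n) ⟩
    2 * 2 ^ n ∎
    where
    lemma : ∀ n → suc (suc n + n) ≡ 2 * suc n
    lemma = solve-∀

  -- At n = q 4ⁱ the factor (n+1)^k is only exponential in i, while (X/Y)^n is doubly exponential.
  beats-polynomial : ∀ {X Y} c k → (∀ n → X ^ n ≤ c * suc n ^ k * Y ^ n) → X ≤ Y
  beats-polynomial {X} {zero} c k h = begin
    X ≡⟨ *-identityʳ X ⟨
    X ^ 1 ≤⟨ h 1 ⟩
    c * 2 ^ k * 0   ≡⟨ *-zeroʳ (c * 2 ^ k) ⟩
    0 ∎
  beats-polynomial {X} {Y@(suc _)} c k h with X ≤? Y
  ... | yes X≤Y = X≤Y
  ... | no  X≰Y = contradiction upper (<⇒≱ lower)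
    where
    q A i j E : ℕ
    q = Y * 2
    A = c + suc q * k
    -- Both `A` and `2 k` are at most `i`, so `E ≤ i + i² < (i + 1)² ≤ 4ⁱ = j`.
    i = A + 2 * k
    j = 2 ^ i * 2 ^ i
    E = A + 2 * i * k
    E<j : E < j
    E<j = begin-strict
      A + 2 * i * k ≤⟨ +-mono-≤ (m≤m+n A (2 * k)) (≤-trans (≤-reflexive (lemma i k)) (*-monoʳ-≤ i (m≤n+m (2 * k) A))) ⟩
      i + i * i <⟨ s≤s (m≤n+m (i + i * i) i) ⟩
      suc (i + (i + i * i)) ≡⟨ square i ⟩
      suc i * suc i ≤⟨ *-mono-≤ (n<2^n i) (n<2^n i) ⟩
      j ∎
      where
      lemma : ∀ i k → 2 * i * k ≡ i * (2 * k)
      lemma = solve-∀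
      square : ∀ i → suc (i + (i + i * i)) ≡ suc i * suc i
      square = solve-∀
    lower : 2 ^ E < 2 ^ j
    lower = ^-monoʳ-< 2 ≤-refl E<j
    polynomial : c * suc (q * j) ^ k ≤ 2 ^ E
    polynomial = begin
      c * suc (q * j) ^ k ≤⟨ *-monoʳ-≤ c (^-monoˡ-≤ k (+-monoˡ-≤ (q * j) (*-mono-≤ (m^n>0 2 i) (m^n>0 2 i)))) ⟩
      c * (suc q * j) ^ k ≤⟨ *-mono-≤ (≤-trans (n≤1+n c) (n<2^n c)) (^-monoˡ-≤ k (*-monoˡ-≤ j (≤-trans (n≤1+n (suc q)) (n<2^n (suc q))))) ⟩
      2 ^ c * (2 ^ suc q * j) ^ k ≡⟨ cong (λ z → 2 ^ c * z ^ k) (cong (2 ^ suc q *_) (sym (^-distribˡ-+-* 2 i i))) ⟩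
      2 ^ c * (2 ^ suc q * 2 ^ (i + i)) ^ k ≡⟨ cong (λ z → 2 ^ c * z ^ k) (^-distribˡ-+-* 2 (suc q) (i + i)) ⟨
      2 ^ c * (2 ^ (suc q + (i + i))) ^ k   ≡⟨ cong (2 ^ c *_) (^-*-assoc 2 (suc q + (i + i)) k) ⟩
      2 ^ c * 2 ^ ((suc q + (i + i)) * k)   ≡⟨ ^-distribˡ-+-* 2 c ((suc q + (i + i)) * k) ⟨
      2 ^ (c + (suc q + (i + i)) * k) ≡⟨ cong (2 ^_) (lemma c q i k) ⟩
      2 ^ E ∎
      where
      lemma : ∀ c q i k → c + (suc q + (i + i)) * k ≡ c + suc q * k + 2 * i * k
      lemma = solve-∀
    upper : 2 ^ j ≤ 2 ^ E
    upper = *-cancelʳ-≤ (2 ^ j) (2 ^ E) (Y ^ (q * j)) {{m^n≢0 Y (q * j)}} (begin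
      2 ^ j * Y ^ (q * j) ≡⟨ cong (2 ^ j *_) (^-*-assoc Y q j) ⟨
      2 ^ j * (Y ^ q) ^ j ≡⟨ ^-distribʳ-* 2 (Y ^ q) j ⟨
      (2 * Y ^ q) ^ j ≤⟨ ^-monoˡ-≤ j (outgrow (≰⇒> X≰Y) 2 ≤-refl) ⟩
      (X ^ q) ^ j ≡⟨ ^-*-assoc X q j ⟩
      X ^ (q * j) ≤⟨ h (q * j) ⟩
      c * suc (q * j) ^ k * Y ^ (q * j) ≤⟨ *-monoˡ-≤ (Y ^ (q * j)) polynomial ⟩
      2 ^ E * Y ^ (q * j) ∎)

-- Finite sums of integers.

module Sums where

  open import Data.Fin as Fin using (Fin; zero; suc)
  import Data.Fin.Properties as Finₚ
  open import Data.Integer using (ℤ; 0ℤ; _+_; _*_; _-_; -_)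
  open import Data.Integer.Properties
  open import Data.Integer.Divisibility.Signed using (_∣_; divides; ∣m∣n⇒∣m+n)
  open import Data.Integer.Tactic.RingSolver using (solve-∀)
  open import Data.List using (List; []; _∷_; _++_; map; allFin; cartesianProduct)
  open import Data.List.Properties using (map-tabulate)
  open import Data.Nat using (zero; suc)
  open import Data.Product using (_×_; _,_)
  open import Function using (_∘_; id)
  open import Relation.Binary.PropositionalEquality

  private
    variable
      A B : Set

  ΣL : List A → (A → ℤ) → ℤ
  ΣL []       f = 0ℤ
  ΣL (x ∷ xs) f = f x + ΣL xs f

  Σ-cong : ∀ (xs : List A) {f g : A → ℤ} → (∀ x → f x ≡ g x) → ΣL xs f ≡ ΣL xs g
  Σ-cong []       e = refl
  Σ-cong (x ∷ xs) e = cong₂ _+_ (e x) (Σ-cong xs e)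

  Σ-0 : ∀ (xs : List A) → ΣL xs (λ _ → 0ℤ) ≡ 0ℤ
  Σ-0 []       = refl
  Σ-0 (x ∷ xs) = trans (+-identityˡ _) (Σ-0 xs)

  private
    interchange : ∀ a b c d → (a + b) + (c + d) ≡ (a + c) + (b + d)
    interchange = solve-∀

  Σ-+ : ∀ (xs : List A) (f g : A → ℤ) → ΣL xs (λ x → f x + g x) ≡ ΣL xs f + ΣL xs g
  Σ-+ []       f g = refl
  Σ-+ (x ∷ xs) f g = trans (cong ((f x + g x) +_) (Σ-+ xs f g)) (interchange (f x) (g x) (ΣL xs f) (ΣL xs g))

  Σ-*ˡ : ∀ (xs : List A) c (f : A → ℤ) → c * ΣL xs f ≡ ΣL xs (λ x → c * f x)
  Σ-*ˡ []       c f = *-zeroʳ c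
  Σ-*ˡ (x ∷ xs) c f = trans (*-distribˡ-+ c (f x) _) (cong (c * f x +_) (Σ-*ˡ xs c f))

  Σ-*ʳ : ∀ (xs : List A) c (f : A → ℤ) → ΣL xs f * c ≡ ΣL xs (λ x → f x * c)
  Σ-*ʳ xs c f = trans (*-comm _ c) (trans (Σ-*ˡ xs c f) (Σ-cong xs λ x → *-comm c (f x)))

  Σ-neg : ∀ (xs : List A) (f : A → ℤ) → ΣL xs (λ x → - f x) ≡ - ΣL xs f
  Σ-neg []       f = refl
  Σ-neg (x ∷ xs) f = trans (cong (- f x +_) (Σ-neg xs f)) (sym (neg-distrib-+ (f x) (ΣL xs f)))

  Σ-− : ∀ (xs : List A) (f g : A → ℤ) → ΣL xs (λ x → f x - g x) ≡ ΣL xs f - ΣL xs g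
  Σ-− xs f g = trans (Σ-+ xs f (λ x → - g x)) (cong (ΣL xs f +_) (Σ-neg xs g))

  Σ-swap : ∀ (xs : List A) (ys : List B) (f : A → B → ℤ) →
           ΣL xs (λ x → ΣL ys (f x)) ≡ ΣL ys (λ y → ΣL xs (λ x → f x y))
  Σ-swap []       ys f = sym (Σ-0 ys)
  Σ-swap (x ∷ xs) ys f = trans (cong (ΣL ys (f x) +_) (Σ-swap xs ys f)) (sym (Σ-+ ys (f x) _))

  Σ-++ : ∀ (xs ys : List A) (f : A → ℤ) → ΣL (xs ++ ys) f ≡ ΣL xs f + ΣL ys f
  Σ-++ []       ys f = sym (+-identityˡ _)
  Σ-++ (x ∷ xs) ys f = trans (cong (f x +_) (Σ-++ xs ys f)) (sym (+-assoc (f x) _ _))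

  Σ-map : ∀ (xs : List A) (h : A → B) (f : B → ℤ) → ΣL (map h xs) f ≡ ΣL xs (f ∘ h)
  Σ-map []       h f = refl
  Σ-map (x ∷ xs) h f = cong (f (h x) +_) (Σ-map xs h f)

  Σ-× : ∀ (xs : List A) (ys : List B) (f : A × B → ℤ) →
        ΣL (cartesianProduct xs ys) f ≡ ΣL xs (λ x → ΣL ys (λ y → f (x , y)))
  Σ-× []       ys f = refl
  Σ-× (x ∷ xs) ys f = trans (Σ-++ (map (x ,_) ys) _ f) (cong₂ _+_ (Σ-map ys (x ,_) f) (Σ-× xs ys f))

  Σ-∣ : ∀ {d} (xs : List A) {f : A → ℤ} → (∀ x → d ∣ f x) → d ∣ ΣL xs f
  Σ-∣ []       h = divides 0ℤ refl
  Σ-∣ (x ∷ xs) h = ∣m∣n⇒∣m+n (h x) (Σ-∣ xs h)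

  Σ-suc : ∀ n (f : Fin (suc n) → ℤ) → ΣL (allFin (suc n)) f ≡ f zero + ΣL (allFin n) (f ∘ suc)
  Σ-suc n f = cong (f zero +_) (trans (cong (λ l → ΣL l f) (sym (map-tabulate id suc))) (Σ-map (allFin n) suc f))

  Σ-single : ∀ {n} (k : Fin n) (f : Fin n → ℤ) → (∀ i → i ≢ k → f i ≡ 0ℤ) → ΣL (allFin n) f ≡ f k
  Σ-single {suc n} zero f h =
    trans (Σ-suc n f) (trans (cong (f zero +_) (trans (Σ-cong (allFin n) λ i → h (suc i) λ ()) (Σ-0 (allFin n))))
                             (+-identityʳ _))
  Σ-single {suc n} (suc k) f h =
    trans (Σ-suc n f) (trans (cong₂ _+_ (h zero λ ()) (Σ-single k (f ∘ suc) λ i ne → h (suc i) (ne ∘ Finₚ.suc-injective)))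
                             (+-identityˡ _))

-- Finite abelian groups with an enumerated carrier.

module Groups where

  open import Algebra.Bundles using (AbelianGroup)
  open import Algebra.Structures using (IsAbelianGroup)
  import Algebra.Properties.CommutativeMonoid.Mult as CommutativeMonoidMult
  import Algebra.Properties.AbelianGroup as AbelianGroupProperties
  import Algebra.Properties.CommutativeSemigroup as CommutativeSemigroupProperties
  open import Data.Fin as Fin using (Fin)
  open import Data.Nat using (ℕ)
  open import Level using (0ℓ)
  open import Relation.Nullary using (Dec)
  open import Relation.Nullary.Decidable using (map′)
  open import Relation.Binary.PropositionalEquality

  -- Searches and pigeonhole arguments use propositional equality and a bijection with `Fin size`.
  -- The setoid group of the theorem is transported to this form once, and products inherit it.
  record FinGroup : Set₁ where
    infixl 6 _⊕_
    infix 8 ⊖_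
    infix 4 _≟_
    field
      C       : Set
      _⊕_     : C → C → C
      𝟘       : C
      ⊖_      : C → C
      isAbelianGroup : IsAbelianGroup _≡_ _⊕_ 𝟘 ⊖_
      size    : ℕ
      enc     : C → Fin size
      dec     : Fin size → C
      dec-enc : ∀ x → dec (enc x) ≡ x
      enc-dec : ∀ i → enc (dec i) ≡ i

    abelianGroup : AbelianGroup 0ℓ 0ℓ
    abelianGroup = record { isAbelianGroup = isAbelianGroup }

    _≟_ : (x y : C) → Dec (x ≡ y)
    x ≟ y = map′ (λ e → trans (sym (dec-enc x)) (trans (cong dec e) (dec-enc y))) (cong enc) (enc x Fin.≟ enc y)

    open IsAbelianGroup isAbelianGroup public
      using (assoc; comm; identityˡ; identityʳ; inverseˡ; inverseʳ)
    open CommutativeMonoidMult (AbelianGroup.commutativeMonoid abelianGroup) public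
      using (×-homo-+; ×-assocˡ; ×-distrib-+) renaming (_×_ to _·_)
    open AbelianGroupProperties abelianGroup public
      using (∙-cancelˡ; ∙-cancelʳ)
    open CommutativeSemigroupProperties (AbelianGroup.commutativeSemigroup abelianGroup) public
      using (interchange; x∙yz≈y∙xz; xy∙z≈xz∙y)

-- Divisibility of binomial coefficients by a prime.

module Binom where

  open import Data.Nat
  open import Data.Nat.Combinatorics
  open import Data.Nat.Combinatorics.Specification using (k>n⇒nCk≡0)
  open import Data.Nat.Divisibility
  open import Data.Nat.Primality
  open import Data.Nat.Properties
  open import Data.Sum using (inj₁; inj₂)
  open import Relation.Nullary using (contradiction)
  open import Relation.Binary.PropositionalEquality
  open ≡-Reasoning

  -- The factor `suc n` on the right exposes the prime: it cannot divide a smaller `suc k`, so it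
  -- divides the binomial coefficient.
  C-absorb : ∀ n k → suc k * (suc n C suc k) ≡ suc n * (n C k)
  C-absorb zero    zero    = refl
  C-absorb zero    (suc k) = begin
    suc (suc k) * (1 C suc (suc k)) ≡⟨ cong (suc (suc k) *_) (k>n⇒nCk≡0 {1} {suc (suc k)} (s<s z<s)) ⟩
    suc (suc k) * 0 ≡⟨ *-zeroʳ (suc (suc k)) ⟩
    0 ≡⟨ cong (1 *_) (k>n⇒nCk≡0 {0} {suc k} z<s) ⟨
    1 * (0 C suc k) ∎
  C-absorb (suc n) zero    = begin
    1 * (suc (suc n) C 1) ≡⟨ *-identityˡ _ ⟩
    suc (suc n) C 1 ≡⟨ nC1≡n (suc (suc n)) ⟩
    suc (suc n) ≡⟨ *-identityʳ (suc (suc n)) ⟨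
    suc (suc n) * 1 ∎
  C-absorb (suc n) (suc k) = begin
    K * (suc (suc n) C K) ≡⟨ cong (K *_) (nCk+nC[k+1]≡[n+1]C[k+1] (suc n) (suc k)) ⟨
    K * (c + (suc n C K)) ≡⟨ *-distribˡ-+ K c _ ⟩
    c + suc k * c + K * (suc n C K) ≡⟨ cong₂ (λ a b → c + a + b) (C-absorb n k) (C-absorb n (suc k)) ⟩
    c + suc n * (n C k) + suc n * (n C suc k) ≡⟨ +-assoc c _ _ ⟩
    c + (suc n * (n C k) + suc n * (n C suc k)) ≡⟨ cong (c +_) (*-distribˡ-+ (suc n) (n C k) _) ⟨
    c + suc n * ((n C k) + (n C suc k)) ≡⟨ cong (λ z → c + suc n * z) (nCk+nC[k+1]≡[n+1]C[k+1] n k) ⟩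
    suc (suc n) * c ∎
    where
    K c : ℕ
    K = suc (suc k)
    c = suc n C suc k

  p∣pCk : ∀ {n k} → Prime (suc n) → k < n → suc n ∣ suc n C suc k
  p∣pCk {n} {k} pr k<n with euclidsLemma (suc k) (suc n C suc k) pr
                              (subst (suc n ∣_) (sym (C-absorb n k)) (m∣m*n (n C k)))
  ... | inj₁ p∣k = contradiction (∣⇒≤ p∣k) (<⇒≱ (s<s k<n))
  ... | inj₂ p∣C = p∣C

-- Counting digit vectors of low weight.

module Chernoff where

  open import Data.Fin as Fin using (Fin; zero; suc; toℕ)
  open import Data.List using (List; []; _∷_; map; concatMap; allFin; tabulate; length)
  open import Data.List.Properties using (length-++; length-map)
  open import Data.List.Membership.Propositional using (_∈_)
  open import Data.List.Membership.Propositional.Properties using (∈-map⁺; ∈-concatMap⁺; ∈-allFin)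
  open import Data.List.Relation.Unary.Any using (here)
  import Data.List.Relation.Unary.Any as Any
  open import Data.Nat
  open import Data.Nat.Properties
  open import Data.Nat.Tactic.RingSolver using (solve-∀)
  open Powers using (^-distribʳ-*)
  open import Data.Vec using (Vec; []; _∷_)
  open import Function using (_∘_; id)
  open import Relation.Nullary using (yes; no; contradiction)
  open import Relation.Binary.PropositionalEquality
  import Data.Fin.Properties as Finₚ

  weight : ∀ {p q} → Vec (Fin p) q → ℕ
  weight []      = 0
  weight (a ∷ α) = toℕ a + weight α

  lowVecs : ∀ p q → ℕ → List (Vec (Fin p) q)
  branch : ∀ p q → ℕ → Fin p → List (Vec (Fin p) (suc q))

  lowVecs p zero    t = [] ∷ []
  lowVecs p (suc q) t = concatMap (branch p q t) (allFin p)

  branch p q t a with toℕ a ≤? t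
  ... | yes _ = map (a ∷_) (lowVecs p q (t ∸ toℕ a))
  ... | no  _ = []

  lowVecs-complete : ∀ {p q} t (α : Vec (Fin p) q) → weight α ≤ t → α ∈ lowVecs p q t
  lowVecs-complete t []      _ = here refl
  lowVecs-complete {p} {suc q} t (a ∷ α) w = ∈-concatMap⁺ (branch p q t) (Any.map (λ { refl → in-branch }) (∈-allFin a))
    where
    in-branch : (a ∷ α) ∈ branch p q t a
    in-branch with toℕ a ≤? t
    ... | yes _  = ∈-map⁺ (a ∷_) (lowVecs-complete (t ∸ toℕ a) α
                     (≤-trans (≤-reflexive (sym (m+n∸m≡n (toℕ a) (weight α)))) (∸-monoˡ-≤ (toℕ a) w)))
    ... | no a≰t = contradiction (≤-trans (m≤m+n (toℕ a) (weight α)) w) a≰t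

  Σ< : ∀ p → (Fin p → ℕ) → ℕ
  Σ< zero    f = 0
  Σ< (suc p) f = f zero + Σ< p (f ∘ suc)

  Σ<-mono : ∀ p {f g : Fin p → ℕ} → (∀ a → f a ≤ g a) → Σ< p f ≤ Σ< p g
  Σ<-mono zero    h = z≤n
  Σ<-mono (suc p) h = +-mono-≤ (h zero) (Σ<-mono p (h ∘ suc))

  Σ<-cong : ∀ p {f g : Fin p → ℕ} → (∀ a → f a ≡ g a) → Σ< p f ≡ Σ< p g
  Σ<-cong zero    h = refl
  Σ<-cong (suc p) h = cong₂ _+_ (h zero) (Σ<-cong p (h ∘ suc))

  Σ<-* : ∀ p (f : Fin p → ℕ) c → Σ< p f * c ≡ Σ< p (λ a → f a * c)
  Σ<-* zero    f c = refl
  Σ<-* (suc p) f c = trans (*-distribʳ-+ c (f zero) _) (cong (f zero * c +_) (Σ<-* p (f ∘ suc) c))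

  length-concatMap : ∀ {A : Set} p {B : Set} (e : Fin p → B) (f : B → List A) →
                     length (concatMap f (tabulate e)) ≡ Σ< p (length ∘ f ∘ e)
  length-concatMap zero    e f = refl
  length-concatMap (suc p) e f = trans (length-++ (f (e zero))) (cong (length (f (e zero)) +_) (length-concatMap p (e ∘ suc) f))

  module Weights (e : ℕ) where
    d : ℕ
    d = suc e

    -- `S n / d ^ n` is the generating function `1 + x + ... + x ^ n` of a single digit at
    -- `x = e / d`.
    S : ℕ → ℕ
    S n = Σ< (suc n) (λ a → e ^ toℕ a * d ^ (n ∸ toℕ a))

    -- Markov's inequality for the weight (e/d)^|α|, with both sides moved so that no division occurs.
    lowVecs-count : ∀ n q t → length (lowVecs (suc n) q t) * (e ^ t * d ^ (q * n)) ≤ S n ^ q * d ^ t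
    lowVecs-count n zero t = ≤-trans (≤-reflexive (trans (*-identityˡ _) (*-identityʳ (e ^ t))))
      (≤-trans (^-monoˡ-≤ t (n≤1+n e)) (≤-reflexive (sym (*-identityˡ (d ^ t)))))
    lowVecs-count n (suc q) t = begin
      length (lowVecs (suc n) (suc q) t) * c
        ≡⟨ cong (_* c) (length-concatMap (suc n) id (branch (suc n) q t)) ⟩
      Σ< (suc n) (length ∘ branch (suc n) q t) * c
        ≡⟨ Σ<-* (suc n) (length ∘ branch (suc n) q t) c ⟩
      Σ< (suc n) (λ a → length (branch (suc n) q t a) * c)
        ≤⟨ Σ<-mono (suc n) term ⟩
      Σ< (suc n) (λ a → e ^ toℕ a * d ^ (n ∸ toℕ a) * (S n ^ q * d ^ t))
        ≡⟨ Σ<-* (suc n) (λ a → e ^ toℕ a * d ^ (n ∸ toℕ a)) (S n ^ q * d ^ t) ⟨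
      S n * (S n ^ q * d ^ t) ≡⟨ *-assoc (S n) (S n ^ q) (d ^ t) ⟨
      S n ^ suc q * d ^ t ∎
      where
      open ≤-Reasoning
      c : ℕ
      c = e ^ t * d ^ (suc q * n)
      regroup : ∀ l x y u v w → l * (x * y * (u * v * w)) ≡ (x * u) * (l * (y * w) * v)
      regroup = solve-∀
      regroup' : ∀ x u s y v → (x * u) * (s * y * v) ≡ x * u * (s * (v * y))
      regroup' = solve-∀
      term : ∀ a → length (branch (suc n) q t a) * c ≤ e ^ toℕ a * d ^ (n ∸ toℕ a) * (S n ^ q * d ^ t)
      term a with toℕ a ≤? t
      ... | no  _   = z≤n
      ... | yes a≤t = begin
        length (map (a ∷_) L) * c ≡⟨ cong (_* c) (length-map (a ∷_) L) ⟩
        length L * c ≡⟨ cong (length L *_) (cong₂ _*_ e^t d^n) ⟩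
        length L * (e ^ i * e ^ (t ∸ i) * (d ^ (n ∸ i) * d ^ i * d ^ (q * n)))
          ≡⟨ regroup (length L) (e ^ i) (e ^ (t ∸ i)) (d ^ (n ∸ i)) (d ^ i) (d ^ (q * n)) ⟩
        (e ^ i * d ^ (n ∸ i)) * (length L * (e ^ (t ∸ i) * d ^ (q * n)) * d ^ i)
          ≤⟨ *-monoʳ-≤ (e ^ i * d ^ (n ∸ i)) (*-monoˡ-≤ (d ^ i) (lowVecs-count n q (t ∸ i))) ⟩
        (e ^ i * d ^ (n ∸ i)) * (S n ^ q * d ^ (t ∸ i) * d ^ i)
          ≡⟨ regroup' (e ^ i) (d ^ (n ∸ i)) (S n ^ q) (d ^ (t ∸ i)) (d ^ i) ⟩
        e ^ i * d ^ (n ∸ i) * (S n ^ q * (d ^ i * d ^ (t ∸ i)))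
          ≡⟨ cong (λ z → e ^ i * d ^ (n ∸ i) * (S n ^ q * z)) (trans (sym (^-distribˡ-+-* d i (t ∸ i))) (cong (d ^_) (m+[n∸m]≡n a≤t))) ⟩
        e ^ i * d ^ (n ∸ i) * (S n ^ q * d ^ t) ∎
        where
        i : ℕ
        i = toℕ a
        L : List (Vec (Fin (suc n)) q)
        L = lowVecs (suc n) q (t ∸ i)
        e^t : e ^ t ≡ e ^ i * e ^ (t ∸ i)
        e^t = trans (cong (e ^_) (sym (m+[n∸m]≡n a≤t))) (^-distribˡ-+-* e i (t ∸ i))
        d^n : d ^ (suc q * n) ≡ d ^ (n ∸ i) * d ^ i * d ^ (q * n)
        d^n = trans (^-distribˡ-+-* d n (q * n)) (cong (_* d ^ (q * n))
          (trans (cong (d ^_) (sym (m∸n+n≡m (s≤s⁻¹ (Finₚ.toℕ<n a))))) (^-distribˡ-+-* d (n ∸ i) i)))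

    -- The inequality of arithmetic and geometric means for `n` copies of `d ^ (n + 1)` and one of
    -- `e ^ (n + 1)`. The induction rests on `2 e d ≤ e² + d²`.
    mean : ∀ n → suc n * (e * d ^ n) ≤ n * d ^ suc n + e ^ suc n
    mean zero    = ≤-reflexive (lemma e)
      where
      lemma : ∀ e → 1 * (e * 1) ≡ e * 1
      lemma = solve-∀
    mean (suc n) = +-cancelʳ-≤ (n * (e * d ^ suc n)) _ _ (begin
      suc (suc n) * (e * d ^ suc n) + n * (e * d ^ suc n)  ≡⟨ collect n e (d ^ n) ⟩
      suc n * d ^ n * (2 * (e * d)) ≤⟨ *-monoʳ-≤ (suc n * d ^ n) (≤-trans (n≤1+n _) (≤-reflexive (square e))) ⟩
      suc n * d ^ n * (e * e + d * d) ≡⟨ expand n e (d ^ n) ⟩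
      e * (suc n * (e * d ^ n)) + suc n * d ^ suc (suc n)  ≤⟨ +-monoˡ-≤ (suc n * d ^ suc (suc n)) (*-monoʳ-≤ e (mean n)) ⟩
      e * (n * d ^ suc n + e ^ suc n) + suc n * d ^ suc (suc n) ≡⟨ rearrange n e (d ^ suc n) (e ^ suc n) ⟩
      suc n * d ^ suc (suc n) + e ^ suc (suc n) + n * (e * d ^ suc n) ∎)
      where
      open ≤-Reasoning
      square : ∀ e → suc (2 * (e * suc e)) ≡ e * e + suc e * suc e
      square = solve-∀
      collect : ∀ n e x → suc (suc n) * (e * (suc e * x)) + n * (e * (suc e * x)) ≡ suc n * x * (2 * (e * suc e))
      collect = solve-∀
      expand : ∀ n e x → suc n * x * (e * e + suc e * suc e) ≡ e * (suc n * (e * x)) + suc n * (suc e * (suc e * x))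
      expand = solve-∀
      rearrange : ∀ n e x y → e * (n * x + y) + suc n * (suc e * x) ≡ suc n * (suc e * x) + e * y + n * (e * x)
      rearrange = solve-∀

    S-suc : ∀ n → S (suc n) ≡ d ^ suc n + e * S n
    S-suc n = cong₂ _+_ (*-identityˡ (d ^ suc n)) (trans
      (Σ<-cong (suc n) λ a → trans (*-assoc e (e ^ toℕ a) (d ^ (n ∸ toℕ a))) (*-comm e (e ^ toℕ a * d ^ (n ∸ toℕ a))))
      (trans (sym (Σ<-* (suc n) (λ a → e ^ toℕ a * d ^ (n ∸ toℕ a)) e)) (*-comm _ e)))

    -- By convexity of `a ↦ e ^ a * d ^ (n - a)`, the average over `0 ≤ a ≤ n` is at most the
    -- average of the two end values.
    S-bound : ∀ n → 2 * S n ≤ suc n * (d ^ n + e ^ n)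
    S-bound zero    = ≤-refl
    S-bound (suc n) = begin
      2 * S (suc n) ≡⟨ cong (2 *_) (S-suc n) ⟩
      2 * (d ^ suc n + e * S n) ≡⟨ distribute (d ^ suc n) e (S n) ⟩
      2 * d ^ suc n + e * (2 * S n) ≤⟨ +-monoʳ-≤ (2 * d ^ suc n) (*-monoʳ-≤ e (S-bound n)) ⟩
      2 * d ^ suc n + e * (suc n * (d ^ n + e ^ n))  ≡⟨ split (d ^ suc n) e n (d ^ n) (e ^ n) ⟩
      2 * d ^ suc n + suc n * (e * e ^ n) + suc n * (e * d ^ n) ≤⟨ +-monoʳ-≤ (2 * d ^ suc n + suc n * (e * e ^ n)) (mean n) ⟩
      2 * d ^ suc n + suc n * (e * e ^ n) + (n * d ^ suc n + e ^ suc n) ≡⟨ collect n (d ^ suc n) (e ^ suc n) ⟩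
      suc (suc n) * (d ^ suc n + e ^ suc n) ∎
      where
      open ≤-Reasoning
      distribute : ∀ x e s → 2 * (x + e * s) ≡ 2 * x + e * (2 * s)
      distribute = solve-∀
      split : ∀ x e n a b → 2 * x + e * (suc n * (a + b)) ≡ 2 * x + suc n * (e * b) + suc n * (e * a)
      split = solve-∀
      collect : ∀ n x y → 2 * x + suc n * y + (n * x + y) ≡ suc (suc n) * (x + y)
      collect = solve-∀

    -- `(1 - 1/d) ^ k ≥ 1 - k/d` with denominators cleared.
    bernoulli : ∀ k → d ^ k * d ≤ e ^ k * d + k * d ^ k
    bernoulli zero    = m≤m+n (1 * d) 0
    bernoulli (suc k) = begin
      d ^ suc k * d ≡⟨ split e (d ^ k) ⟩
      e * (d ^ k * d) + d ^ suc k ≤⟨ +-monoˡ-≤ (d ^ suc k) (*-monoʳ-≤ e (bernoulli k)) ⟩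
      e * (e ^ k * d + k * d ^ k) + d ^ suc k ≤⟨ m≤m+n _ (k * d ^ k) ⟩
      e * (e ^ k * d + k * d ^ k) + d ^ suc k + k * d ^ k ≡⟨ collect e k (e ^ k) (d ^ k) ⟩
      e ^ suc k * d + suc k * d ^ suc k ∎
      where
      open ≤-Reasoning
      split : ∀ e x → suc e * x * suc e ≡ e * (x * suc e) + suc e * x
      split = solve-∀
      collect : ∀ e k y x → e * (y * suc e + k * x) + suc e * x + k * x ≡ e * y * suc e + suc k * (suc e * x)
      collect = solve-∀

  cube : ℕ → ℕ
  cube x = x * x * x

  -- For b < a ≤ 2b the difference is (a − b)(b² + 4ab − a²) > 0.
  cube-gap : ∀ {a b} → b < a → a ≤ 2 * b → cube (a + b) < 8 * (a * a * b)
  cube-gap {a} {b} b<a a≤2b = subst (λ a → cube (a + b) < 8 * (a * a * b)) (m+[n∸m]≡n (<⇒≤ b<a)) (go (a ∸ b) (m<n⇒0<n∸m b<a) c≤b)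
    where
    open ≤-Reasoning
    c≤b : a ∸ b ≤ b
    c≤b = ≤-trans (∸-monoˡ-≤ b a≤2b) (≤-reflexive (trans (cong (λ z → b + z ∸ b) (+-identityʳ b)) (m+n∸n≡m b b)))
    left : ∀ b c → ((b + c) + b) * ((b + c) + b) * ((b + c) + b) ≡ 8 * (b * b * b) + 12 * (b * b * c) + 6 * (b * c * c) + c * c * c
    left = solve-∀
    right : ∀ b c → 8 * ((b + c) * (b + c) * b) ≡ 8 * (b * b * b) + 12 * (b * b * c) + 6 * (b * c * c) + (4 * (b * b * c) + 2 * (b * c * c))
    right = solve-∀
    go : ∀ c → 0 < c → c ≤ b → cube ((b + c) + b) < 8 * ((b + c) * (b + c) * b)
    go c 0<c c≤b = begin-strict
      cube ((b + c) + b) ≡⟨ left b c ⟩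
      X + c * c * c <⟨ +-monoʳ-< X (begin-strict
        c * c * c ≤⟨ *-monoˡ-≤ c (*-monoˡ-≤ c c≤b) ⟩
        b * c * c <⟨ m<m+n (b * c * c) (*-mono-≤ (*-mono-≤ (≤-trans 0<c c≤b) 0<c) 0<c) ⟩
        b * c * c + b * c * c ≡⟨ cong (b * c * c +_) (sym (+-identityʳ _)) ⟩
        2 * (b * c * c) ≤⟨ m≤n+m (2 * (b * c * c)) (4 * (b * b * c)) ⟩
        4 * (b * b * c) + 2 * (b * c * c) ∎) ⟩
      X + (4 * (b * b * c) + 2 * (b * c * c)) ≡⟨ right b c ⟨
      8 * ((b + c) * (b + c) * b) ∎
      where
      X : ℕ
      X = 8 * (b * b * b) + 12 * (b * b * c) + 6 * (b * c * c)

  cube-mono : ∀ {x y} → x ≤ y → cube x ≤ cube y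
  cube-mono l = *-mono-≤ (*-mono-≤ l l) l

  cube-* : ∀ x y → cube (x * y) ≡ cube x * cube y
  cube-* x y = lemma x y
    where
    lemma : ∀ x y → x * y * (x * y) * (x * y) ≡ x * x * x * (y * y * y)
    lemma = solve-∀

  cube-^ : ∀ x q → cube (x ^ q) ≡ cube x ^ q
  cube-^ x q = sym (trans (^-distribʳ-* (x * x) x q) (cong (_* x ^ q) (^-distribʳ-* x x q)))

  cube-x^ : ∀ x t → cube (x ^ t) ≡ x ^ (3 * t)
  cube-x^ x t = trans (lemma (x ^ t)) (trans (^-*-assoc x t 3) (cong (x ^_) (*-comm t 3)))
    where
    lemma : ∀ x → x * x * x ≡ x * (x * (x * 1))
    lemma = solve-∀

  module Rate (k : ℕ) where
    -- The modulus is p = n + 1, and d / e = 2n / (2n − 1).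
    n e : ℕ
    n = suc k
    e = suc (k + k)
    open Weights e

    a b P Q : ℕ
    a = d ^ n
    b = e ^ n
    P = cube (a + b)
    Q = 8 * (a * a * b)

    -- With `β = b/a = (1 - 1/(2n)) ^ n` the claim is `(1 + β)³ < 8 β`, true for `1/2 ≤ β < 1`. The
    -- lower bound on `β` is Bernoulli's inequality and the reason for `d = 2n`.
    P<Q : P < Q
    P<Q = cube-gap (^-monoˡ-< n (n<1+n e)) (*-cancelˡ-≤ n (+-cancelʳ-≤ (n * a) _ _ (begin
      n * a + n * a ≡⟨ double k a ⟩
      a * d ≤⟨ bernoulli n ⟩
      b * d + n * a ≡⟨ cong (_+ n * a) (double' k b) ⟩
      n * (2 * b) + n * a ∎)))
      where
      open ≤-Reasoning
      double : ∀ k a → suc k * a + suc k * a ≡ a * suc (suc (k + k))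
      double = solve-∀
      double' : ∀ k b → b * suc (suc (k + k)) ≡ suc k * (2 * b)
      double' = solve-∀

    -- With `x = e/d`, `lowVecs-count` gives `L ≤ (S n / d ^ n) ^ q * x ^ (-t)`. As `3 t ≤ q n`,
    -- cubing allows `x ^ (-3t)` to be replaced by `x ^ (-q n)`. By `S-bound` each coordinate then
    -- contributes at most `p³ (1 + β)³ / (8 β) = p³ P / Q`, where `β = b/a`.
    lowVecs-rate : ∀ q t → 3 * t ≤ q * n → cube (length (lowVecs (suc n) q t)) * Q ^ q ≤ (cube (suc n) * P) ^ q
    lowVecs-rate q t 3t≤ = begin
      cube L * Q ^ q ≡⟨ cong (cube L *_) Q^q ⟩
      cube L * (8 ^ q * (D * D * E)) ≡⟨ swap (cube L) (8 ^ q) (D * D * E) ⟩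
      8 ^ q * (cube L * (D * D * E)) ≤⟨ *-monoʳ-≤ (8 ^ q) cancelled ⟩
      8 ^ q * cube (S n ^ q) ≡⟨ cong (8 ^ q *_) (cube-^ (S n) q) ⟩
      8 ^ q * cube (S n) ^ q ≡⟨ ^-distribʳ-* 8 (cube (S n)) q ⟨
      (8 * cube (S n)) ^ q ≡⟨ cong (_^ q) (cube-* 2 (S n)) ⟨
      cube (2 * S n) ^ q ≤⟨ ^-monoˡ-≤ q (cube-mono (S-bound n)) ⟩
      cube (suc n * (a + b)) ^ q ≡⟨ cong (_^ q) (cube-* (suc n) (a + b)) ⟩
      (cube (suc n) * P) ^ q ∎
      where
      open ≤-Reasoning
      L D E u : ℕ
      L = length (lowVecs (suc n) q t)
      D = d ^ (q * n)
      E = e ^ (q * n)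
      u = q * n ∸ 3 * t
      swap : ∀ x y z → x * (y * z) ≡ y * (x * z)
      swap = solve-∀
      power : ∀ x → (x ^ n) ^ q ≡ x ^ (q * n)
      power x = trans (^-*-assoc x n q) (cong (x ^_) (*-comm n q))
      Q^q : Q ^ q ≡ 8 ^ q * (D * D * E)
      Q^q = trans (^-distribʳ-* 8 (a * a * b) q) (cong (8 ^ q *_) (trans (^-distribʳ-* (a * a) b q)
        (cong₂ _*_ (trans (^-distribʳ-* a a q) (cong₂ _*_ (power d) (power d))) (power e))))
      regroup : ∀ l x y D → l * (D * D * (x * y)) * D ≡ l * (x * (D * D * D)) * y
      regroup = solve-∀
      split : ∀ x → x ^ (q * n) ≡ x ^ (3 * t) * x ^ u
      split x = trans (cong (x ^_) (sym (m+[n∸m]≡n 3t≤))) (^-distribˡ-+-* x (3 * t) u)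
      instance
        D≢0 : NonZero D
        D≢0 = m^n≢0 d (q * n)
      cancelled : cube L * (D * D * E) ≤ cube (S n ^ q)
      cancelled = *-cancelʳ-≤ _ _ D (begin
        cube L * (D * D * E) * D ≡⟨ cong (λ z → cube L * (D * D * z) * D) (split e) ⟩
        cube L * (D * D * (e ^ (3 * t) * e ^ u)) * D ≡⟨ regroup (cube L) (e ^ (3 * t)) (e ^ u) D ⟩
        cube L * (e ^ (3 * t) * cube D) * e ^ u ≡⟨ cong (λ z → cube L * (z * cube D) * e ^ u) (cube-x^ e t) ⟨
        cube L * (cube (e ^ t) * cube D) * e ^ u ≡⟨ cong (_* e ^ u) (trans (cong (cube L *_) (sym (cube-* (e ^ t) D))) (sym (cube-* L (e ^ t * D)))) ⟩
        cube (L * (e ^ t * D)) * e ^ u ≤⟨ *-mono-≤ (cube-mono (lowVecs-count n q t)) (^-monoˡ-≤ u (n≤1+n e)) ⟩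
        cube (S n ^ q * d ^ t) * d ^ u ≡⟨ cong (_* d ^ u) (trans (cube-* (S n ^ q) (d ^ t)) (cong (cube (S n ^ q) *_) (cube-x^ d t))) ⟩
        cube (S n ^ q) * d ^ (3 * t) * d ^ u ≡⟨ *-assoc (cube (S n ^ q)) _ _ ⟩
        cube (S n ^ q) * (d ^ (3 * t) * d ^ u) ≡⟨ cong (cube (S n ^ q) *_) (split d) ⟨
        cube (S n ^ q) * D ∎)

-- Coordinates along torsion generators.

module Coordinates where

  open Groups
  open import Data.Fin using (Fin; toℕ)
  open import Data.Nat using (ℕ; _*_; _^_; _≤_)
  open import Data.Vec using (Vec; []; _∷_)
  open import Data.Vec.Relation.Unary.All using (All)
  open import Relation.Binary.PropositionalEquality using (_≡_)

  module _ (G : FinGroup) where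
    open FinGroup G

    cmb : ∀ {p r} → Vec (Fin p) r → Vec C r → C
    cmb []       []       = 𝟘
    cmb (d ∷ ds) (g ∷ gs) = toℕ d · g ⊕ cmb ds gs

    -- `volume` says that the labelling by cosets and digits is economical: it bounds the number
    -- `s * p ^ r` of labels, a small fraction of which will be of low weight, by the group order.
    record Coords (p : ℕ) : Set where
      field
        {r s}     : ℕ
        gens      : Vec C r
        reps      : Fin s → C
        coset     : C → Fin s
        digits    : C → Vec (Fin p) r
        decompose : ∀ x → x ≡ reps (coset x) ⊕ cmb (digits x) gens
        torsion   : All (λ g → p · g ≡ 𝟘) gens
        volume    : s * p ^ r ≤ size

-- Finite differences and degree modulo `p`.

open Groups
open import Data.Nat as ℕ using (ℕ; zero; suc)
open import Data.Nat.Primality using (Prime)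

module Differences (G : FinGroup) (n : ℕ) (prime : Prime (suc n)) where

  open Binom
  open Sums
  open import Data.Fin as Fin using (Fin; zero; suc; toℕ; fromℕ)
  import Data.Fin.Properties as Finₚ
  open import Data.Integer using (ℤ; 0ℤ; 1ℤ; +_; _+_; _*_; _-_; -_)
  open import Data.Integer.Properties
  open import Data.Integer.Divisibility.Signed
  open import Data.Integer.Tactic.RingSolver using (solve-∀)
  open import Data.List using (List; []; _∷_; allFin)
  import Data.Nat.Properties as ℕₚ
  open import Data.Nat.Combinatorics using (_C_; nCn≡1; nCk+nC[k+1]≡[n+1]C[k+1])
  open import Data.Nat.Combinatorics.Specification using (k>n⇒nCk≡0)
  open import Data.Product using (_,_)
  open import Data.Vec using (Vec; []; _∷_)
  open import Data.Vec.Membership.Propositional using (_∈_)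
  open import Data.Vec.Relation.Unary.All as All using (All; []; _∷_)
  open import Data.Vec.Relation.Unary.Any using (here; there)
  open import Function using (_∘_)
  open import Relation.Nullary using (yes; no; contradiction)
  open import Relation.Binary.PropositionalEquality
  open FinGroup G hiding (interchange; _≟_) renaming (C to X)

  private
    variable
      A : Set
      r : ℕ
      P : X → Set
      f f' : X → ℤ

  p : ℕ
  p = suc n

  ∣0 : ∀ {d} → d ∣ 0ℤ
  ∣0 = divides 0ℤ refl

  D : X → (X → ℤ) → (X → ℤ)
  D g f x = f (x ⊕ g) - f x

  D-cong : ∀ g → (∀ x → f x ≡ f' x) → ∀ x → D g f x ≡ D g f' x
  D-cong g e x = cong₂ _-_ (e (x ⊕ g)) (e x)

  D-comm : ∀ g h (f : X → ℤ) x → D g (D h f) x ≡ D h (D g f) x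
  D-comm g h f x rewrite xy∙z≈xz∙y x g h = rearrange (f (x ⊕ h ⊕ g)) (f (x ⊕ g)) (f (x ⊕ h)) (f x)
    where
    rearrange : ∀ a b c d → (a - b) - (c - d) ≡ (a - c) - (b - d)
    rearrange = solve-∀

  -- Nil P k f says that f has degree < k modulo p along the directions in P.
  Nil : (X → Set) → ℕ → (X → ℤ) → Set
  Nil P zero    f = ∀ x → + p ∣ f x
  Nil P (suc k) f = ∀ g → P g → Nil P k (D g f)

  Nil-resp : ∀ k → (∀ x → f x ≡ f' x) → Nil P k f → Nil P k f'
  Nil-resp zero    e h x    = subst (+ p ∣_) (e x) (h x)
  Nil-resp (suc k) e h g Pg = Nil-resp k (D-cong g e) (h g Pg)

  Nil-divisible : ∀ k → (∀ x → + p ∣ f x) → Nil P k f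
  Nil-divisible zero    h      = h
  Nil-divisible (suc k) h g Pg = Nil-divisible k (λ x → ∣m∣n⇒∣m-n (h (x ⊕ g)) (h x))

  Nil-suc : ∀ k → Nil P k f → Nil P (suc k) f
  Nil-suc zero    h      = Nil-divisible 1 h
  Nil-suc (suc k) h g Pg = Nil-suc k (h g Pg)

  Nil-mono : ∀ {k k'} → k ℕ.≤ k' → Nil P k f → Nil P k' f
  Nil-mono {k' = k'} ℕ.z≤n   h      = Nil-divisible k' h
  Nil-mono           (ℕ.s≤s l) h g Pg = Nil-mono l (h g Pg)

  Nil-+ : ∀ k → Nil P k f → Nil P k f' → Nil P k (λ x → f x + f' x)
  Nil-+ zero    h h' x = ∣m∣n⇒∣m+n (h x) (h' x)
  Nil-+ {f = f} {f'} (suc k) h h' g Pg =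
    Nil-resp k (λ x → rearrange (f (x ⊕ g)) (f x) (f' (x ⊕ g)) (f' x)) (Nil-+ k (h g Pg) (h' g Pg))
    where
    rearrange : ∀ a b c d → (a - b) + (c - d) ≡ (a + c) - (b + d)
    rearrange = solve-∀

  Nil-* : ∀ k c → Nil P k f → Nil P k (λ x → c * f x)
  Nil-* zero    c h x = ∣n⇒∣m*n c (h x)
  Nil-* {f = f} (suc k) c h g Pg =
    Nil-resp k (λ x → distrib c (f (x ⊕ g)) (f x)) (Nil-* k c (h g Pg))
    where
    distrib : ∀ c a b → c * (a - b) ≡ c * a - c * b
    distrib = solve-∀

  Nil-Σ : ∀ k (xs : List A) {F : A → X → ℤ} → (∀ a → Nil P k (F a)) → Nil P k (λ x → ΣL xs (λ a → F a x))
  Nil-Σ k []       h = Nil-divisible k (λ _ → ∣0)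
  Nil-Σ k (a ∷ xs) h = Nil-+ k (h a) (Nil-Σ k xs h)

  Nil-shift : ∀ k y → Nil P k f → Nil P k (λ x → f (x ⊕ y))
  Nil-shift zero    y h x = h (x ⊕ y)
  Nil-shift {f = f} (suc k) y h g Pg =
    Nil-resp k (λ x → cong (λ z → f z - f (x ⊕ y)) (xy∙z≈xz∙y x y g)) (Nil-shift k y (h g Pg))

  Nil-D : ∀ k h → Nil P k f → Nil P k (D h f)
  Nil-D {f = f} k h nf =
    Nil-resp k (λ x → cong (_+_ (f (x ⊕ h))) (-1*i≡-i (f x))) (Nil-+ k (Nil-shift k h nf) (Nil-* k (- 1ℤ) nf))

  iterD : ℕ → X → (X → ℤ) → (X → ℤ)
  iterD zero    g f = f
  iterD (suc j) g f = iterD j g (D g f)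

  iterD-cong : ∀ j g → (∀ x → f x ≡ f' x) → ∀ x → iterD j g f x ≡ iterD j g f' x
  iterD-cong zero    g e = e
  iterD-cong (suc j) g e = iterD-cong j g (D-cong g e)

  iterD-D : ∀ j g h (f : X → ℤ) x → iterD j g (D h f) x ≡ D h (iterD j g f) x
  iterD-D zero    g h f x = refl
  iterD-D (suc j) g h f x = trans (iterD-cong j g (D-comm g h f) x) (iterD-D j g h (D g f) x)

  Nil-iterD : ∀ {g k} j → P g → Nil P (j ℕ.+ k) f → Nil P k (iterD j g f)
  Nil-iterD zero    Pg h = h
  Nil-iterD (suc j) Pg h = Nil-iterD j Pg (h _ Pg)

  -- Translation by `g` is `1 + D g`, and this is the binomial expansion of its `d`-th power. The
  -- range runs up to `m ≥ d`, past the last nonzero coefficient, so that the index set does not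
  -- depend on the digit `d`.
  taylor : ∀ m d → d ℕ.≤ m → ∀ (f : X → ℤ) x g →
           f (x ⊕ d · g) ≡ ΣL (allFin (suc m)) (λ a → + (d C toℕ a) * iterD (toℕ a) g f x)
  taylor m zero _ f x g = sym (trans
    (Σ-single {suc m} zero F λ { zero ne → contradiction refl ne
                       ; (suc i) _ → cong (λ c → + c * iterD (suc (toℕ i)) g f x) (k>n⇒nCk≡0 {0} {suc (toℕ i)} ℕ.z<s) })
    (trans (*-identityˡ (f x)) (cong f (sym (identityʳ x)))))
    where
    F : Fin (suc m) → ℤ
    F a = + (0 C toℕ a) * iterD (toℕ a) g f x
  taylor (suc m) (suc d) (ℕ.s≤s d≤m) f x g = begin
    f (x ⊕ (g ⊕ d · g)) ≡⟨ cong f (trans (sym (assoc x g (d · g))) (xy∙z≈xz∙y x g (d · g))) ⟩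
    f (x ⊕ d · g ⊕ g) ≡⟨ split (f (x ⊕ d · g ⊕ g)) (f (x ⊕ d · g)) ⟩
    D g f (x ⊕ d · g) + f (x ⊕ d · g) ≡⟨ cong₂ _+_ (taylor m d d≤m (D g f) x g)
                                                       (taylor (suc m) d (ℕₚ.m≤n⇒m≤1+n d≤m) f x g) ⟩
    ΣL (allFin (suc m)) F + ΣL (allFin (suc (suc m))) H  ≡⟨ cong (_+_ (ΣL (allFin (suc m)) F)) (Σ-suc (suc m) H) ⟩
    ΣL (allFin (suc m)) F + (H zero + ΣL (allFin (suc m)) (H ∘ suc))
                                                 ≡⟨ rearrange (ΣL (allFin (suc m)) F) (H zero) _ ⟩
    H zero + (ΣL (allFin (suc m)) F + ΣL (allFin (suc m)) (H ∘ suc))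
                                                 ≡⟨ cong (_+_ (H zero)) (Σ-+ (allFin (suc m)) F (H ∘ suc)) ⟨
    H zero + ΣL (allFin (suc m)) (λ a → F a + H (suc a))
                                                 ≡⟨ cong (_+_ (H zero)) (Σ-cong (allFin (suc m)) pascal) ⟩
    K zero + ΣL (allFin (suc m)) (K ∘ suc) ≡⟨ Σ-suc (suc m) K ⟨
    ΣL (allFin (suc (suc m))) K ∎
    where
    open ≡-Reasoning
    F : Fin (suc m) → ℤ
    F a = + (d C toℕ a) * iterD (toℕ a) g (D g f) x
    H K : Fin (suc (suc m)) → ℤ
    H a = + (d C toℕ a) * iterD (toℕ a) g f x
    K a = + (suc d C toℕ a) * iterD (toℕ a) g f x
    split : ∀ a b → a ≡ (a - b) + b
    split = solve-∀
    rearrange : ∀ a b c → a + (b + c) ≡ b + (a + c)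
    rearrange = solve-∀
    pascal : ∀ a → F a + H (suc a) ≡ K (suc a)
    pascal a = trans (sym (*-distribʳ-+ (iterD (toℕ a) g (D g f) x) (+ (d C toℕ a)) (+ (d C suc (toℕ a)))))
      (cong (λ c → + c * iterD (toℕ a) g (D g f) x) (nCk+nC[k+1]≡[n+1]C[k+1] d (toℕ a)))

  ∣Σ⇒∣ : ∀ {d m} (k : Fin m) (F : Fin m → ℤ) → (∀ i → i ≢ k → d ∣ F i) → d ∣ ΣL (allFin m) F → d ∣ F k
  ∣Σ⇒∣ {d} {m} k F h hΣ = ∣m+n∣m⇒∣n {m = ΣL (allFin m) F - F k} (subst (d ∣_) (sym (cancel (ΣL (allFin m) F) (F k))) hΣ)
    (subst (d ∣_) (trans (Σ-− (allFin m) F δ) (cong (λ z → ΣL (allFin m) F - z) (trans (Σ-single k δ δ-off) δ-on)))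
      (Σ-∣ (allFin m) term))
    where
    cancel : ∀ a b → (a - b) + b ≡ a
    cancel = solve-∀
    δ : Fin m → ℤ
    δ i with i Fin.≟ k
    ... | yes _ = F i
    ... | no  _ = 0ℤ
    δ-off : ∀ i → i ≢ k → δ i ≡ 0ℤ
    δ-off i ne with i Fin.≟ k
    ... | yes e = contradiction e ne
    ... | no  _ = refl
    δ-on : δ k ≡ F k
    δ-on with k Fin.≟ k
    ... | yes _ = refl
    ... | no ne = contradiction refl ne
    term : ∀ i → d ∣ F i - δ i
    term i with i Fin.≟ k
    ... | yes _ = subst (d ∣_) (sym (i≡j⇒i-j≡0 (refl {x = F i}))) ∣0
    ... | no ne = subst (d ∣_) (sym (+-identityʳ (F i))) (h i ne)

  -- Taylor's formula at p · g = 0 expresses D^p f through multiples of p.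
  iterD-p : ∀ g → p · g ≡ 𝟘 → ∀ (f : X → ℤ) x → + p ∣ iterD p g f x
  iterD-p g pg≡0 f x = subst (+ p ∣_) on-top (∣Σ⇒∣ (fromℕ n) F off-top (subst (+ p ∣_) (sym sum≡0) ∣0))
    where
    F : Fin p → ℤ
    F a = + (p C suc (toℕ a)) * iterD (suc (toℕ a)) g f x
    on-top : F (fromℕ n) ≡ iterD p g f x
    on-top = trans (cong (λ k → + (p C suc k) * iterD (suc k) g f x) (Finₚ.toℕ-fromℕ n))
      (trans (cong (λ c → + c * iterD p g f x) (nCn≡1 p)) (*-identityˡ _))
    off-top : ∀ i → i ≢ fromℕ n → + p ∣ F i
    off-top i ne = ∣m⇒∣m*n {m = + (p C suc (toℕ i))} (iterD (suc (toℕ i)) g f x) (∣ᵤ⇒∣ (p∣pCk prime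
      (ℕₚ.≤∧≢⇒< (ℕ.s≤s⁻¹ (Finₚ.toℕ<n i)) λ e → ne (Finₚ.toℕ-injective (trans e (sym (Finₚ.toℕ-fromℕ n)))))))
    sum≡0 : ΣL (allFin p) F ≡ 0ℤ
    sum≡0 = +-cancelˡ (f x) (trans (sym (trans (cong f (sym (trans (cong (x ⊕_) pg≡0) (identityʳ x))))
      (trans (taylor p p ℕₚ.≤-refl f x g) (trans (Σ-suc p (λ a → + (p C toℕ a) * iterD (toℕ a) g f x))
        (cong (λ z → z + ΣL (allFin p) F) (*-identityˡ (f x)))))))
      (sym (+-identityʳ (f x))))
      where
      +-cancelˡ : ∀ a {b c} → a + b ≡ a + c → b ≡ c
      +-cancelˡ a {b} {c} e = trans (undo a b) (trans (cong (λ z → - a + z) e) (sym (undo a c)))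
        where
        undo : ∀ a b → b ≡ - a + (a + b)
        undo = solve-∀

  -- Differences commute, so the pigeonhole principle applies to directions: among `k + j + 1`
  -- differences along `g ∷ gs`, either `j + 1` are along `g` or `k + 1` along `gs`.
  Nil-∷ : ∀ {g} {gs : Vec X r} k j → Nil (_∈ gs) (suc k) f → (∀ x → + p ∣ iterD (suc j) g f x) →
          Nil (_∈ g ∷ gs) (suc (k ℕ.+ j)) f
  Nil-∷ k zero h hj _ (here refl) = Nil-divisible (k ℕ.+ 0) hj
  Nil-∷ {f = f} {g} {gs} k (suc j) h hj _ (here refl) =
    subst (λ m → Nil (_∈ g ∷ gs) m (D g f)) (sym (ℕₚ.+-suc k j)) (Nil-∷ {f = D g f} k j (Nil-D {f = f} (suc k) g h) hj)
  Nil-∷ zero j h hj g' (there g'∈) = Nil-divisible j (h g' g'∈)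
  Nil-∷ {f = f} {g} (suc k) j h hj g' (there g'∈) =
    Nil-∷ {f = D g' f} k j (h g' g'∈) (λ x → subst (+ p ∣_) (sym (iterD-D (suc j) g g' f x)) (∣m∣n⇒∣m-n (hj (x ⊕ g')) (hj x)))

  Nil-all : (gs : Vec X r) → All (λ g → p · g ≡ 𝟘) gs → ∀ f → Nil (_∈ gs) (suc (r ℕ.* n)) f
  Nil-all []       []         f g ()
  Nil-all {suc r} (g ∷ gs) (pg ∷ pgs) f =
    subst (λ m → Nil (_∈ g ∷ gs) (suc m) f) (ℕₚ.+-comm (r ℕ.* n) n) (Nil-∷ {f = f} (r ℕ.* n) n (Nil-all gs pgs f) (iterD-p g pg f))

-- Convolution operators and their effect on the degree.

open Coordinates
open Groups
open import Data.Nat as ℕ using (ℕ; suc)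
open import Data.Nat.Primality using (Prime)

module Operators (G : FinGroup) (n : ℕ) (prime : Prime (suc n)) (K : Coords G (suc n)) where

  open Chernoff using (weight)
  open Sums
  open import Data.Fin as Fin using (Fin; zero; suc; toℕ)
  import Data.Fin.Properties as Finₚ
  open import Data.Integer using (ℤ; 0ℤ; 1ℤ; +_; _+_; _*_; _-_; -_)
  open import Data.Integer.Properties
  open import Data.Integer.Divisibility.Signed
  open import Data.Integer.Tactic.RingSolver using (solve-∀)
  open import Data.List using (List; []; _∷_; allFin; cartesianProduct; map)
  import Data.Nat.Properties as ℕₚ
  open import Data.Nat.Combinatorics using (_C_)
  open import Data.Product using (_,_)
  open import Data.Vec using (Vec; []; _∷_)
  open import Data.Vec.Membership.Propositional using (_∈_)
  open import Data.Vec.Relation.Unary.All as All using (All; []; _∷_)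
  open import Data.Vec.Relation.Unary.Any using (here; there)
  open import Relation.Nullary using (Dec; yes; no; contradiction)
  open import Relation.Binary.PropositionalEquality
  open FinGroup G hiding (interchange; _≟_) renaming (C to X)
  open Coords K
  open Differences G n prime

  private
    variable
      A B : Set
      q : ℕ

  allV : ∀ q → List (Vec (Fin p) q)
  allV ℕ.zero = [] ∷ []
  allV (suc q) = map (λ (a , as) → a ∷ as) (cartesianProduct (allFin p) (allV q))

  Σ-allV : ∀ q (F : Vec (Fin p) (suc q) → ℤ) → ΣL (allV (suc q)) F ≡ ΣL (allFin p) (λ a → ΣL (allV q) (λ α → F (a ∷ α)))
  Σ-allV q F = trans (Σ-map (cartesianProduct (allFin p) (allV q)) _ F) (Σ-× (allFin p) (allV q) _)

  binomial : Vec (Fin p) q → Vec (Fin p) q → ℤ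
  binomial []       []       = 1ℤ
  binomial (d ∷ ds) (a ∷ α) = + (toℕ d C toℕ a) * binomial ds α

  Dv : Vec X q → Vec (Fin p) q → (X → ℤ) → (X → ℤ)
  Dv []       []      f = f
  Dv (g ∷ gs) (a ∷ α) f = iterD (toℕ a) g (Dv gs α f)

  Dv-cong : ∀ (gs : Vec X q) α {f f' : X → ℤ} → (∀ x → f x ≡ f' x) → ∀ x → Dv gs α f x ≡ Dv gs α f' x
  Dv-cong []       []      e = e
  Dv-cong (g ∷ gs) (a ∷ α) e = iterD-cong (toℕ a) g (Dv-cong gs α e)

  iterD-− : ∀ j g (f f' : X → ℤ) x → iterD j g (λ y → f y - f' y) x ≡ iterD j g f x - iterD j g f' x
  iterD-− ℕ.zero  g f f' x = refl
  iterD-− (suc j) g f f' x =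
    trans (iterD-cong j g (λ y → rearrange (f (y ⊕ g)) (f' (y ⊕ g)) (f y) (f' y)) x) (iterD-− j g (D g f) (D g f') x)
    where
    rearrange : ∀ a b c d → (a - b) - (c - d) ≡ (a - c) - (b - d)
    rearrange = solve-∀

  Dv-− : ∀ (gs : Vec X q) α (f f' : X → ℤ) x → Dv gs α (λ y → f y - f' y) x ≡ Dv gs α f x - Dv gs α f' x
  Dv-− []       []      f f' x = refl
  Dv-− (g ∷ gs) (a ∷ α) f f' x =
    trans (iterD-cong (toℕ a) g (Dv-− gs α f f') x) (iterD-− (toℕ a) g (Dv gs α f) (Dv gs α f') x)

  Nil-Dv : ∀ {P : X → Set} {f k} (gs : Vec X q) α → All P gs → Nil P (weight α ℕ.+ k) f → Nil P k (Dv gs α f)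
  Nil-Dv []       []      []         h = h
  Nil-Dv {P = P} {f} {k} (g ∷ gs) (a ∷ α) (Pg ∷ Pgs) h =
    Nil-iterD (toℕ a) Pg (Nil-Dv gs α Pgs (subst (λ m → Nil P m f) eq h))
    where
    eq : toℕ a ℕ.+ weight α ℕ.+ k ≡ weight α ℕ.+ (toℕ a ℕ.+ k)
    eq = trans (cong (ℕ._+ k) (ℕₚ.+-comm (toℕ a) (weight α))) (ℕₚ.+-assoc (weight α) (toℕ a) k)

  taylorV : ∀ (ds : Vec (Fin p) q) gs (f : X → ℤ) x →
            f (x ⊕ cmb G ds gs) ≡ ΣL (allV q) (λ α → binomial ds α * Dv gs α f x)
  taylorV []       []       f x = trans (cong f (identityʳ x)) (trans (sym (*-identityˡ (f x))) (sym (+-identityʳ _)))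
  taylorV {suc q} (d ∷ ds) (g ∷ gs) f x = begin
    f (x ⊕ (toℕ d · g ⊕ cmb G ds gs))  ≡⟨ cong f (assoc x _ _) ⟨
    f (x ⊕ toℕ d · g ⊕ cmb G ds gs) ≡⟨ taylorV ds gs f (x ⊕ toℕ d · g) ⟩
    ΣL (allV q) (λ α → binomial ds α * Dv gs α f (x ⊕ toℕ d · g))
      ≡⟨ Σ-cong (allV q) (λ α → cong (binomial ds α *_) (taylor n (toℕ d) (ℕ.s≤s⁻¹ (Finₚ.toℕ<n d)) (Dv gs α f) x g)) ⟩
    ΣL (allV q) (λ α → binomial ds α * ΣL (allFin p) (λ a → + (toℕ d C toℕ a) * iterD (toℕ a) g (Dv gs α f) x))
      ≡⟨ Σ-cong (allV q) (λ α → trans (Σ-*ˡ (allFin p) (binomial ds α) _) (Σ-cong (allFin p) λ a →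
           rearrange (binomial ds α) (+ (toℕ d C toℕ a)) (iterD (toℕ a) g (Dv gs α f) x))) ⟩
    ΣL (allV q) (λ α → ΣL (allFin p) (λ a → F (a ∷ α)))
      ≡⟨ Σ-swap (allV q) (allFin p) (λ α a → F (a ∷ α)) ⟩
    ΣL (allFin p) (λ a → ΣL (allV q) (λ α → F (a ∷ α)))
      ≡⟨ Σ-allV q F ⟨
    ΣL (allV (suc q)) F ∎
    where
    open ≡-Reasoning
    F : Vec (Fin p) (suc q) → ℤ
    F α = binomial (d ∷ ds) α * Dv (g ∷ gs) α f x
    rearrange : ∀ a b c → a * (b * c) ≡ (b * a) * c
    rearrange = solve-∀

  indicator : ∀ {ℓ} {P : Set ℓ} → Dec P → ℤ
  indicator (yes _) = 1ℤ
  indicator (no  _) = 0ℤ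

  -- The coordinates of translation by `x` in the operators that send `f` to `Dv gens α f`, shifted
  -- by `reps σ`. Extension by zero to all cosets gives every `x` the same index set, so that the
  -- sums in `Op-expand` can be exchanged.
  coefficient : X → Fin s → Vec (Fin p) r → ℤ
  coefficient x σ α = indicator (σ Fin.≟ coset x) * binomial (digits x) α

  expand : ∀ (f : X → ℤ) y x →
           f (y ⊕ x) ≡ ΣL (allFin s) (λ σ → ΣL (allV r) (λ α → coefficient x σ α * Dv gens α f (y ⊕ reps σ)))
  expand f y x = begin
    f (y ⊕ x) ≡⟨ cong (λ z → f (y ⊕ z)) (decompose x) ⟩
    f (y ⊕ (reps (coset x) ⊕ cmb G (digits x) gens)) ≡⟨ cong f (assoc y _ _) ⟨
    f (y ⊕ reps (coset x) ⊕ cmb G (digits x) gens) ≡⟨ taylorV (digits x) gens f (y ⊕ reps (coset x)) ⟩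
    ΣL (allV r) (λ α → binomial (digits x) α * Dv gens α f (y ⊕ reps (coset x)))
      ≡⟨ Σ-cong (allV r) (λ α → cong (_* Dv gens α f (y ⊕ reps (coset x))) (on α)) ⟨
    F (coset x) ≡⟨ Σ-single (coset x) F off ⟨
    ΣL (allFin s) F ∎
    where
    open ≡-Reasoning
    F : Fin s → ℤ
    F σ = ΣL (allV r) (λ α → coefficient x σ α * Dv gens α f (y ⊕ reps σ))
    on : ∀ α → coefficient x (coset x) α ≡ binomial (digits x) α
    on α with coset x Fin.≟ coset x
    ... | yes _ = *-identityˡ _
    ... | no ne = contradiction refl ne
    off : ∀ σ → σ ≢ coset x → F σ ≡ 0ℤ
    off σ ne = trans (Σ-cong (allV r) (λ α → zeroterm α)) (Σ-0 (allV r))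
      where
      zeroterm : ∀ α → coefficient x σ α * Dv gens α f (y ⊕ reps σ) ≡ 0ℤ
      zeroterm α with σ Fin.≟ coset x
      ... | yes e = contradiction e ne
      ... | no  _ = refl

  Op : List A → (A → X) → (A → ℤ) → (X → ℤ) → (X → ℤ)
  Op xs pos u f y = ΣL xs (λ a → u a * f (y ⊕ pos a))

  moment : List A → (A → X) → (A → ℤ) → Fin s → Vec (Fin p) r → ℤ
  moment xs pos u σ α = ΣL xs (λ a → u a * coefficient (pos a) σ α)

  -- These are linear conditions on `u` modulo `p`, one for each `σ` and each `α` of weight at most
  -- `t`.
  Low : ℕ → List A → (A → X) → (A → ℤ) → Set
  Low t xs pos u = ∀ σ α → weight α ℕ.≤ t → + p ∣ moment xs pos u σ α

  Op-expand : ∀ (xs : List A) pos u f y →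
    Op xs pos u f y ≡ ΣL (allFin s) (λ σ → ΣL (allV r) (λ α → moment xs pos u σ α * Dv gens α f (y ⊕ reps σ)))
  Op-expand xs pos u f y = begin
    ΣL xs (λ a → u a * f (y ⊕ pos a))
      ≡⟨ Σ-cong xs (λ a → trans (cong (u a *_) (expand f y (pos a)))
           (trans (Σ-*ˡ (allFin s) (u a) _) (Σ-cong (allFin s) λ σ → trans (Σ-*ˡ (allV r) (u a) _) (Σ-cong (allV r) λ α →
             sym (*-assoc (u a) _ _))))) ⟩
    ΣL xs (λ a → ΣL (allFin s) (λ σ → ΣL (allV r) (λ α → c a σ α * d σ α)))
      ≡⟨ Σ-swap xs (allFin s) _ ⟩
    ΣL (allFin s) (λ σ → ΣL xs (λ a → ΣL (allV r) (λ α → c a σ α * d σ α)))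
      ≡⟨ Σ-cong (allFin s) (λ σ → trans (Σ-swap xs (allV r) _) (Σ-cong (allV r) λ α → sym (Σ-*ʳ xs (d σ α) _))) ⟩
    ΣL (allFin s) (λ σ → ΣL (allV r) (λ α → moment xs pos u σ α * d σ α)) ∎
    where
    open ≡-Reasoning
    c : _ → Fin s → Vec (Fin p) r → ℤ
    c a σ α = u a * coefficient (pos a) σ α
    d : Fin s → Vec (Fin p) r → ℤ
    d σ α = Dv gens α f (y ⊕ reps σ)

  all-∈ : ∀ (gs : Vec X q) → All (_∈ gs) gs
  all-∈ []       = []
  all-∈ (g ∷ gs) = here refl ∷ All.map there (all-∈ gs)

  -- In the expansion of the operator, terms with `weight α ≤ t` have a coefficient divisible by
  -- `p`; each of the others takes at least `t + 1` differences.
  Op-Nil : ∀ {t k} (xs : List A) pos u {f} → Low t xs pos u → Nil (_∈ gens) (suc t ℕ.+ k) f → Nil (_∈ gens) k (Op xs pos u f)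
  Op-Nil {t = t} {k} xs pos u {f} low h =
    Nil-resp k (λ y → sym (Op-expand xs pos u f y)) (Nil-Σ k (allFin s) λ σ → Nil-Σ k (allV r) λ α → term σ α)
    where
    term : ∀ σ α → Nil (_∈ gens) k (λ y → moment xs pos u σ α * Dv gens α f (y ⊕ reps σ))
    term σ α with weight α ℕ.≤? t
    ... | yes w≤t = Nil-divisible k λ y → ∣m⇒∣m*n {m = moment xs pos u σ α} (Dv gens α f (y ⊕ reps σ)) (low σ α w≤t)
    ... | no  w≰t = Nil-* k (moment xs pos u σ α) (Nil-shift k (reps σ) (Nil-Dv gens α (all-∈ gens)
                      (Nil-mono (ℕₚ.+-monoˡ-≤ k (ℕₚ.≰⇒> w≰t)) h)))

  -- Expanding the translation by `z` at `𝟘` expresses `f z` through differences of `f` at the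
  -- representatives; those of weight above `t` vanish modulo `p` by the degree bound.
  vanishing : ∀ {t f} → Nil (_∈ gens) (suc t) f → (∀ σ α → weight α ℕ.≤ t → + p ∣ Dv gens α f (𝟘 ⊕ reps σ)) →
              ∀ z → + p ∣ f z
  vanishing {t} {f} h low z = subst (λ y → + p ∣ f y) (identityˡ z) (subst (+ p ∣_) (sym (expand f 𝟘 z))
    (Σ-∣ (allFin s) λ σ → Σ-∣ (allV r) λ α → ∣n⇒∣m*n (coefficient z σ α) (term σ α)))
    where
    term : ∀ σ α → + p ∣ Dv gens α f (𝟘 ⊕ reps σ)
    term σ α with weight α ℕ.≤? t
    ... | yes w≤t = low σ α w≤t
    ... | no  w≰t = Nil-Dv {k = 0} gens α (all-∈ gens)
                      (Nil-mono (ℕₚ.≤-trans (ℕₚ.≰⇒> w≰t) (ℕₚ.m≤m+n (weight α) 0)) h) (𝟘 ⊕ reps σ)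

  -- Both operators lower the degree by t + 1, and a function of degree at most t is determined by its low differences.
  product-vanishing : ∀ {t} → r ℕ.* n ℕ.< 3 ℕ.* suc t →
    (xs : List A) (pos : A → X) (u : A → ℤ) (ys : List B) (pos' : B → X) (v : B → ℤ) →
    Low t xs pos u → Low t ys pos' v → ∀ f →
    (∀ σ α → weight α ℕ.≤ t → + p ∣ Dv gens α (Op xs pos u (Op ys pos' v f)) (𝟘 ⊕ reps σ)) →
    ∀ z → + p ∣ Op xs pos u (Op ys pos' v f) z
  product-vanishing {t = t} big xs pos u ys pos' v lu lv f low =
    vanishing {f = Op xs pos u (Op ys pos' v f)}
      (Op-Nil xs pos u {Op ys pos' v f} lu (Op-Nil ys pos' v {f} lv (Nil-mono {f = f} big' (Nil-all gens torsion f)))) low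
    where
    big' : suc (r ℕ.* n) ℕ.≤ suc t ℕ.+ (suc t ℕ.+ suc t)
    big' = subst (suc (r ℕ.* n) ℕ.≤_) (cong (λ z → suc t ℕ.+ (suc t ℕ.+ z)) (ℕₚ.+-identityʳ (suc t))) big

-- Residues modulo `p`.

open import Data.Nat as ℕ using (ℕ; zero; suc)
open import Data.Nat.Primality using (Prime; euclidsLemma)

module Residues (n : ℕ) where

  open import Data.Fin as Fin using (Fin; zero; suc; toℕ; fromℕ<)
  import Data.Fin.Properties as Finₚ
  open import Data.Integer using (ℤ; +_; _+_; _*_; _-_; -_; ∣_∣)
  open import Data.Integer.DivMod using (_%ℕ_; _/ℕ_; n%ℕd<d; a≡a%ℕn+[a/ℕn]*n)
  open import Data.Integer.Properties
  open import Data.Integer.Divisibility.Signed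
  open import Data.Integer.Tactic.RingSolver using (solve-∀)
  import Data.Nat.Divisibility as ℕ∣
  import Data.Nat.Properties as ℕₚ
  open import Data.Sum using (inj₁; inj₂)
  open import Relation.Nullary using (¬_; contradiction)
  open import Relation.Binary.PropositionalEquality

  private
    p : ℕ
    p = suc n

  ι : Fin p → ℤ
  ι a = + toℕ a

  reduce : ℤ → Fin p
  reduce x = fromℕ< (n%ℕd<d x p)

  reduce-∣ : ∀ x → + p ∣ x - ι (reduce x)
  reduce-∣ x = divides (x /ℕ p) (trans (cong (λ z → x - + z) (Finₚ.toℕ-fromℕ< (n%ℕd<d x p)))
    (trans (cong (_- + (x %ℕ p)) (a≡a%ℕn+[a/ℕn]*n x p)) (cancel (+ (x %ℕ p)) (x /ℕ p * + p))))
    where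
    cancel : ∀ a b → (a + b) - a ≡ b
    cancel = solve-∀

  ι-injective : ∀ {a b} → + p ∣ ι a - ι b → a ≡ b
  ι-injective {a} {b} h = Finₚ.toℕ-injective (+-injective (i-j≡0⇒i≡j (ι a) (ι b) (∣i∣≡0⇒i≡0 (small _ (∣⇒∣ᵤ h) bound))))
    where
    bound : ∣ ι a - ι b ∣ ℕ.< p
    bound = ℕₚ.≤-<-trans (subst (λ z → ∣ z ∣ ℕ.≤ toℕ a ℕ.⊔ toℕ b) (sym (m-n≡m⊖n (toℕ a) (toℕ b)))
      (∣m⊝n∣≤m⊔n (toℕ a) (toℕ b))) (ℕₚ.⊔-lub (Finₚ.toℕ<n a) (Finₚ.toℕ<n b))
    small : ∀ m → p ℕ∣.∣ m → m ℕ.< p → m ≡ 0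
    small zero    _ _ = refl
    small (suc m) d l = contradiction (ℕ∣.∣⇒≤ d) (ℕₚ.<⇒≱ l)

  ∣-trans-− : ∀ {d} x y z → d ∣ x - y → d ∣ y - z → d ∣ x - z
  ∣-trans-− x y z h h' = subst (_ ∣_) (telescope x y z) (∣m∣n⇒∣m+n h h')
    where
    telescope : ∀ x y z → (x - y) + (y - z) ≡ x - z
    telescope = solve-∀

  ∣-sym-− : ∀ {d} x y → d ∣ x - y → d ∣ y - x
  ∣-sym-− x y h = subst (_ ∣_) (flip x y) (∣m⇒∣-m h)
    where
    flip : ∀ x y → - (x - y) ≡ y - x
    flip = solve-∀

  reduce-injective : ∀ x y → reduce x ≡ reduce y → + p ∣ x - y
  reduce-injective x y e = ∣-trans-− x (ι (reduce x)) y (reduce-∣ x)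
    (subst (λ z → + p ∣ ι z - y) (sym e) (∣-sym-− y _ (reduce-∣ y)))

  ι-nonzero : ∀ {a} → a ≢ zero → ¬ + p ∣ ι a
  ι-nonzero {a} ne h = ne (ι-injective (subst (+ p ∣_) (sym (+-identityʳ (ι a))) h))

  euclid : Prime p → ∀ x y → ¬ + p ∣ x → + p ∣ x * y → + p ∣ y
  euclid pr x y nx h with euclidsLemma ∣ x ∣ ∣ y ∣ pr (subst (p ℕ∣.∣_) (abs-* x y) (∣⇒∣ᵤ h))
  ... | inj₁ px = contradiction (∣ᵤ⇒∣ px) nx
  ... | inj₂ py = ∣ᵤ⇒∣ py

-- Functions between finite sets as numbers.

module FunToFin where

  open import Data.Fin using (Fin; zero; suc; combine; funToFin; finToFun)
  import Data.Fin.Properties as Finₚ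
  open import Data.Nat using (zero; suc)
  open import Function using (_∘_)
  open import Relation.Binary.PropositionalEquality

  funToFin-cong : ∀ {m N} {f g : Fin m → Fin N} → (∀ i → f i ≡ g i) → funToFin f ≡ funToFin g
  funToFin-cong {zero}  e = refl
  funToFin-cong {suc m} e = cong₂ combine (e zero) (funToFin-cong (e ∘ suc))

  funToFin-injective : ∀ {m N} {f g : Fin m → Fin N} → funToFin f ≡ funToFin g → ∀ i → f i ≡ g i
  funToFin-injective {f = f} {g} e i =
    trans (sym (Finₚ.finToFun-funToFin f i)) (trans (cong (λ z → finToFun z i) e) (Finₚ.finToFun-funToFin g i))

-- Encoding the pairs of matrices with product zero.

open import Data.Nat as ℕ using (ℕ; zero; suc; _^_; _∸_)
open import Data.Nat.Primality using (Prime)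

module ZeroProducts (n : ℕ) (prime : Prime (suc n)) where

  open Residues n
  open FunToFin
  open Sums
  open import Data.Fin as Fin using (Fin; zero; suc; funToFin; finToFun; punchIn; punchOut; combine; _↑ˡ_; _↑ʳ_)
  import Data.Fin.Properties as Finₚ
  open import Data.Integer using (ℤ; 0ℤ; +_; _+_; _*_; _-_; -_)
  open import Data.Integer.Properties
  open import Data.Integer.Divisibility.Signed
  open import Data.Integer.Tactic.RingSolver using (solve-∀)
  open import Data.List using (allFin)
  open import Data.Product using (Σ-syntax; _×_; _,_; proj₁; proj₂)
  open import Function using (_∘_)
  open import Relation.Nullary using (Dec; yes; no; contradiction; ¬?)
  open import Relation.Nullary.Decidable using (decidable-stable)
  open import Relation.Binary.PropositionalEquality

  private
    p : ℕ
    p = suc n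
    variable
      a b c m N : ℕ

  F : Set
  F = Fin p

  Annihilate : (Fin a → Fin b → F) → (Fin b → Fin c → F) → Set
  Annihilate {b = b} U V = ∀ i l → + p ∣ ΣL (allFin b) (λ k → ι (U i k) * ι (V k l))

  -- Recursion on the first row of U: if it is nonzero, eliminating with a pivot removes a column of U and a row of V.
  pairs : ℕ → ℕ → ℕ → ℕ
  pairs zero    b       c = (p ^ c) ^ b
  pairs (suc a) zero    c = 1
  pairs (suc a) (suc b) c = pairs a (suc b) c ℕ.+ (p ^ suc b ∸ 1) ℕ.* (p ^ a ℕ.* pairs a b c)

  -- The bound on the number of pairs is given as an injection, so that tuples of blocks can be
  -- encoded block by block. Its conclusion is pointwise because matrices are functions.
  record Coding (a b c z : ℕ) : Set where
    field
      code      : (U : Fin a → Fin b → F) (V : Fin b → Fin c → F) → Annihilate U V → Fin z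
      injective : ∀ {U V h U' V' h'} → code U V h ≡ code U' V' h' →
                  (∀ i k → U i k ≡ U' i k) × (∀ k l → V k l ≡ V' k l)

  -- Skipping the code of the zero row accounts for the `∸ 1` in `pairs`; without it, `pairs-square`
  -- would fail for `p = 2` and `m = 1`.
  omit : (i : Fin N) {j : Fin N} → i ≢ j → Fin (N ∸ 1)
  omit {suc N} i ne = punchOut ne

  omit-injective : (i : Fin N) {j k : Fin N} (ne : i ≢ j) (ne' : i ≢ k) → omit i ne ≡ omit i ne' → j ≡ k
  omit-injective {suc N} i ne ne' e = Finₚ.punchOut-injective ne ne' e

  inl : Fin m → Fin (m ℕ.+ N)
  inl {N = N} i = i ↑ˡ N

  inr : Fin N → Fin (m ℕ.+ N)
  inr {m = m} i = m ↑ʳ i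

  inl≢inr : ∀ {i : Fin m} {j : Fin N} → inl i ≢ inr j
  inl≢inr {m} {N} {i} {j} e with trans (sym (Finₚ.splitAt-↑ˡ m i N)) (trans (cong (Fin.splitAt m) e) (Finₚ.splitAt-↑ʳ m N j))
  ... | ()

  Σ-punchIn : ∀ {b} (j : Fin (suc b)) (f : Fin (suc b) → ℤ) →
              ΣL (allFin (suc b)) f ≡ f j + ΣL (allFin b) (f ∘ punchIn j)
  Σ-punchIn {b} zero f = Σ-suc b f
  Σ-punchIn {suc b} (suc j) f = trans (Σ-suc (suc b) f) (trans (cong (_+_ (f zero)) (Σ-punchIn j (f ∘ suc)))
    (trans (rearrange (f zero) (f (suc j)) _) (cong (_+_ (f (suc j))) (sym (Σ-suc b (f ∘ punchIn (suc j)))))))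
    where
    rearrange : ∀ x y z → x + (y + z) ≡ y + (x + z)
    rearrange = solve-∀

  -- The zero row gets the default column `zero`, so the property is an implication;
  -- `column-nonzero` uses its contrapositive.
  pivot : (w : Fin (suc b) → F) → Σ[ j ∈ Fin (suc b) ] (w j ≡ zero → ∀ k → w k ≡ zero)
  pivot w with Finₚ.any? (λ k → ¬? (w k Fin.≟ zero))
  ... | yes (j , wj≢0) = j , λ e → contradiction e wj≢0
  ... | no  none       = zero , λ _ k → decidable-stable (w k Fin.≟ zero) λ wk≢0 → none (k , wk≢0)

  module Step {a b c z₁ z₂ : ℕ} (K₁ : Coding a (suc b) c z₁) (K₂ : Coding a b c z₂) where
    private
      module K₁ = Coding K₁
      module K₂ = Coding K₂

    Row : Set
    Row = Fin (p ^ suc b)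

    zeroRow : Row
    zeroRow = funToFin {suc b} {p} (λ _ → zero)

    -- The pivot is computed from the code of a row, so that equal codes give equal columns by
    -- `cong`, without extensionality.
    column : Row → Fin (suc b)
    column e = proj₁ (pivot (finToFun {p} {suc b} e))

    column-nonzero : (w : Fin (suc b) → F) → zeroRow ≢ funToFin w → w (column (funToFin w)) ≢ zero
    column-nonzero w ne w≡0 = ne (sym (funToFin-cong {suc b} {p} λ k → trans (sym (Finₚ.finToFun-funToFin w k))
      (proj₂ (pivot (finToFun {p} {suc b} (funToFin w))) (trans (Finₚ.finToFun-funToFin w _) w≡0) k)))

    -- Cross-multiplication avoids inverting the pivot; `euclid` cancels the extra factor in
    -- `recover`.
    eliminated : (U : Fin (suc a) → Fin (suc b) → F) → Fin (suc b) → Fin a → Fin (suc b) → ℤ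
    eliminated U j i k = ι (U zero j) * ι (U (suc i) k) - ι (U (suc i) j) * ι (U zero k)

    module _ (U : Fin (suc a) → Fin (suc b) → F) (V : Fin (suc b) → Fin c → F) (h : Annihilate U V) (j : Fin (suc b)) where
      U″ : Fin a → Fin b → F
      U″ i k = reduce (eliminated U j i (punchIn j k))

      V″ : Fin b → Fin c → F
      V″ k l = V (punchIn j k) l

      -- The combination of row `suc i` and row `zero` still annihilates `V`, and its entry in
      -- column `j` is zero, so deleting column `j` together with row `j` of `V` preserves the
      -- product modulo `p`.
      h″ : Annihilate U″ V″
      h″ i l = ∣m+n∣m⇒∣n
        (subst (+ p ∣_) (trans total (split _ _)) (∣m∣n⇒∣m-n (∣n⇒∣m*n (ι (U zero j)) (h (suc i) l)) (∣n⇒∣m*n (ι (U (suc i) j)) (h zero l))))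
        (subst (+ p ∣_) (Σ-− (allFin b) _ _) (Σ-∣ (allFin b) {λ k → eliminated U j i (punchIn j k) * ι (V″ k l) - ι (U″ i k) * ι (V″ k l)}
          (λ k → subst (+ p ∣_) (factor (eliminated U j i (punchIn j k)) (ι (U″ i k)) (ι (V″ k l)))
             (∣m⇒∣m*n (ι (V″ k l)) (reduce-∣ (eliminated U j i (punchIn j k)))))))
        where
        open ≡-Reasoning
        factor : ∀ x y v → (x - y) * v ≡ x * v - y * v
        factor = solve-∀
        split : ∀ x y → x ≡ (x - y) + y
        split = solve-∀
        self : ∀ x y v → (x * y - y * x) * v ≡ 0ℤ
        self = solve-∀
        spread : ∀ x u y w v → x * (u * v) - y * (w * v) ≡ (x * u - y * w) * v
        spread = solve-∀
        S : (Fin (suc b) → ℤ) → ℤ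
        S = ΣL (allFin (suc b))
        uv wv ev : Fin (suc b) → ℤ
        uv k = ι (U (suc i) k) * ι (V k l)
        wv k = ι (U zero k) * ι (V k l)
        ev k = eliminated U j i k * ι (V k l)
        total : ι (U zero j) * S uv - ι (U (suc i) j) * S wv ≡ ΣL (allFin b) (ev ∘ punchIn j)
        total = begin
          ι (U zero j) * S uv - ι (U (suc i) j) * S wv
            ≡⟨ cong₂ _-_ (Σ-*ˡ (allFin (suc b)) (ι (U zero j)) uv) (Σ-*ˡ (allFin (suc b)) (ι (U (suc i) j)) wv) ⟩
          S (λ k → ι (U zero j) * uv k) - S (λ k → ι (U (suc i) j) * wv k)
            ≡⟨ Σ-− (allFin (suc b)) (λ k → ι (U zero j) * uv k) (λ k → ι (U (suc i) j) * wv k) ⟨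
          S (λ k → ι (U zero j) * uv k - ι (U (suc i) j) * wv k)
            ≡⟨ Σ-cong (allFin (suc b)) (λ k → spread (ι (U zero j)) (ι (U (suc i) k)) (ι (U (suc i) j)) (ι (U zero k)) (ι (V k l))) ⟩
          S ev ≡⟨ Σ-punchIn j ev ⟩
          ev j + ΣL (allFin b) (ev ∘ punchIn j) ≡⟨ cong (_+ ΣL (allFin b) (ev ∘ punchIn j)) (self (ι (U zero j)) (ι (U (suc i) j)) (ι (V j l))) ⟩
          0ℤ + ΣL (allFin b) (ev ∘ punchIn j) ≡⟨ +-identityˡ _ ⟩
          ΣL (allFin b) (ev ∘ punchIn j) ∎

    -- A nonzero pivot cancels modulo `p`. This restores the entries of `U` outside column `j` from
    -- the eliminated ones, and the deleted row `j` of `V` from the fact that the first row of `U`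
    -- annihilates every column of `V`.
    recover : ∀ {U V h U' V' h'} j → U zero j ≢ zero → (∀ k → U zero k ≡ U' zero k) → (∀ i → U (suc i) j ≡ U' (suc i) j) →
              (∀ i k → U″ U V h j i k ≡ U″ U' V' h' j i k) → (∀ k l → V″ U V h j k l ≡ V″ U' V' h' j k l) →
              (∀ i k → U i k ≡ U' i k) × (∀ k l → V k l ≡ V' k l)
    recover {U} {V} {h} {U'} {V'} {h'} j wj≢0 row col eU eV = U≡ , V≡
      where
      w : ℤ
      w = ι (U zero j)
      U≡ : ∀ i k → U i k ≡ U' i k
      U≡ zero    k = row k
      U≡ (suc i) k with j Fin.≟ k
      ... | yes refl = col i
      ... | no  j≢k  = subst (λ k → U (suc i) k ≡ U' (suc i) k) (Finₚ.punchIn-punchOut j≢k) (at (punchOut j≢k))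
        where
        difference : ∀ w u y v u' → (w * u - y * v) - (w * u' - y * v) ≡ w * (u - u')
        difference = solve-∀
        at : ∀ k → U (suc i) (punchIn j k) ≡ U' (suc i) (punchIn j k)
        at k = ι-injective (euclid prime w _ (ι-nonzero wj≢0) (subst (+ p ∣_)
          (trans (cong₂ (λ x y → eliminated U j i (punchIn j k) - (x - y))
                   (cong (λ z → ι z * ι (U' (suc i) (punchIn j k))) (sym (row j)))
                   (cong₂ (λ y v → ι y * ι v) (sym (col i)) (sym (row (punchIn j k)))))
            (difference w (ι (U (suc i) (punchIn j k))) (ι (U (suc i) j)) (ι (U zero (punchIn j k))) (ι (U' (suc i) (punchIn j k)))))
          (reduce-injective (eliminated U j i (punchIn j k)) (eliminated U' j i (punchIn j k)) (eU i k))))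
      V≡ : ∀ k l → V k l ≡ V' k l
      V≡ k l with j Fin.≟ k
      ... | no  j≢k  = subst (λ k → V k l ≡ V' k l) (Finₚ.punchIn-punchOut j≢k) (eV (punchOut j≢k) l)
      ... | yes refl = ι-injective (euclid prime w _ (ι-nonzero wj≢0) (subst (+ p ∣_)
          (trans (cong₂ _-_ (Σ-punchIn j f) (Σ-punchIn j f'))
            (trans (cong₂ (λ x y → (f j + ΣL (allFin b) (f ∘ punchIn j)) - (x + y)) (cong (λ z → ι z * ι (V' j l)) (sym (row j))) rest)
              (difference w (ι (V j l)) (ι (V' j l)) _)))
          (∣m∣n⇒∣m-n (h zero l) (h' zero l))))
        where
        f f' : Fin (suc b) → ℤ
        f k = ι (U zero k) * ι (V k l)
        f' k = ι (U' zero k) * ι (V' k l)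
        difference : ∀ w v v' s → (w * v + s) - (w * v' + s) ≡ w * (v - v')
        difference = solve-∀
        rest : ΣL (allFin b) (f' ∘ punchIn j) ≡ ΣL (allFin b) (f ∘ punchIn j)
        rest = Σ-cong (allFin b) λ k → cong₂ (λ x y → ι x * ι y) (sym (row (punchIn j k))) (sym (eV k l))

    Z : ℕ
    Z = z₁ ℕ.+ (p ^ suc b ∸ 1) ℕ.* (p ^ a ℕ.* z₂)

    rowOf : (Fin (suc a) → Fin (suc b) → F) → Row
    rowOf U = funToFin (U zero)

    code : (U : Fin (suc a) → Fin (suc b) → F) (V : Fin (suc b) → Fin c → F) → Annihilate U V →
           Dec (zeroRow ≡ rowOf U) → Fin Z
    code U V h (yes _) = inl (K₁.code (U ∘ suc) V (h ∘ suc))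
    code U V h (no ne) = inr (combine (omit zeroRow ne) (combine (funToFin (λ i → U (suc i) j)) (K₂.code (U″ U V h j) (V″ U V h j) (h″ U V h j))))
      where
      j : Fin (suc b)
      j = column (rowOf U)

    code-injective : ∀ {U V h d U' V' h' d'} → code U V h d ≡ code U' V' h' d' → (∀ i k → U i k ≡ U' i k) × (∀ k l → V k l ≡ V' k l)
    code-injective {U} {V} {h} {yes e} {U'} {V'} {h'} {yes e'} eq = U≡ , proj₂ ih
      where
      ih : (∀ i k → U (suc i) k ≡ U' (suc i) k) × (∀ k l → V k l ≡ V' k l)
      ih = K₁.injective (Finₚ.↑ˡ-injective _ _ _ eq)
      U≡ : ∀ i k → U i k ≡ U' i k
      U≡ zero    = funToFin-injective {suc b} {p} (trans (sym e) e')
      U≡ (suc i) = proj₁ ih i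
    code-injective {d = yes _} {d' = no _} eq = contradiction eq inl≢inr
    code-injective {d = no _} {d' = yes _} eq = contradiction (sym eq) inl≢inr
    code-injective {U} {V} {h} {no ne} {U'} {V'} {h'} {no ne'} eq =
      recover {U} {V} {h} {U'} {V'} {h'} j (column-nonzero (U zero) ne) (funToFin-injective {suc b} {p} rows)
        (λ i → trans (funToFin-injective (proj₁ eq₂) i) (cong (U' (suc i)) (sym j≡)))
        (subst (λ k → ∀ i l → U″ U V h j i l ≡ U″ U' V' h' k i l) (sym j≡) (proj₁ ih))
        (subst (λ k → ∀ i l → V″ U V h j i l ≡ V″ U' V' h' k i l) (sym j≡) (proj₂ ih))
      where
      j j' : Fin (suc b)
      j  = column (rowOf U)
      j' = column (rowOf U')
      eq₁ : omit zeroRow ne ≡ omit zeroRow ne' × _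
      eq₁ = Finₚ.combine-injective _ _ _ _ (Finₚ.↑ʳ-injective z₁ _ _ eq)
      rows : rowOf U ≡ rowOf U'
      rows = omit-injective zeroRow ne ne' (proj₁ eq₁)
      j≡ : j ≡ j'
      j≡ = cong column rows
      eq₂ : funToFin (λ i → U (suc i) j) ≡ funToFin (λ i → U' (suc i) j') × _
      eq₂ = Finₚ.combine-injective _ _ _ _ (proj₂ eq₁)
      ih : (∀ i k → U″ U V h j i k ≡ U″ U' V' h' j' i k) × (∀ k l → V″ U V h j k l ≡ V″ U' V' h' j' k l)
      ih = K₂.injective (proj₂ eq₂)

    coding : Coding (suc a) (suc b) c Z
    coding = record
      { code      = λ U V h → code U V h (zeroRow Fin.≟ rowOf U)
      ; injective = λ {U} {V} {h} {U'} {V'} {h'} → code-injective {U} {V} {h} {zeroRow Fin.≟ rowOf U} {U'} {V'} {h'} {zeroRow Fin.≟ rowOf U'} }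

  coding : ∀ a b c → Coding a b c (pairs a b c)
  coding zero    b       c = record
    { code      = λ U V _ → funToFin (λ k → funToFin (V k))
    ; injective = λ e → (λ ()) , λ k → funToFin-injective (funToFin-injective e k) }
  coding (suc a) zero    c = record { code = λ _ _ _ → zero ; injective = λ _ → (λ _ ()) , λ () }
  coding (suc a) (suc b) c = Step.coding (coding a (suc b) c) (coding a b c)

-- Bounding the number of pairs of matrices with product zero.

open import Data.Nat as ℕ using (ℕ; suc)
open import Data.Nat.Primality using (Prime)

module PairsBound (n : ℕ) (prime : Prime (suc n)) where

  open ZeroProducts n prime using (pairs)
  open import Data.Nat
  open import Data.Nat.Properties
  open import Data.Nat.Primality using (prime⇒nonTrivial)
  open import Data.Nat.Tactic.RingSolver using (solve-∀)
  open import Data.Product using (_,_)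
  open import Data.Sum using (inj₁; inj₂)
  open import Relation.Nullary using (yes; no; contradiction)
  open import Relation.Binary.PropositionalEquality

  p : ℕ
  p = suc n

  2≤p : 2 ≤ p
  2≤p = nonTrivial⇒n>1 p where instance _ = prime⇒nonTrivial prime

  fourth : ℕ → ℕ
  fourth x = x * x * (x * x)

  fourth-mono : ∀ {x y} → x ≤ y → fourth x ≤ fourth y
  fourth-mono l = *-mono-≤ (*-mono-≤ l l) (*-mono-≤ l l)

  fourth-^ : ∀ x → fourth x ≡ x ^ 4
  fourth-^ x = lemma x
    where
    lemma : ∀ x → x * x * (x * x) ≡ x * (x * (x * (x * 1)))
    lemma = solve-∀

  fourth-* : ∀ x y → fourth (x * y) ≡ fourth x * fourth y
  fourth-* x y = lemma x y
    where
    lemma : ∀ x y → x * y * (x * y) * (x * y * (x * y)) ≡ x * x * (x * x) * (y * y * (y * y))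
    lemma = solve-∀

  fourth-p^ : ∀ k → fourth (p ^ k) ≡ p ^ (4 * k)
  fourth-p^ k = trans (fourth-^ (p ^ k)) (trans (^-*-assoc p k 4) (cong (p ^_) (*-comm k 4)))

  private
    double : ∀ y → (y + y) * (y + y) * ((y + y) * (y + y)) ≡ 16 * (y * y * (y * y))
    double = solve-∀

  fourth-+ : ∀ {x y Y} → fourth x ≤ Y → fourth y ≤ Y → fourth (x + y) ≤ 16 * Y
  fourth-+ {x} {y} {Y} hx hy with ≤-total x y
  ... | inj₁ x≤y = ≤-trans (fourth-mono (+-monoˡ-≤ y x≤y)) (≤-trans (≤-reflexive (double y)) (*-monoʳ-≤ 16 hy))
  ... | inj₂ y≤x = ≤-trans (fourth-mono (+-monoʳ-≤ x y≤x)) (≤-trans (≤-reflexive (double x)) (*-monoʳ-≤ 16 hx))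

  -- Dimension count: over a field, the pairs with rank U = k form a set of dimension k(a+b) − k² + (b−k)c,
  -- at most bc + (a+b−c)²/4.
  exponent : ℕ → ℕ → ℕ → ℕ
  exponent a b c = 4 * (b * c) + (a + b ∸ c) * (a + b ∸ c)

  square-mono : ∀ {x y} → x ≤ y → x * x ≤ y * y
  square-mono l = *-mono-≤ l l

  exponent-row : ∀ a b c → exponent a b c ≤ exponent (suc a) b c
  exponent-row a b c = +-monoʳ-≤ (4 * (b * c)) (square-mono (∸-monoˡ-≤ c (n≤1+n (a + b))))

  -- For `c ≤ a + b` this is an equality: `d = a + b - c` grows to `d + 2`, and
  -- `4 c + (d + 2)² - d² = 4 (a + b + 1)`. For `c > a + b` the truncated square on the left is `0`,
  -- and `a + b + 1 ≤ c` suffices.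
  exponent-pivot : ∀ a b c → 4 * (suc b + a) + exponent a b c ≤ exponent (suc a) (suc b) c
  exponent-pivot a b c with ≤-total c (a + b)
  ... | inj₁ c≤ rewrite +-suc a b | sym (m+[n∸m]≡n c≤) | m+n∸m≡n c (a + b ∸ c) = subst₂ _≤_ refl
    (cong (λ z → 4 * (suc b * c) + z * z) (sym (trans (cong (_∸ c) (trans (cong (λ z → suc (suc z)) (+-comm c d)) refl)) (m+n∸n≡m (suc (suc d)) c))))
    (≤-reflexive (trans (cong (λ z → 4 * z + (4 * (b * c) + d * d)) (trans (cong suc (+-comm b a)) (cong suc (sym (m+[n∸m]≡n c≤))))) (identity b c d)))
    where
    d : ℕ
    d = a + b ∸ c
    identity : ∀ b c d → 4 * suc (c + d) + (4 * (b * c) + d * d) ≡ 4 * (suc b * c) + suc (suc d) * suc (suc d)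
    identity = solve-∀
  ... | inj₂ ≤c rewrite m≤n⇒m∸n≡0 ≤c with suc (a + b) ≤? c
  ...   | yes <c = ≤-trans (≤-reflexive (rearrange a b c)) (≤-trans (+-monoʳ-≤ (4 * (b * c)) (*-monoʳ-≤ 4 <c))
                     (≤-trans (≤-reflexive (collect b c)) (m≤m+n _ _)))
    where
    rearrange : ∀ a b c → 4 * (suc b + a) + (4 * (b * c) + 0) ≡ 4 * (b * c) + 4 * suc (a + b)
    rearrange = solve-∀
    collect : ∀ b c → 4 * (b * c) + 4 * c ≡ 4 * (suc b * c)
    collect = solve-∀
  ...   | no  ≮c with ≤-antisym ≤c (s≤s⁻¹ (≰⇒> ≮c))
  ...     | refl rewrite +-suc a b | m+n∸n≡m 2 (a + b) = ≤-reflexive (identity a b)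
    where
    identity : ∀ a b → 4 * (suc b + a) + (4 * (b * (a + b)) + 0) ≡ 4 * (suc b * (a + b)) + 2 * 2
    identity = solve-∀

  -- Both terms of the recursion obey the bound for the smaller `a`, so each row costs a factor `2`,
  -- or `16` after fourth powers.
  pairs-fourth : ∀ a b c → fourth (pairs a b c) ≤ 16 ^ a * p ^ exponent a b c
  pairs-fourth zero b c = ≤-trans (≤-reflexive (trans (cong fourth (trans (^-*-assoc p c b) (cong (p ^_) (*-comm c b))))
    (fourth-p^ (b * c)))) (≤-trans (^-monoʳ-≤ p (m≤m+n (4 * (b * c)) _)) (≤-reflexive (sym (*-identityˡ _))))
  pairs-fourth (suc a) zero c = *-mono-≤ (m^n>0 16 (suc a)) (m^n>0 p (exponent (suc a) 0 c))
  pairs-fourth (suc a) (suc b) c = ≤-trans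
    (fourth-+ {pairs a (suc b) c} {(p ^ suc b ∸ 1) * (p ^ a * pairs a b c)} {16 ^ a * p ^ E}
      (≤-trans (pairs-fourth a (suc b) c) (*-monoʳ-≤ (16 ^ a) (^-monoʳ-≤ p (exponent-row a (suc b) c))))
      second)
    (≤-reflexive (sym (*-assoc 16 (16 ^ a) _)))
    where
    E : ℕ
    E = exponent (suc a) (suc b) c
    open ≤-Reasoning
    second : fourth ((p ^ suc b ∸ 1) * (p ^ a * pairs a b c)) ≤ 16 ^ a * p ^ E
    second = begin
      fourth ((p ^ suc b ∸ 1) * (p ^ a * pairs a b c)) ≤⟨ fourth-mono (*-monoˡ-≤ (p ^ a * pairs a b c) (m∸n≤m (p ^ suc b) 1)) ⟩
      fourth (p ^ suc b * (p ^ a * pairs a b c)) ≡⟨ cong fourth (sym (*-assoc (p ^ suc b) _ _)) ⟩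
      fourth (p ^ suc b * p ^ a * pairs a b c)   ≡⟨ cong (λ z → fourth (z * pairs a b c)) (sym (^-distribˡ-+-* p (suc b) a)) ⟩
      fourth (p ^ (suc b + a) * pairs a b c) ≡⟨ fourth-* (p ^ (suc b + a)) (pairs a b c) ⟩
      fourth (p ^ (suc b + a)) * fourth (pairs a b c)
        ≤⟨ *-mono-≤ (≤-reflexive (fourth-p^ (suc b + a))) (pairs-fourth a b c) ⟩
      p ^ (4 * (suc b + a)) * (16 ^ a * p ^ exponent a b c) ≡⟨ swap (p ^ (4 * (suc b + a))) (16 ^ a) (p ^ exponent a b c) ⟩
      16 ^ a * (p ^ (4 * (suc b + a)) * p ^ exponent a b c) ≡⟨ cong (16 ^ a *_) (sym (^-distribˡ-+-* p (4 * (suc b + a)) _)) ⟩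
      16 ^ a * p ^ (4 * (suc b + a) + exponent a b c) ≤⟨ *-monoʳ-≤ (16 ^ a) (^-monoʳ-≤ p (exponent-pivot a b c)) ⟩
      16 ^ a * p ^ E ∎
      where
      swap : ∀ x y z → x * (y * z) ≡ y * (x * z)
      swap = solve-∀

  pairs-1 : pairs 1 1 1 ≡ suc (n + n)
  pairs-1 = lemma n
    where
    lemma : ∀ n → suc n * 1 * 1 + n * 1 * (1 * 1) ≡ suc (n + n)
    lemma = solve-∀

  -- For `m ≥ 2` the exponent of `p` is `5 m²`, and `16 ^ m ≤ p ^ (4 m) ≤ p ^ (2 m²)` fills the gap
  -- to `7 m²`. For `m = 1` this slack is too small and the exact count `2 p - 1` is used; at
  -- `p = 2` the claim is `81 ≤ 128`.
  pairs-square : ∀ m → fourth (pairs m m m) ≤ p ^ (7 * (m * m))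
  pairs-square 0 = ≤-refl
  pairs-square 1 with n ≟ 1 | 3 ≤? p
  ... | yes n≡1 | _       = subst (λ k → fourth k ≤ p ^ 7) (sym pairs-1)
    (subst (λ n → fourth (suc (n + n)) ≤ suc n ^ 7) (sym n≡1) (≤ᵇ⇒≤ 81 128 _))
  ... | no n≢1  | no  ≮3  = contradiction (≤-antisym (s≤s⁻¹ (s≤s⁻¹ (≰⇒> ≮3))) (s≤s⁻¹ 2≤p)) n≢1
  ... | no _    | yes 3≤p = begin
    fourth (pairs 1 1 1)  ≡⟨ cong fourth pairs-1 ⟩
    fourth (suc n + n) ≤⟨ fourth-mono {suc n + n} {suc n + suc n} (+-monoʳ-≤ (suc n) (n≤1+n n)) ⟩
    fourth (p + p) ≡⟨ double p ⟩
    16 * fourth p ≤⟨ *-monoˡ-≤ (fourth p) (≤-trans (≤ᵇ⇒≤ 16 27 _) (^-monoˡ-≤ 3 3≤p)) ⟩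
    p ^ 3 * fourth p ≡⟨ cong (p ^ 3 *_) (fourth-^ p) ⟩
    p ^ 3 * p ^ 4 ≡⟨ ^-distribˡ-+-* p 3 4 ⟨
    p ^ 7 ∎
    where open ≤-Reasoning
  pairs-square m@(suc (suc _)) = begin
    fourth (pairs m m m) ≤⟨ pairs-fourth m m m ⟩
    16 ^ m * p ^ exponent m m m ≤⟨ *-monoˡ-≤ _ (^-monoˡ-≤ m (^-monoˡ-≤ 4 2≤p)) ⟩
    (p ^ 4) ^ m * p ^ exponent m m m ≡⟨ cong₂ _*_ (^-*-assoc p 4 m) (cong (p ^_) (cong (λ z → 4 * (m * m) + z * z) (m+n∸m≡n m m))) ⟩
    p ^ (4 * m) * p ^ (4 * (m * m) + m * m) ≡⟨ ^-distribˡ-+-* p (4 * m) _ ⟨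
    p ^ (4 * m + (4 * (m * m) + m * m)) ≤⟨ ^-monoʳ-≤ p (+-monoˡ-≤ _ (≤-trans (≤-reflexive (*-assoc 2 2 m)) (*-monoʳ-≤ 2 (*-monoˡ-≤ m {2} {m} (s≤s (s≤s z≤n)))))) ⟩
    p ^ (2 * (m * m) + (4 * (m * m) + m * m)) ≡⟨ cong (p ^_) (collect (m * m)) ⟩
    p ^ (7 * (m * m)) ∎
    where
    open ≤-Reasoning
    collect : ∀ x → 2 * x + (4 * x + x) ≡ 7 * x
    collect = solve-∀

-- Disjoint matrix multiplications in a group.

module Families where

  open Groups
  open import Data.Fin using (Fin)
  open import Data.Nat using (ℕ)
  open import Data.Product using (Σ; _×_; _,_)
  open import Relation.Binary.PropositionalEquality using (_≡_)

  -- A family of disjoint matrix multiplication tensors ⟨a i , b i , c i⟩ inside the addition table of G.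
  record Family (G : FinGroup) (I : Set) (a b c : I → ℕ) : Set where
    open FinGroup G
    field
      x       : ∀ i → Fin (a i) → Fin (b i) → C
      y       : ∀ i → Fin (b i) → Fin (c i) → C
      z       : ∀ i → Fin (c i) → Fin (a i) → C
      triangle : ∀ i α β γ → x i α β ⊕ y i β γ ⊕ z i γ α ≡ 𝟘
      matches  : ∀ {i j k} α β β' γ γ' α' → x i α β ⊕ y j β' γ ⊕ z k γ' α' ≡ 𝟘 →
                 _≡_ {A = Σ I (λ i → Fin (a i))} (i , α) (k , α') ×
                 _≡_ {A = Σ I (λ i → Fin (b i))} (i , β) (j , β') ×
                 _≡_ {A = Σ I (λ i → Fin (c i))} (j , γ) (k , γ')

-- Counting pairs relative to base points.

module TwoStage where

  open import Data.Fin as Fin using (Fin; combine; remQuot)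
  import Data.Fin.Properties as Finₚ
  open import Data.Nat using (ℕ; _*_; _≤_)
  open import Data.Product using (_×_; _,_; proj₁; proj₂; ∃; uncurry)
  open import Relation.Nullary using (Dec; yes; no; contradiction)
  open import Relation.Binary.PropositionalEquality

  private
    variable
      A B K₁ K₂ Z : ℕ

  pick : ∀ {P : Fin A → Set} → Dec (∃ P) → Fin A → Fin A
  pick (yes (u , _)) _ = u
  pick (no  _)       d = d

  -- The search sees `u` only through `κ u`, so all members of a class share one base point. It
  -- always succeeds, `u` itself being a hit; the default only makes the function total.
  base : (κ : Fin A → Fin K₁) → Fin A → Fin A
  base κ u = pick (Finₚ.any? (λ u₀ → κ u₀ Fin.≟ κ u)) u

  base-class : (κ : Fin A → Fin K₁) (u : Fin A) → κ u ≡ κ (base κ u)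
  base-class κ u with Finₚ.any? (λ u₀ → κ u₀ Fin.≟ κ u)
  ... | yes (_ , e) = sym e
  ... | no  none    = contradiction (u , refl) none

  base-cong : (κ : Fin A → Fin K₁) {u u' : Fin A} → κ u ≡ κ u' → base κ u ≡ base κ u'
  base-cong κ {u} {u'} e rewrite e with Finₚ.any? (λ u₀ → κ u₀ Fin.≟ κ u')
  ... | yes _    = refl
  ... | no  none = contradiction (u' , refl) none

  -- Elements of each class are coded by their difference from a base point of the class, so only differences need codes.
  two-stage :
    (κ₁ : Fin A → Fin K₁) (κ₂ : Fin A → Fin A → Fin B → Fin K₂)
    (code : ∀ u₀ u v₀ v → κ₁ u ≡ κ₁ u₀ → κ₂ u₀ u v ≡ κ₂ u₀ u v₀ → Fin Z) →
    (∀ u₀ {u u' v₀ v v₀' v' d e d' e'} → code u₀ u v₀ v d e ≡ code u₀ u' v₀' v' d' e' → u ≡ u' × (v₀ ≡ v₀' → v ≡ v')) →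
    A * B ≤ K₁ * (K₂ * Z)
  two-stage {A} {K₁} {B} {K₂} {Z} κ₁ κ₂ code injective =
    Finₚ.injective⇒≤ {f = λ w → encode (proj₁ (remQuot {A} B w)) (proj₂ (remQuot {A} B w))}
      λ {w} {w'} e → trans (sym (Finₚ.combine-remQuot {A} B w))
        (trans (uncurry (cong₂ combine) (encode-injective e)) (Finₚ.combine-remQuot {A} B w'))
    where
    u₀ : Fin A → Fin A
    u₀ = base κ₁
    v₀ : Fin A → Fin B → Fin B
    v₀ u = base (κ₂ (u₀ u) u)
    encode : Fin A → Fin B → Fin (K₁ * (K₂ * Z))
    encode u v = combine (κ₁ u) (combine (κ₂ (u₀ u) u v)
      (code (u₀ u) u (v₀ u v) v (base-class κ₁ u) (base-class (κ₂ (u₀ u) u) v)))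
    at : ∀ {a u v d e a' u' v' d' e'} → a ≡ a' → κ₂ a u v ≡ κ₂ a' u' v' →
         code a u (base (κ₂ a u) v) v d e ≡ code a' u' (base (κ₂ a' u') v') v' d' e' → u ≡ u' × v ≡ v'
    at {a} refl eκ ec with injective a ec
    ... | refl , v≡ = refl , v≡ (base-cong (κ₂ a _) eκ)
    encode-injective : ∀ {u v u' v'} → encode u v ≡ encode u' v' → u ≡ u' × v ≡ v'
    encode-injective e with Finₚ.combine-injective _ _ _ _ e
    ... | eκ₁ , e' with Finₚ.combine-injective _ _ _ _ e'
    ... | eκ₂ , ec = at (base-cong κ₁ eκ₁) eκ₂ ec

-- The main count for families of square blocks of one size.

open Coordinates
open Families
open Groups
open import Data.Nat as ℕ using (ℕ; suc)
open import Data.Nat.Primality using (Prime)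

module Counting (G : FinGroup) (n : ℕ) (prime : Prime (suc n)) (K : Coords G (suc n)) where

  open Chernoff using (weight)
  open Operators G n prime K
  open Residues n
  open Sums
  open FunToFin
  open TwoStage
  open ZeroProducts n prime
  open import Data.Empty using (⊥)
  open import Data.Fin as Fin using (Fin; suc; combine; funToFin; finToFun)
  import Data.Fin.Properties as Finₚ
  open import Data.Integer using (ℤ; 0ℤ; 1ℤ; +_; _+_; _*_; _-_; -_)
  open import Data.Integer.Properties hiding (_≟_)
  open import Data.Integer.Divisibility.Signed
  open import Data.Integer.Tactic.RingSolver using (solve-∀)
  open import Data.List using (List; allFin; cartesianProduct; length; lookup)
  open import Data.List.Membership.Propositional using (_∈_)
  open import Data.List.Relation.Unary.Any using (index)
  open import Data.List.Relation.Unary.Any.Properties using (lookup-index)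
  open import Data.Nat using (_^_)
  open import Data.Product using (_×_; _,_; proj₁; proj₂)
  open import Data.Vec using (Vec)
  open import Relation.Nullary using (yes; no; contradiction)
  open import Relation.Binary.PropositionalEquality
  open FinGroup G hiding (interchange) renaming (C to X)
  open Coords K
  open Differences G n prime using (p)

  private
    variable
      A B : Set

  δ : X → ℤ
  δ x = indicator (x ≟ 𝟘)

  δ-on : ∀ {x} → x ≡ 𝟘 → δ x ≡ 1ℤ
  δ-on {x} e with x ≟ 𝟘
  ... | yes _ = refl
  ... | no ne = contradiction e ne

  δ-off : ∀ {x} → x ≢ 𝟘 → δ x ≡ 0ℤ
  δ-off {x} ne with x ≟ 𝟘
  ... | yes e = contradiction e ne
  ... | no _  = refl

  product-− : ∀ a b c → (a - b) * c ≡ a * c - b * c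
  product-− = solve-∀

  product-−ʳ : ∀ a b c → a * (b - c) ≡ a * b - a * c
  product-−ʳ = solve-∀

  moment-− : ∀ (xs : List A) pos u u' σ α →
             moment xs pos (λ a → u a - u' a) σ α ≡ moment xs pos u σ α - moment xs pos u' σ α
  moment-− xs pos u u' σ α = trans (Σ-cong xs λ a → product-− (u a) (u' a) (coefficient (pos a) σ α)) (Σ-− xs _ _)

  Op-−ˡ : ∀ (xs : List A) pos u u' f z → Op xs pos (λ a → u a - u' a) f z ≡ Op xs pos u f z - Op xs pos u' f z
  Op-−ˡ xs pos u u' f z = trans (Σ-cong xs λ a → product-− (u a) (u' a) (f (z ⊕ pos a))) (Σ-− xs _ _)

  Op-−ʳ : ∀ (xs : List A) pos u f f' z → Op xs pos u (λ y → f y - f' y) z ≡ Op xs pos u f z - Op xs pos u f' z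
  Op-−ʳ xs pos u f f' z = trans (Σ-cong xs λ a → product-−ʳ (u a) (f (z ⊕ pos a)) (f' (z ⊕ pos a))) (Σ-− xs _ _)

  Op-cong : ∀ (xs : List A) pos u {f f'} → (∀ y → f y ≡ f' y) → ∀ z → Op xs pos u f z ≡ Op xs pos u f' z
  Op-cong xs pos u e z = Σ-cong xs λ a → cong (u a *_) (e (z ⊕ pos a))

  triples : ∀ N m → List (Fin N × Fin m × Fin m)
  triples N m = cartesianProduct (allFin N) (cartesianProduct (allFin m) (allFin m))

  Σ-triples : ∀ N m (f : Fin N × Fin m × Fin m → ℤ) →
              ΣL (triples N m) f ≡ ΣL (allFin N) (λ i → ΣL (allFin m) (λ α → ΣL (allFin m) (λ β → f (i , α , β))))
  Σ-triples N m f = trans (Σ-× (allFin N) _ f) (Σ-cong (allFin N) λ i → Σ-× (allFin m) (allFin m) _)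

  Σ-zero : ∀ (xs : List A) {f : A → ℤ} → (∀ x → f x ≡ 0ℤ) → ΣL xs f ≡ 0ℤ
  Σ-zero xs h = trans (Σ-cong xs h) (Σ-0 xs)

  module Bound {N m : ℕ} (fam : Family G (Fin N) (λ _ → m) (λ _ → m) (λ _ → m))
               {t : ℕ} (big : r ℕ.* n ℕ.< 3 ℕ.* suc t)
               (lows : List (Fin s × Vec (Fin p) r)) (complete : ∀ σ α → weight α ℕ.≤ t → (σ , α) ∈ lows) where
    open Family fam

    T : Set
    T = Fin N × Fin m × Fin m

    ts : List T
    ts = triples N m

    px py : T → X
    px (i , α , β) = x i α β
    py (j , β , γ) = y j β γ

    -- By `matches`, the delta function retains only the triangles through `z k γ α`, which run over
    -- the middle index `β` of block `k`.
    value : ∀ (u v : T → ℤ) k γ α →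
            Op ts px u (Op ts py v δ) (z k γ α) ≡ ΣL (allFin m) (λ β → u (k , α , β) * v (k , β , γ))
    value u v k γ α = begin
      ΣL ts P ≡⟨ Σ-triples N m P ⟩
      ΣL (allFin N) (λ i → ΣL (allFin m) (λ α' → ΣL (allFin m) (λ β → P (i , α' , β))))
        ≡⟨ Σ-single k _ (λ i ne → Σ-zero (allFin m) λ α' → Σ-zero (allFin m) λ β → off (i , α' , β) λ e → ne (cong proj₁ e)) ⟩
      ΣL (allFin m) (λ α' → ΣL (allFin m) (λ β → P (k , α' , β)))
        ≡⟨ Σ-single α _ (λ α' ne → Σ-zero (allFin m) λ β → off (k , α' , β) λ e → ne (cong proj₂ e)) ⟩
      ΣL (allFin m) (λ β → P (k , α , β))
        ≡⟨ Σ-cong (allFin m) (λ β → cong (u (k , α , β) *_) (on β)) ⟩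
      ΣL (allFin m) (λ β → u (k , α , β) * v (k , β , γ)) ∎
      where
      open ≡-Reasoning
      Q : T → T → ℤ
      Q a b = v b * δ (z k γ α ⊕ px a ⊕ py b)
      P : T → ℤ
      P a = u a * ΣL ts (Q a)
      rotate : ∀ a b → z k γ α ⊕ px a ⊕ py b ≡ px a ⊕ py b ⊕ z k γ α
      rotate a b = trans (assoc (z k γ α) (px a) (py b)) (comm (z k γ α) (px a ⊕ py b))
      Q-off : ∀ a b → px a ⊕ py b ⊕ z k γ α ≢ 𝟘 → Q a b ≡ 0ℤ
      Q-off a b ne = trans (cong (v b *_) (δ-off (λ e → ne (trans (sym (rotate a b)) e)))) (*-zeroʳ (v b))
      off : ∀ ((i , α' , β) : T) → (i , α') ≢ (k , α) → P (i , α' , β) ≡ 0ℤ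
      off a@(i , α' , β) ne = trans (cong (u a *_) (Σ-zero ts λ b@(j , β' , γ') → Q-off a b λ e →
        ne (proj₁ (matches α' β β' γ' γ α e)))) (*-zeroʳ (u a))
      on : ∀ β → ΣL ts (Q (k , α , β)) ≡ v (k , β , γ)
      on β = begin
        ΣL ts R ≡⟨ Σ-triples N m R ⟩
        ΣL (allFin N) (λ j → ΣL (allFin m) (λ β' → ΣL (allFin m) (λ γ' → R (j , β' , γ'))))
          ≡⟨ Σ-single k _ (λ j ne → Σ-zero (allFin m) λ β' → Σ-zero (allFin m) λ γ' → R-off j β' γ' λ e _ → ne (sym (cong proj₁ e))) ⟩
        ΣL (allFin m) (λ β' → ΣL (allFin m) (λ γ' → R (k , β' , γ')))
          ≡⟨ Σ-single β _ (λ β' ne → Σ-zero (allFin m) λ γ' → R-off k β' γ' λ e _ → ne (sym (cong proj₂ e))) ⟩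
        ΣL (allFin m) (λ γ' → R (k , β , γ'))
          ≡⟨ Σ-single γ _ (λ γ' ne → R-off k β γ' λ _ e → ne (cong proj₂ e)) ⟩
        R (k , β , γ)
          ≡⟨ cong (v (k , β , γ) *_) (δ-on (trans (rotate (k , α , β) (k , β , γ)) (triangle k α β γ))) ⟩
        v (k , β , γ) * 1ℤ ≡⟨ *-identityʳ _ ⟩
        v (k , β , γ) ∎
        where
        R : T → ℤ
        R = Q (k , α , β)
        R-off : ∀ j β' γ' → ((k , β) ≡ (j , β') → (j , γ') ≡ (k , γ) → ⊥) → R (j , β' , γ') ≡ 0ℤ
        R-off j β' γ' h = Q-off (k , α , β) (j , β' , γ') λ e → let (_ , eβ , eγ) = matches α β β' γ' γ α e in h eβ eγ

    R : ℕ
    R = length lows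

    Function : Set
    Function = Fin (((p ^ m) ^ m) ^ N)

    at : Function → T → Fin p
    at e (i , α , β) = finToFun {p} {m} (finToFun {p ^ m} {m} (finToFun {(p ^ m) ^ m} {N} e i) α) β

    at-injective : ∀ {e e'} → (∀ a → at e a ≡ at e' a) → e ≡ e'
    at-injective {e} {e'} h = finToFun-injective λ i → finToFun-injective λ α → finToFun-injective λ β → h (i , α , β)
      where
      finToFun-injective : ∀ {a b} {e e' : Fin (a ^ b)} → (∀ i → finToFun {a} {b} e i ≡ finToFun {a} {b} e' i) → e ≡ e'
      finToFun-injective {a} {b} {e} {e'} h =
        trans (sym (Finₚ.funToFin-finToFin {b} {a} e)) (trans (funToFin-cong h) (Finₚ.funToFin-finToFin {b} {a} e'))

    lift : Function → T → ℤ
    lift e a = ι (at e a)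

    minus : Function → Function → T → ℤ
    minus e₀ e a = lift e a - lift e₀ a

    residues : (Fin s × Vec (Fin p) r → ℤ) → Fin (p ^ R)
    residues φ = funToFin (λ ρ → reduce (φ (lookup lows ρ)))

    residues-∣ : ∀ φ φ' → residues φ ≡ residues φ' → ∀ σ α → weight α ℕ.≤ t → + p ∣ φ (σ , α) - φ' (σ , α)
    residues-∣ φ φ' e σ α w = subst (λ l → + p ∣ φ l - φ' l) (sym (lookup-index mem))
      (reduce-injective (φ (lookup lows (index mem))) (φ' (lookup lows (index mem))) (funToFin-injective e (index mem)))
      where
      mem : (σ , α) ∈ lows
      mem = complete σ α w

    momentOf : (T → X) → (T → ℤ) → Fin s × Vec (Fin p) r → ℤ
    momentOf pos u (σ , α) = moment ts pos u σ α

    productOf : (T → ℤ) → (T → ℤ) → Fin s × Vec (Fin p) r → ℤ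
    productOf u v (σ , α) = Dv gens α (Op ts px u (Op ts py v δ)) (𝟘 ⊕ reps σ)

    productOf-− : ∀ u v v' l → productOf u (λ a → v a - v' a) l ≡ productOf u v l - productOf u v' l
    productOf-− u v v' (σ , α) = trans
      (Dv-cong gens α (λ w → trans (Op-cong ts px u (Op-−ˡ ts py v v' δ) w) (Op-−ʳ ts px u (Op ts py v δ) (Op ts py v' δ) w)) (𝟘 ⊕ reps σ))
      (Dv-− gens α (Op ts px u (Op ts py v δ)) (Op ts px u (Op ts py v' δ)) (𝟘 ⊕ reps σ))

    κ₁ : Function → Fin (p ^ R)
    κ₁ u = residues (momentOf px (lift u))

    -- The differences of the product are linear in `v` only with `minus u₀ u` fixed, so this
    -- classification of `v` depends on `u₀` and `u`.
    κ₂ : Function → Function → Function → Fin (p ^ R ℕ.* p ^ R)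
    κ₂ u₀ u v = combine (residues (momentOf py (lift v))) (residues (productOf (minus u₀ u) (lift v)))

    minus-Low : ∀ pos u₀ u → residues (momentOf pos (lift u)) ≡ residues (momentOf pos (lift u₀)) → Low t ts pos (minus u₀ u)
    minus-Low pos u₀ u e σ α w = subst (+ p ∣_) (sym (moment-− ts pos (lift u) (lift u₀) σ α)) (residues-∣ (momentOf pos (lift u)) (momentOf pos (lift u₀)) e σ α w)

    block : (T → ℤ) → Fin N → Fin m → Fin m → Fin p
    block u k α β = reduce (u (k , α , β))

    -- Equal moments make both differences `Low`; linearity in `v` kills the low differences of
    -- their product. Then `product-vanishing` applies, and `value` reads its conclusion as a matrix
    -- product in each block.
    annihilate : ∀ u₀ u v₀ v → κ₁ u ≡ κ₁ u₀ → κ₂ u₀ u v ≡ κ₂ u₀ u v₀ →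
                 ∀ k → Annihilate (block (minus u₀ u) k) (block (minus v₀ v) k)
    annihilate u₀ u v₀ v e₁ e₂ k α γ = ∣m+n∣m⇒∣n (subst (+ p ∣_) (trans (value ū v̄ k γ α) (split _ _)) vanishes)
      (subst (+ p ∣_) (Σ-− (allFin m) _ _) (Σ-∣ (allFin m)
        {λ β → ū (k , α , β) * v̄ (k , β , γ) - ι (block ū k α β) * ι (block v̄ k β γ)}
        λ β → subst (+ p ∣_) (reduction (ū (k , α , β)) (v̄ (k , β , γ)) (ι (block ū k α β)) (ι (block v̄ k β γ)))
          (∣m∣n⇒∣m+n (∣m⇒∣m*n (v̄ (k , β , γ)) (reduce-∣ (ū (k , α , β)))) (∣n⇒∣m*n (ι (block ū k α β)) (reduce-∣ (v̄ (k , β , γ)))))))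
      where
      ū v̄ : T → ℤ
      ū = minus u₀ u
      v̄ = minus v₀ v
      e₃ : _ × _
      e₃ = Finₚ.combine-injective _ _ _ _ e₂
      split : ∀ a b → a ≡ (a - b) + b
      split = solve-∀
      reduction : ∀ a b c d → (a - c) * b + c * (b - d) ≡ a * b - c * d
      reduction = solve-∀
      vanishes : + p ∣ Op ts px ū (Op ts py v̄ δ) (z k γ α)
      vanishes = product-vanishing big ts px ū ts py v̄ (minus-Low px u₀ u e₁) (minus-Low py v₀ v (proj₁ e₃)) δ
        (λ σ α w → subst (+ p ∣_) (sym (productOf-− ū (lift v) (lift v₀) (σ , α))) (residues-∣ (productOf ū (lift v)) (productOf ū (lift v₀)) (proj₂ e₃) σ α w))
        (z k γ α)

    open Coding (coding m m m)

    Z : ℕ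
    Z = pairs m m m

    codes : ∀ u₀ u v₀ v → κ₁ u ≡ κ₁ u₀ → κ₂ u₀ u v ≡ κ₂ u₀ u v₀ → Fin (Z ^ N)
    codes u₀ u v₀ v e₁ e₂ = funToFin λ k → code (block (minus u₀ u) k) (block (minus v₀ v) k) (annihilate u₀ u v₀ v e₁ e₂ k)

    block-injective : ∀ e₀ {e e'} → (∀ k α β → block (minus e₀ e) k α β ≡ block (minus e₀ e') k α β) → e ≡ e'
    block-injective e₀ {e} {e'} h = at-injective λ a@(k , α , β) → ι-injective (subst (+ p ∣_)
      (cancel (lift e a) (lift e' a) (lift e₀ a)) (reduce-injective (minus e₀ e a) (minus e₀ e' a) (h k α β)))
      where
      cancel : ∀ a b c → (a - c) - (b - c) ≡ a - b
      cancel = solve-∀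

    codes-injective : ∀ u₀ {u u' v₀ v v₀' v' d e d' e'} → codes u₀ u v₀ v d e ≡ codes u₀ u' v₀' v' d' e' → u ≡ u' × (v₀ ≡ v₀' → v ≡ v')
    codes-injective u₀ {v₀ = v₀} eq =
      block-injective u₀ (λ k α → proj₁ (blocks k) α) , λ { refl → block-injective v₀ λ k α → proj₂ (blocks k) α }
      where
      blocks : ∀ k → _ × _
      blocks k = injective (funToFin-injective eq k)

    count : ((p ^ m) ^ m) ^ N ℕ.* ((p ^ m) ^ m) ^ N ℕ.≤ p ^ R ℕ.* ((p ^ R ℕ.* p ^ R) ℕ.* Z ^ N)
    count = two-stage κ₁ κ₂ codes codes-injective

-- A basis of the `p`-torsion and representatives of its cosets.

open Coordinates
open Groups
open import Data.Nat as ℕ using (ℕ; zero; suc)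
open import Data.Nat.Primality using (Prime)

module Generators (G : FinGroup) (n : ℕ) (prime : Prime (suc n)) where

  open import Data.Fin as Fin using (Fin; zero; suc; toℕ; fromℕ<; combine; remQuot; funToFin; finToFun)
  import Data.Fin.Properties as Finₚ
  open import Data.Nat using (_^_; _*_; _+_; _≤_; _<_; _∸_)
  open import Data.Nat.Coprimality using (prime⇒coprime; coprime-Bézout)
  open import Data.Nat.DivMod using (_%_; _/_; m≡m%n+[m/n]*n; m%n<n)
  open import Data.Nat.GCD using (module Bézout)
  open import Data.Nat.Primality using (prime⇒nonTrivial)
  open import Data.Nat.Properties hiding (_≟_)
  open import Data.Product using (_×_; _,_; proj₁; proj₂; ∃; ∃-syntax; Σ-syntax)
  open import Data.Vec using (Vec; []; _∷_; lookup; tabulate)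
  open import Data.Vec.Properties using (tabulate∘lookup; tabulate-cong)
  open import Data.Vec.Relation.Unary.All using (All; []; _∷_)
  open import Function using (_∘_)
  open import Relation.Nullary using (¬_; Dec; yes; no; contradiction)
  open import Relation.Nullary.Decidable using (map′; ¬?; _×-dec_)
  open import Relation.Binary.Definitions using (tri<; tri≈; tri>)
  open import Relation.Binary.PropositionalEquality
  open Powers using (n<2^n)
  open FinGroup G
  open ≡-Reasoning

  private
    variable
      r s : ℕ

  p : ℕ
  p = suc n

  Torsion : C → Set
  Torsion x = p · x ≡ 𝟘

  any : {P : C → Set} → (∀ x → Dec (P x)) → Dec (∃ P)
  any {P} P? = map′ (λ (i , h) → dec i , h) (λ (x , h) → enc x , subst P (sym (dec-enc x)) h) (Finₚ.any? (P? ∘ dec))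

  ·-zero : ∀ m → m · 𝟘 ≡ 𝟘
  ·-zero zero    = refl
  ·-zero (suc m) = trans (identityˡ (m · 𝟘)) (·-zero m)

  ·-mod : ∀ {x} → Torsion x → ∀ m → (m % p) · x ≡ m · x
  ·-mod {x} px m = begin
    (m % p) · x ≡⟨ identityʳ _ ⟨
    (m % p) · x ⊕ 𝟘 ≡⟨ cong ((m % p) · x ⊕_) (·-zero (m / p)) ⟨
    (m % p) · x ⊕ (m / p) · 𝟘 ≡⟨ cong (λ y → (m % p) · x ⊕ (m / p) · y) px ⟨
    (m % p) · x ⊕ (m / p) · (p · x)  ≡⟨ cong ((m % p) · x ⊕_) (×-assocˡ x (m / p) p) ⟩
    (m % p) · x ⊕ (m / p * p) · x ≡⟨ ×-homo-+ x (m % p) (m / p * p) ⟨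
    (m % p + m / p * p) · x ≡⟨ cong (_· x) (m≡m%n+[m/n]*n m p) ⟨
    m · x ∎

  Torsion-+ : ∀ {x y} → Torsion x → Torsion y → Torsion (x ⊕ y)
  Torsion-+ {x} {y} hx hy = trans (×-distrib-+ x y p) (trans (cong₂ _⊕_ hx hy) (identityˡ 𝟘))

  Torsion-· : ∀ {x} m → Torsion x → Torsion (m · x)
  Torsion-· {x} m hx = trans (×-assocˡ x p m) (trans (cong (_· x) (*-comm p m))
    (trans (sym (×-assocˡ x m p)) (trans (cong (m ·_) hx) (·-zero m))))

  Torsion-cmb : ∀ (ds : Vec (Fin p) r) {gs} → All Torsion gs → Torsion (cmb G ds gs)
  Torsion-cmb []       []         = ·-zero p
  Torsion-cmb (d ∷ ds) (tg ∷ tgs) = Torsion-+ (Torsion-· (toℕ d) tg) (Torsion-cmb ds tgs)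

  Span : Vec C r → C → Set
  Span gs x = ∃[ ds ] cmb G {p} ds gs ≡ x

  span-0 : ∀ (gs : Vec C r) → Span gs 𝟘
  span-0 []       = [] , refl
  span-0 (g ∷ gs) = zero ∷ proj₁ (span-0 gs) , trans (identityˡ _) (proj₂ (span-0 gs))

  span-+ : ∀ {gs : Vec C r} → All Torsion gs → ∀ {x y} → Span gs x → Span gs y → Span gs (x ⊕ y)
  span-+ []         ([] , refl)     ([] , refl)       = [] , sym (identityˡ 𝟘)
  span-+ {gs = g ∷ gs} (tg ∷ tgs) (d ∷ ds , refl) (d' ∷ ds' , refl) with span-+ tgs (ds , refl) (ds' , refl)
  ... | es , e = fromℕ< (m%n<n (toℕ d + toℕ d') p) ∷ es , (begin
    toℕ (fromℕ< (m%n<n (toℕ d + toℕ d') p)) · g ⊕ cmb G es gs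
      ≡⟨ cong₂ (λ m y → m · g ⊕ y) (Finₚ.toℕ-fromℕ< (m%n<n (toℕ d + toℕ d') p)) e ⟩
    ((toℕ d + toℕ d') % p) · g ⊕ (cmb G ds gs ⊕ cmb G ds' gs)
      ≡⟨ cong (_⊕ (cmb G ds gs ⊕ cmb G ds' gs)) (trans (·-mod tg (toℕ d + toℕ d')) (×-homo-+ g (toℕ d) (toℕ d'))) ⟩
    (toℕ d · g ⊕ toℕ d' · g) ⊕ (cmb G ds gs ⊕ cmb G ds' gs)
      ≡⟨ interchange (toℕ d · g) (toℕ d' · g) (cmb G ds gs) (cmb G ds' gs) ⟩
    (toℕ d · g ⊕ cmb G ds gs) ⊕ (toℕ d' · g ⊕ cmb G ds' gs) ∎)

  span-· : ∀ {gs : Vec C r} → All Torsion gs → ∀ m {x} → Span gs x → Span gs (m · x)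
  span-· {gs = gs} tgs zero    h = span-0 gs
  span-· {gs = gs} tgs (suc m) h = span-+ tgs h (span-· tgs m h)

  -- x = y ⊖ z, using n · z as the negative of a p-torsion element z.
  subtract : ∀ {x y z} → Torsion z → x ⊕ z ≡ y → x ≡ y ⊕ n · z
  subtract {x} {y} {z} tz e = begin
    x ≡⟨ identityʳ x ⟨
    x ⊕ 𝟘 ≡⟨ cong (x ⊕_) tz ⟨
    x ⊕ (z ⊕ n · z)   ≡⟨ assoc x z (n · z) ⟨
    x ⊕ z ⊕ n · z ≡⟨ cong (_⊕ n · z) e ⟩
    y ⊕ n · z ∎

  -- Bézout for `j` and the prime `p` inverts `j` modulo `p`. In natural numbers the relation comes
  -- with two possible signs; for one of them the multiple of `j · x` equals the negative of `x`.
  span-divide : ∀ {gs : Vec C r} → All Torsion gs → ∀ {x} → Torsion x → ∀ j → 0 < j → j < p → Span gs (j · x) → Span gs x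
  span-divide {gs = gs} tgs {x} tx j 0<j j<p h with coprime-Bézout (prime⇒coprime prime {{ℕ.>-nonZero 0<j}} j<p)
  ... | Bézout.+- a b eq = subst (Span gs) (sym (subtract (Torsion-· b (Torsion-· j tx)) (begin
      x ⊕ b · (j · x) ≡⟨ cong₂ _⊕_ (sym (identityʳ x)) (×-assocˡ x b j) ⟩
      1 · x ⊕ (b * j) · x ≡⟨ ×-homo-+ x 1 (b * j) ⟨
      (1 + b * j) · x ≡⟨ cong (_· x) eq ⟩
      (a * p) · x ≡⟨ ×-assocˡ x a p ⟨
      a · (p · x) ≡⟨ trans (cong (a ·_) tx) (·-zero a) ⟩
      𝟘 ∎)))
    (span-+ tgs (span-0 gs) (span-· tgs n (span-· tgs b h)))
  ... | Bézout.-+ a b eq = subst (Span gs) (begin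
      b · (j · x) ≡⟨ ×-assocˡ x b j ⟩
      (b * j) · x ≡⟨ cong (_· x) eq ⟨
      (1 + a * p) · x ≡⟨ ×-homo-+ x 1 (a * p) ⟩
      1 · x ⊕ (a * p) · x ≡⟨ cong₂ _⊕_ (identityʳ x) (trans (sym (×-assocˡ x a p)) (trans (cong (a ·_) tx) (·-zero a))) ⟩
      x ⊕ 𝟘 ≡⟨ identityʳ x ⟩
      x ∎)
    (span-· tgs b h)

  toVec : Fin (p ^ r) → Vec (Fin p) r
  toVec {r} e = tabulate (finToFun {p} {r} e)

  fromVec : Vec (Fin p) r → Fin (p ^ r)
  fromVec ds = funToFin (lookup ds)

  toVec-fromVec : ∀ (ds : Vec (Fin p) r) → toVec (fromVec ds) ≡ ds
  toVec-fromVec ds = trans (tabulate-cong (Finₚ.finToFun-funToFin (lookup ds))) (tabulate∘lookup ds)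

  fromVec-toVec : ∀ (e : Fin (p ^ r)) → fromVec (toVec {r} e) ≡ e
  fromVec-toVec {r} e = trans (cong-lookup r (finToFun {p} {r} e)) (Finₚ.funToFin-finToFin {r} {p} e)
    where
    cong-lookup : ∀ r (f : Fin r → Fin p) → funToFin (lookup (tabulate f)) ≡ funToFin f
    cong-lookup zero    f = refl
    cong-lookup (suc r) f = cong (combine (f zero)) (cong-lookup r (f ∘ suc))

  span? : ∀ (gs : Vec C r) x → Dec (Span gs x)
  span? {r} gs x = map′ (λ (e , h) → toVec e , h)
    (λ (ds , h) → fromVec ds , trans (cong (λ v → cmb G v gs) (toVec-fromVec ds)) h)
    (Finₚ.any? {p ^ r} (λ e → cmb G (toVec e) gs ≟ x))

  Independent : Vec C r → Set
  Independent gs = ∀ ds ds' → cmb G {p} ds gs ≡ cmb G ds' gs → ds ≡ ds'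

  record Basis : Set where
    field
      {rank}      : ℕ
      gens        : Vec C rank
      torsion     : All Torsion gens
      independent : Independent gens
      spanning    : ∀ x → Torsion x → Span gens x

  enc-injective : ∀ {x y} → enc x ≡ enc y → x ≡ y
  enc-injective {x} {y} e = trans (sym (dec-enc x)) (trans (cong dec e) (dec-enc y))

  span-smaller : ∀ {g} {gs : Vec C r} → All Torsion gs → Torsion g → ∀ (d d' : Fin p) ds ds' → toℕ d < toℕ d' →
                 toℕ d · g ⊕ cmb G ds gs ≡ toℕ d' · g ⊕ cmb G ds' gs → Span gs g
  span-smaller {g = g} {gs} tgs tg d d' ds ds' d<d' e =
    span-divide tgs tg j (m<n⇒0<n∸m d<d') (≤-<-trans (m∸n≤m (toℕ d') (toℕ d)) (Finₚ.toℕ<n d'))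
      (subst (Span gs) (sym (subtract (Torsion-cmb ds' tgs) (∙-cancelˡ (toℕ d · g) _ _ (begin
        toℕ d · g ⊕ (j · g ⊕ cmb G ds' gs)   ≡⟨ assoc _ _ _ ⟨
        toℕ d · g ⊕ j · g ⊕ cmb G ds' gs ≡⟨ cong (_⊕ cmb G ds' gs) (×-homo-+ g (toℕ d) j) ⟨
        (toℕ d + j) · g ⊕ cmb G ds' gs ≡⟨ cong (λ m → m · g ⊕ cmb G ds' gs) (m+[n∸m]≡n (<⇒≤ d<d')) ⟩
        toℕ d' · g ⊕ cmb G ds' gs ≡⟨ e ⟨
        toℕ d · g ⊕ cmb G ds gs ∎))))
        (span-+ tgs (ds , refl) (span-· tgs n (ds' , refl))))
    where
    j : ℕ
    j = toℕ d' ∸ toℕ d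

  independent-∷ : ∀ {g} {gs : Vec C r} → All Torsion gs → Torsion g → ¬ Span gs g → Independent gs → Independent (g ∷ gs)
  independent-∷ {g = g} tgs tg ∉ ind (d ∷ ds) (d' ∷ ds') e with <-cmp (toℕ d) (toℕ d')
  ... | tri< d<d' _ _ = contradiction (span-smaller tgs tg d d' ds ds' d<d' e) ∉
  ... | tri> _ _ d'<d = contradiction (span-smaller tgs tg d' d ds' ds d'<d (sym e)) ∉
  ... | tri≈ _ d≡ _ with Finₚ.toℕ-injective d≡
  ...   | refl = cong (d ∷_) (ind ds ds' (∙-cancelˡ (toℕ d · g) _ _ e))

  2≤p : 2 ≤ p
  2≤p = ℕ.nonTrivial⇒n>1 p where instance _ = prime⇒nonTrivial prime

  -- The fuel cannot run out: independence gives `r < 2 ^ r ≤ p ^ r ≤ size`, whereas zero fuel would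
  -- mean `size ≤ r`.
  extend-basis : ∀ fuel {gs : Vec C r} → size ≤ r + fuel → All Torsion gs → Independent gs → Basis
  extend-basis {r} fuel {gs} bound tgs ind with any (λ x → (p · x ≟ 𝟘) ×-dec ¬? (span? gs x))
  ... | no none = record { gens = gs ; torsion = tgs ; independent = ind ; spanning = spanning }
    where
    spanning : ∀ x → Torsion x → Span gs x
    spanning x tx with span? gs x
    ... | yes h = h
    ... | no ¬h = contradiction (x , tx , ¬h) none
  ... | yes (x , tx , ∉) with fuel
  ...   | suc k = extend-basis k (subst (size ≤_) (+-suc r k) bound) (tx ∷ tgs) (independent-∷ tgs tx ∉ ind)
  ...   | zero  = contradiction small (<⇒≱ (≤-trans (n<2^n r) (^-monoˡ-≤ r 2≤p)))
    where
    small : p ^ r ≤ r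
    small = ≤-trans (Finₚ.injective⇒≤ {f = λ e → enc (cmb G (toVec {r} e) gs)} λ {e} {e'} h →
        trans (sym (fromVec-toVec {r} e)) (trans (cong fromVec (ind (toVec e) (toVec e') (enc-injective h))) (fromVec-toVec {r} e')))
      (≤-trans bound (≤-reflexive (+-identityʳ r)))

  basis : Basis
  basis = extend-basis size {gs = []} ≤-refl [] λ { [] [] _ → refl }

  module Transversal (B : Basis) where
    open Basis B

    point : Vec C s → Fin s → Vec (Fin p) rank → C
    point reps σ ds = lookup reps σ ⊕ cmb G ds gens

    Separated : Vec C s → Set
    Separated {s} reps = ∀ σ σ' ds ds' → point reps σ ds ≡ point reps σ' ds' → σ ≡ σ' × ds ≡ ds'

    Covered : Vec C s → C → Set
    Covered reps x = ∃[ σ ] ∃[ ds ] point reps σ ds ≡ x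

    covered? : ∀ (reps : Vec C s) x → Dec (Covered reps x)
    covered? reps x = Finₚ.any? λ σ → map′ (λ (e , h) → toVec e , h)
      (λ (ds , h) → fromVec ds , trans (cong (point reps σ) (toVec-fromVec ds)) h)
      (Finₚ.any? {p ^ rank} (λ e → point reps σ (toVec e) ≟ x))

    separated-∷ : ∀ {x} (reps : Vec C s) → ¬ Covered reps x → Separated reps → Separated (x ∷ reps)
    separated-∷ reps ∉ sep zero    zero     ds ds' e = refl , independent ds ds' (∙-cancelˡ _ _ _ e)
    separated-∷ reps ∉ sep (suc σ) (suc σ') ds ds' e with sep σ σ' ds ds' e
    ... | refl , eq = refl , eq
    separated-∷ {x = x} reps ∉ sep zero (suc σ) ds ds' e = contradiction (σ , covering) ∉
      where
      difference : Span gens (cmb G ds' gens ⊕ n · cmb G ds gens)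
      difference = span-+ torsion (ds' , refl) (span-· torsion n (ds , refl))
      covering : ∃[ es ] point reps σ es ≡ x
      covering = proj₁ difference , trans (cong (lookup reps σ ⊕_) (proj₂ difference))
        (trans (sym (assoc _ _ _)) (sym (subtract (Torsion-cmb ds torsion) e)))
    separated-∷ reps ∉ sep (suc σ) zero ds ds' e with separated-∷ reps ∉ sep zero (suc σ) ds' ds (sym e)
    ... | () , _

    Point : ℕ → Set
    Point s = Fin (s * p ^ rank)

    separated-≤ : ∀ (reps : Vec C s) → Separated reps → s * p ^ rank ≤ size
    separated-≤ {s} reps sep = Finₚ.injective⇒≤ {f = λ w → enc (at w)} λ {w} {w'} e → at-injective w w' (enc-injective e)
      where
      at : Point s → C
      at w = point reps (proj₁ (remQuot {s} (p ^ rank) w)) (toVec {rank} (proj₂ (remQuot {s} (p ^ rank) w)))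
      at-injective : ∀ w w' → at w ≡ at w' → w ≡ w'
      at-injective w w' e with sep _ _ (toVec (proj₂ (remQuot {s} (p ^ rank) w))) (toVec (proj₂ (remQuot {s} (p ^ rank) w'))) e
      ... | eσ , eds = trans (sym (Finₚ.combine-remQuot {s} (p ^ rank) w)) (trans (cong₂ combine eσ
        (trans (sym (fromVec-toVec {rank} _)) (trans (cong fromVec eds) (fromVec-toVec {rank} _))))
        (Finₚ.combine-remQuot {s} (p ^ rank) w'))

    -- Uncovered elements are added greedily. The points on different cosets are distinct, so `s`
    -- cannot exceed `size` and the fuel suffices. The equality of ranks is returned because the
    -- size of the `p`-torsion is read off from it.
    extend-reps : ∀ fuel (reps : Vec C s) → size < s + fuel → Separated reps → Σ[ K ∈ Coords G p ] Coords.r K ≡ rank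
    extend-reps {s} fuel reps bound sep with any (λ x → ¬? (covered? reps x))
    ... | no none = record
      { gens = gens ; reps = lookup reps ; coset = λ x → proj₁ (cover x) ; digits = λ x → proj₁ (proj₂ (cover x))
      ; decompose = λ x → sym (proj₂ (proj₂ (cover x))) ; torsion = torsion ; volume = separated-≤ reps sep } , refl
      where
      cover : ∀ x → Covered reps x
      cover x with covered? reps x
      ... | yes h = h
      ... | no ¬h = contradiction (x , ¬h) none
    ... | yes (x , ∉) with fuel
    ...   | suc k = extend-reps k (x ∷ reps) (subst (size <_) (+-suc s k) bound) (separated-∷ reps ∉ sep)
    ...   | zero  = contradiction (≤-trans (m≤m*n s (p ^ rank) {{m^n≢0 p rank}}) (separated-≤ reps sep))
                      (<⇒≱ (subst (size <_) (+-identityʳ s) bound))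

    coords : Σ[ K ∈ Coords G p ] Coords.r K ≡ rank
    coords = extend-reps (suc size) [] ≤-refl λ ()

-- A prime with large torsion.

open Groups

module LargeTorsion (G : FinGroup) where

  open Coordinates
  open import Data.Fin as Fin using (Fin; zero; suc; combine; remQuot)
  import Data.Fin.Properties as Finₚ
  open import Data.List using ([]; _∷_; length)
  open import Data.List.Relation.Unary.All using (All; []; _∷_)
  open import Data.Nat hiding (_≟_)
  open import Data.Nat.ListAction using (product)
  open import Data.Nat.Primality using (Prime; prime[2]; ¬prime[0]; prime⇒nonTrivial; productOfPrimes≥1)
  open import Data.Nat.Primality.Factorisation using (factorise; PrimeFactorisation; factors)
  open import Data.Nat.Properties hiding (_≟_)
  open import Data.Product using (_×_; _,_; proj₁; proj₂; ∃-syntax)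
  open import Data.Sum using (inj₁; inj₂)
  open import Relation.Nullary using (yes; no; contradiction)
  open import Relation.Binary.PropositionalEquality
  open FinGroup G

  -- An upper bound on the size of the `m`-torsion by a list that may contain repetitions and other
  -- elements, so that `cover-*` can multiply bounds without counting kernels and images.
  record Cover (m B : ℕ) : Set where
    field
      {count} : ℕ
      bound   : count ≤ B
      point   : Fin count → C
      hits    : ∀ x → m · x ≡ 𝟘 → ∃[ i ] point i ≡ x

  widen : ∀ {m B B'} → B ≤ B' → Cover m B → Cover m B'
  widen le c = record { bound = ≤-trans bound le ; point = point ; hits = hits }
    where open Cover c

  cover-1 : Cover 1 1
  cover-1 = record { bound = ≤-refl ; point = λ _ → 𝟘 ; hits = λ x h → zero , sym (trans (sym (identityʳ x)) h) }

  divide : ∀ m y → C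
  divide m y with Finₚ.any? (λ i → (m · dec i) ≟ y)
  ... | yes (i , _) = dec i
  ... | no  _       = 𝟘

  divide-correct : ∀ m y x → m · x ≡ y → m · divide m y ≡ y
  divide-correct m y x h with Finₚ.any? (λ i → (m · dec i) ≟ y)
  ... | yes (_ , e) = e
  ... | no  none    = contradiction (enc x , trans (cong (m ·_) (dec-enc x)) h) none

  -- G[pm] → G[p], x ↦ m x, has kernel G[m].
  cover-* : ∀ {p m B B'} → Cover p B → Cover m B' → Cover (p * m) (B * B')
  cover-* {p} {m} c c' = record { count = c.count * c'.count ; bound = *-mono-≤ c.bound c'.bound ; point = point ; hits = hits }
    where
    module c = Cover c
    module c' = Cover c'
    point : Fin (c.count * c'.count) → C
    point w = divide m (c.point (proj₁ (remQuot {c.count} c'.count w))) ⊕ c'.point (proj₂ (remQuot {c.count} c'.count w))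
    hits : ∀ x → (p * m) · x ≡ 𝟘 → ∃[ w ] point w ≡ x
    hits x h = combine i j , (begin
      point (combine i j)   ≡⟨ cong (λ w → divide m (c.point (proj₁ w)) ⊕ c'.point (proj₂ w)) (Finₚ.remQuot-combine i j) ⟩
      d ⊕ c'.point j ≡⟨ cong (d ⊕_) ej ⟩
      d ⊕ (x ⊕ ⊖ d) ≡⟨ x∙yz≈y∙xz d x (⊖ d) ⟩
      x ⊕ (d ⊕ ⊖ d) ≡⟨ cong (x ⊕_) (inverseʳ d) ⟩
      x ⊕ 𝟘 ≡⟨ identityʳ x ⟩
      x ∎)
      where
      open ≡-Reasoning
      hit : ∃[ i ] c.point i ≡ m · x
      hit = c.hits (m · x) (trans (×-assocˡ x p m) h)
      i : Fin c.count
      i = proj₁ hit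
      d : C
      d = divide m (c.point i)
      md : m · d ≡ m · x
      md = trans (divide-correct m (c.point i) x (sym (proj₂ hit))) (proj₂ hit)
      kernel : m · (x ⊕ ⊖ d) ≡ 𝟘
      kernel = ∙-cancelʳ (m · d) _ _ (begin
        m · (x ⊕ ⊖ d) ⊕ m · d   ≡⟨ ×-distrib-+ (x ⊕ ⊖ d) d m ⟨
        m · (x ⊕ ⊖ d ⊕ d) ≡⟨ cong (m ·_) (trans (assoc x (⊖ d) d) (trans (cong (x ⊕_) (inverseˡ d)) (identityʳ x))) ⟩
        m · x ≡⟨ md ⟨
        m · d ≡⟨ identityˡ (m · d) ⟨
        𝟘 ⊕ m · d ∎)
      hit' : ∃[ j ] c'.point j ≡ x ⊕ ⊖ d
      hit' = c'.hits (x ⊕ ⊖ d) kernel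
      j : Fin c'.count
      j = proj₁ hit'
      ej : c'.point j ≡ x ⊕ ⊖ d
      ej = proj₂ hit'

  record PrimeCoords : Set where
    field
      {n}     : ℕ
      isPrime : Prime (suc n)
      K       : Coords G (suc n)
    torsionSize : ℕ
    torsionSize = suc n ^ Coords.r K

  open PrimeCoords using (n; torsionSize)

  primeCoords : ∀ {n} → Prime (suc n) → ∃[ P ] PrimeCoords.n P ≡ n × Cover (suc n) (torsionSize P)
  primeCoords {n} pr = record { isPrime = pr ; K = proj₁ coords } , refl ,
    record { bound = ≤-reflexive (cong (suc n ^_) (sym (proj₂ coords)))
           ; point = λ e → cmb G (toVec e) gens
           ; hits  = λ x h → let (ds , e) = spanning x h in fromVec ds , trans (cong (λ v → cmb G v gens) (toVec-fromVec ds)) e }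
    where
    open Generators G n pr
    open Basis basis
    open Transversal basis

  largest : ∀ {ps} → All Prime ps → ∃[ P ] suc (n P) ≤ suc (product ps) × Cover (product ps) (torsionSize P ^ length ps)
  -- The exponent `1` has no prime factors, and `2` serves as default. It exceeds the empty product
  -- by one, hence the `suc` in the bound on the prime.
  largest [] = proj₁ two , s≤s (≤-reflexive (proj₁ (proj₂ two))) , cover-1
    where
    two : ∃[ P ] PrimeCoords.n P ≡ 1 × Cover 2 (torsionSize P)
    two = primeCoords prime[2]
  largest {zero ∷ ps} (pr ∷ prs) = contradiction pr ¬prime[0]
  largest {suc m ∷ ps} (pr ∷ prs) with primeCoords pr | largest prs
  ... | P , refl , c | P' , bound , c' with ≤-total (torsionSize P) (torsionSize P')
  ...   | inj₁ le = P' , ≤-trans bound (s≤s (m≤n*m (product ps) (suc m))) ,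
                    widen (*-monoˡ-≤ (torsionSize P' ^ length ps) le) (cover-* c c')
  ...   | inj₂ le = P , m≤n⇒m≤1+n (m≤m*n (suc m) (product ps) {{>-nonZero (productOfPrimes≥1 prs)}}) ,
                    widen (*-monoʳ-≤ (torsionSize P) (^-monoˡ-≤ (length ps) le)) (cover-* c c')

  length≤product : ∀ {ps} → All Prime ps → suc (length ps) ≤ product ps
  length≤product [] = ≤-refl
  length≤product {p ∷ ps} (pr ∷ prs) = begin
    1 + suc (length ps) ≤⟨ +-monoˡ-≤ (suc (length ps)) (s≤s z≤n) ⟩
    suc (length ps) + suc (length ps) ≡⟨ cong (suc (length ps) +_) (sym (+-identityʳ (suc (length ps)))) ⟩
    2 * suc (length ps) ≤⟨ *-mono-≤ (nonTrivial⇒n>1 p {{prime⇒nonTrivial pr}}) (length≤product prs) ⟩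
    p * product ps ∎
    where open ≤-Reasoning

  -- The whole group is `m`-torsion. Along the factorisation of `m` its order is at most a product
  -- of sizes of prime torsion subgroups, at most `m` of them, each bounded by the largest.
  large-torsion : ∀ m → 1 ≤ m → (∀ x → m · x ≡ 𝟘) → ∃[ P ] suc (n P) ≤ suc m × size ≤ torsionSize P ^ m
  large-torsion m 1≤m kills = P , subst (λ k → suc (n P) ≤ suc k) (sym m≡) P≤ , (begin
    size ≤⟨ Finₚ.injective⇒≤ {f = λ i → proj₁ (at i)} injective ⟩
    count ≤⟨ bound ⟩
    torsionSize P ^ length (factors f) ≤⟨ ^-monoʳ-≤ (torsionSize P) {{m^n≢0 (suc (n P)) (Coords.r (PrimeCoords.K P))}} few ⟩
    torsionSize P ^ m ∎)
    where
    open ≤-Reasoning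
    f : PrimeFactorisation m
    f = factorise m {{>-nonZero 1≤m}}
    m≡ : m ≡ product (factors f)
    m≡ = PrimeFactorisation.isFactorisation f
    chosen : ∃[ P ] suc (n P) ≤ suc (product (factors f)) × Cover (product (factors f)) (torsionSize P ^ length (factors f))
    chosen = largest (PrimeFactorisation.factorsPrime f)
    P : PrimeCoords
    P = proj₁ chosen
    P≤ : suc (n P) ≤ suc (product (factors f))
    P≤ = proj₁ (proj₂ chosen)
    open Cover (proj₂ (proj₂ chosen))
    few : length (factors f) ≤ m
    few = ≤-trans (n≤1+n _) (≤-trans (length≤product (PrimeFactorisation.factorsPrime f)) (≤-reflexive (sym m≡)))
    at : ∀ i → ∃[ j ] point j ≡ dec i
    at i = hits (dec i) (trans (cong (_· dec i) (sym m≡)) (kills (dec i)))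
    injective : ∀ {i i'} → proj₁ (at i) ≡ proj₁ (at i') → i ≡ i'
    injective {i} {i'} e = trans (sym (enc-dec i)) (trans (cong enc (trans (sym (proj₂ (at i)))
      (trans (cong point e) (proj₂ (at i'))))) (enc-dec i'))

-- The uniform power saving.

module Saving where

  open Chernoff
  open Coordinates
  open Families
  open Groups
  open Powers
  open import Data.Fin as Fin using (Fin)
  open import Data.List using (List; []; _∷_; length; map; allFin; cartesianProduct)
  open import Data.List.Membership.Propositional.Properties using (∈-cartesianProduct⁺; ∈-allFin)
  open import Data.List.Properties using (length-tabulate; length-++; length-map)
  open import Data.Nat
  open import Data.Nat.DivMod using (_/_; _%_; m/n*n≤m; m≡m%n+[m/n]*n; m%n<n)
  open import Data.Nat.Primality using (Prime; prime⇒nonTrivial)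
  open import Data.Nat.Properties
  open import Data.Nat.Tactic.RingSolver using (solve-∀)
  open import Data.Product using (_×_; _,_)
  open import Data.Vec using (Vec)
  open import Function using (id)
  open import Relation.Nullary using (yes; no; contradiction)
  open import Relation.Binary.PropositionalEquality
  open ≤-Reasoning

  ^-cancelˡ-≤ : ∀ p {a b} → 1 < p → p ^ a ≤ p ^ b → a ≤ b
  ^-cancelˡ-≤ p {a} {b} 1<p h with a ≤? b
  ... | yes a≤b = a≤b
  ... | no  a≰b = contradiction h (<⇒≱ (^-monoʳ-< p 1<p (≰⇒> a≰b)))

  length-× : ∀ {A B : Set} (xs : List A) (ys : List B) → length (cartesianProduct xs ys) ≡ length xs * length ys
  length-× []       ys = refl
  length-× (x ∷ xs) ys = trans (length-++ (map (x ,_) ys)) (cong₂ _+_ (length-map (x ,_) ys) (length-× xs ys))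

  -- The sum dominates the requirement of each modulus in range, and the initial `1` keeps it
  -- positive when there is none.
  accumulate : ℕ → ℕ → ℕ
  accumulate M zero    = 1
  accumulate M (suc k) = Rate.P k * M + accumulate M k

  accumulate-large : ∀ M L {k} → k < L → Rate.P k * M ≤ accumulate M L
  accumulate-large M (suc L) {k} (s≤s k≤L) with k ≟ L
  ... | yes refl = m≤m+n _ _
  ... | no  k≢L  = ≤-trans (accumulate-large M L (≤∧≢⇒< k≤L k≢L)) (m≤n+m _ _)

  -- An exponent `h` with `(Q/P) ^ h ≥ p ^ ℓ` for all moduli `p = k + 2 ≤ ℓ + 1` at once, since it
  -- must be chosen before the group and its prime.
  saving : ℕ → ℕ
  saving ℓ = accumulate (suc ℓ ^ ℓ) ℓ

  P-nonZero : ∀ k → NonZero (Rate.P k)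
  P-nonZero k = >-nonZero (cube-mono (≤-trans (m^n>0 d n) (m≤m+n a b)))
    where
    open Rate k
    open Weights e using (d)

  saving-spec : ∀ {ℓ k} → k < ℓ → suc (suc k) ^ ℓ * Rate.P k ^ saving ℓ ≤ Rate.Q k ^ saving ℓ
  saving-spec {ℓ} {k} k<ℓ = ≤-trans (*-monoˡ-≤ _ (^-monoˡ-≤ ℓ (s≤s k<ℓ)))
    (outgrow {{P-nonZero k}} (Rate.P<Q k) (suc ℓ ^ ℓ) (accumulate-large (suc ℓ ^ ℓ) ℓ k<ℓ))

  module Uniform (G : FinGroup) {n : ℕ} (prime : Prime (suc n)) (K : Coords G (suc n)) where
    open Coords K
    open PairsBound n prime using (fourth; fourth-mono; fourth-*; fourth-^; fourth-p^; pairs-square; 2≤p)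

    t : ℕ
    t = r * n / 3

    lows : List (Fin s × Vec (Fin (suc n)) r)
    lows = cartesianProduct (allFin s) (lowVecs (suc n) r t)

    R : ℕ
    R = s * length (lowVecs (suc n) r t)

    length-lows : length lows ≡ R
    length-lows = trans (length-× (allFin s) _) (cong (_* length (lowVecs (suc n) r t)) (length-tabulate {n = s} id))

    big : r * n < 3 * suc t
    big = begin-strict
      r * n ≡⟨ m≡m%n+[m/n]*n (r * n) 3 ⟩
      r * n % 3 + t * 3 <⟨ +-monoˡ-< (t * 3) (m%n<n (r * n) 3) ⟩
      3 + t * 3 ≡⟨ *-comm (suc t) 3 ⟩
      3 * suc t ∎

    -- With `T = N m²`, the count reads `p ^ (2 T) ≤ p ^ (3 R) * Z ^ N`. After fourth powers
    -- `pairs-square` applies, and the exponents give `8 T ≤ 12 R + 7 T`.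
    volume-≤ : ∀ {N m} → Family G (Fin N) (λ _ → m) (λ _ → m) (λ _ → m) → N * (m * m) ≤ 12 * R
    volume-≤ {N} {m} fam = +-cancelʳ-≤ (7 * T) _ _ (^-cancelˡ-≤ p 2≤p (begin
      p ^ (T + 7 * T) ≡⟨ cong (p ^_) (eight T) ⟩
      p ^ (4 * (T + T)) ≡⟨ fourth-p^ (T + T) ⟨
      fourth (p ^ (T + T)) ≡⟨ cong fourth (trans (^-distribˡ-+-* p T T) (sym (cong₂ _*_ X≡ X≡))) ⟩
      fourth (X * X) ≤⟨ fourth-mono count ⟩
      fourth (p ^ R' * (p ^ R' * p ^ R' * Z ^ N)) ≡⟨ cong fourth (trans (sym (*-assoc (p ^ R') _ _)) (cong (_* Z ^ N) p^3R)) ⟩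
      fourth (p ^ (3 * R') * Z ^ N) ≡⟨ fourth-* (p ^ (3 * R')) (Z ^ N) ⟩
      fourth (p ^ (3 * R')) * fourth (Z ^ N) ≡⟨ cong₂ _*_ (fourth-p^ (3 * R')) fourth-power ⟩
      p ^ (4 * (3 * R')) * fourth Z ^ N   ≤⟨ *-monoʳ-≤ (p ^ (4 * (3 * R'))) (^-monoˡ-≤ N (pairs-square m)) ⟩
      p ^ (4 * (3 * R')) * (p ^ (7 * (m * m))) ^ N ≡⟨ cong₂ _*_ (cong (p ^_) (sym (*-assoc 4 3 R'))) (trans (^-*-assoc p (7 * (m * m)) N) (cong (p ^_) (seven m N))) ⟩
      p ^ (12 * R') * p ^ (7 * T) ≡⟨ ^-distribˡ-+-* p (12 * R') (7 * T) ⟨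
      p ^ (12 * R' + 7 * T) ≡⟨ cong (λ z → p ^ (12 * z + 7 * T)) length-lows ⟩
      p ^ (12 * R + 7 * T) ∎))
      where
      open Counting G n prime K
      open Bound fam big lows (λ σ α w → ∈-cartesianProduct⁺ (∈-allFin σ) (lowVecs-complete t α w)) using (count; Z) renaming (R to R')
      p T X : ℕ
      p = suc n
      T = N * (m * m)
      X = ((p ^ m) ^ m) ^ N
      eight : ∀ T → T + 7 * T ≡ 4 * (T + T)
      eight = solve-∀
      seven : ∀ m N → 7 * (m * m) * N ≡ 7 * (N * (m * m))
      seven = solve-∀
      X≡ : X ≡ p ^ T
      X≡ = trans (cong (_^ N) (^-*-assoc p m m)) (trans (^-*-assoc p (m * m) N) (cong (p ^_) (*-comm (m * m) N)))
      p^3R : p ^ R' * (p ^ R' * p ^ R') ≡ p ^ (3 * R')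
      p^3R = trans (cong (p ^ R' *_) (sym (^-distribˡ-+-* p R' R'))) (trans (sym (^-distribˡ-+-* p R' (R' + R')))
        (cong (λ z → p ^ (R' + (R' + z))) (sym (+-identityʳ R'))))
      fourth-power : fourth (Z ^ N) ≡ fourth Z ^ N
      fourth-power = trans (fourth-^ (Z ^ N)) (trans (^-*-assoc Z N 4) (trans (cong (Z ^_) (*-comm N 4))
        (trans (sym (^-*-assoc Z 4 N)) (cong (_^ N) (sym (fourth-^ Z))))))

  module Rated (G : FinGroup) {k : ℕ} (prime : Prime (suc (suc k))) (K : Coords G (suc (suc k))) where
    open FinGroup G using (size)
    open Coords K
    open Uniform G prime K
    open Rate k using (P; Q; lowVecs-rate)

    R-rate : cube R * Q ^ r ≤ cube size * P ^ r
    R-rate = begin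
      cube (s * L) * Q ^ r ≡⟨ cong (_* Q ^ r) (cube-* s L) ⟩
      cube s * cube L * Q ^ r ≡⟨ *-assoc (cube s) (cube L) (Q ^ r) ⟩
      cube s * (cube L * Q ^ r) ≤⟨ *-monoʳ-≤ (cube s) (lowVecs-rate r t (≤-trans (≤-reflexive (*-comm 3 t)) (m/n*n≤m (r * suc k) 3))) ⟩
      cube s * (cube p * P) ^ r ≡⟨ cong (cube s *_) (trans (^-distribʳ-* (cube p) P r) (cong (_* P ^ r) (sym (cube-^ p r)))) ⟩
      cube s * (cube (p ^ r) * P ^ r) ≡⟨ *-assoc (cube s) (cube (p ^ r)) (P ^ r) ⟨
      cube s * cube (p ^ r) * P ^ r ≡⟨ cong (_* P ^ r) (cube-* s (p ^ r)) ⟨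
      cube (s * p ^ r) * P ^ r ≤⟨ *-monoˡ-≤ (P ^ r) (cube-mono volume) ⟩
      cube size * P ^ r ∎
      where
      p L : ℕ
      p = suc (suc k)
      L = length (lowVecs p r t)

    -- By the choice of `h`, `(Q/P) ^ (h r) ≥ p ^ (r ℓ) ≥ size`: the `h`-th power of `R-rate` saves
    -- a full factor `size`.
    R-saving : ∀ {ℓ} → k < ℓ → size ≤ (suc (suc k) ^ r) ^ ℓ → cube R ^ saving ℓ * size ≤ cube size ^ saving ℓ
    R-saving {ℓ} k<ℓ size≤ = *-cancelʳ-≤ _ _ ((P ^ h) ^ r) {{m^n≢0 (P ^ h) r {{m^n≢0 P h {{P-nonZero k}}}}}} (begin
      cube R ^ h * size * (P ^ h) ^ r ≤⟨ *-monoˡ-≤ _ (*-monoʳ-≤ (cube R ^ h) size≤) ⟩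
      cube R ^ h * (p ^ r) ^ ℓ * (P ^ h) ^ r ≡⟨ cong (λ z → cube R ^ h * z * (P ^ h) ^ r) (exchange p r ℓ) ⟩
      cube R ^ h * (p ^ ℓ) ^ r * (P ^ h) ^ r ≡⟨ *-assoc (cube R ^ h) _ _ ⟩
      cube R ^ h * ((p ^ ℓ) ^ r * (P ^ h) ^ r) ≡⟨ cong (cube R ^ h *_) (^-distribʳ-* (p ^ ℓ) (P ^ h) r) ⟨
      cube R ^ h * (p ^ ℓ * P ^ h) ^ r ≤⟨ *-monoʳ-≤ (cube R ^ h) (^-monoˡ-≤ r (saving-spec k<ℓ)) ⟩
      cube R ^ h * (Q ^ h) ^ r ≡⟨ cong (cube R ^ h *_) (exchange Q h r) ⟩
      cube R ^ h * (Q ^ r) ^ h ≡⟨ ^-distribʳ-* (cube R) (Q ^ r) h ⟨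
      (cube R * Q ^ r) ^ h ≤⟨ ^-monoˡ-≤ h R-rate ⟩
      (cube size * P ^ r) ^ h ≡⟨ ^-distribʳ-* (cube size) (P ^ r) h ⟩
      cube size ^ h * (P ^ r) ^ h ≡⟨ cong (cube size ^ h *_) (exchange P r h) ⟩
      cube size ^ h * (P ^ h) ^ r ∎)
      where
      p h : ℕ
      p = suc (suc k)
      h = saving ℓ
      exchange : ∀ x a b → (x ^ a) ^ b ≡ (x ^ b) ^ a
      exchange x a b = trans (^-*-assoc x a b) (trans (cong (x ^_) (*-comm a b)) (sym (^-*-assoc x b a)))

    family-saving : ∀ {ℓ} → k < ℓ → size ≤ (suc (suc k) ^ r) ^ ℓ →
      ∀ {N m} → Family G (Fin N) (λ _ → m) (λ _ → m) (λ _ → m) →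
      cube (N * (m * m)) ^ saving ℓ * size ≤ cube (12 * size) ^ saving ℓ
    family-saving {ℓ} k<ℓ size≤ {N} {m} fam = begin
      cube (N * (m * m)) ^ h * size ≤⟨ *-monoˡ-≤ size (^-monoˡ-≤ h (cube-mono (volume-≤ fam))) ⟩
      cube (12 * R) ^ h * size ≡⟨ cong (λ z → z ^ h * size) (cube-* 12 R) ⟩
      (cube 12 * cube R) ^ h * size ≡⟨ cong (_* size) (^-distribʳ-* (cube 12) (cube R) h) ⟩
      cube 12 ^ h * cube R ^ h * size ≡⟨ *-assoc (cube 12 ^ h) (cube R ^ h) size ⟩
      cube 12 ^ h * (cube R ^ h * size)   ≤⟨ *-monoʳ-≤ (cube 12 ^ h) (R-saving k<ℓ size≤) ⟩
      cube 12 ^ h * cube size ^ h ≡⟨ ^-distribʳ-* (cube 12) (cube size) h ⟨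
      (cube 12 * cube size) ^ h ≡⟨ cong (_^ h) (cube-* 12 size) ⟨
      cube (12 * size) ^ h ∎
      where
      h : ℕ
      h = saving ℓ

  module _ (G : FinGroup) where
    open FinGroup G

    uniform-family-bound : ∀ {ℓ m} → 1 ≤ m → m ≤ ℓ → (∀ x → m · x ≡ 𝟘) →
      ∀ {N a} → Family G (Fin N) (λ _ → a) (λ _ → a) (λ _ → a) →
      cube (N * (a * a)) ^ saving ℓ * size ≤ cube (12 * size) ^ saving ℓ
    uniform-family-bound {ℓ} {m} 1≤m m≤ℓ kills fam with LargeTorsion.large-torsion G m 1≤m kills
    ... | record { n = zero ; isPrime = pr } , _ = contradiction (nonTrivial⇒n>1 1 {{prime⇒nonTrivial pr}}) (λ { (s≤s ()) })
    ... | record { n = suc k ; isPrime = pr ; K = K } , p≤ , size≤ = Rated.family-saving G pr K (≤-trans (s≤s⁻¹ p≤) m≤ℓ)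
      (≤-trans size≤ (^-monoʳ-≤ (suc (suc k) ^ Coords.r K) {{m^n≢0 (suc (suc k)) (Coords.r K)}} m≤ℓ)) fam

-- Products, rotations and restrictions of families.

module FamilyOperations where

  open Families
  open Groups
  open import Data.Fin as Fin using (Fin; zero; suc; combine; remQuot)
  import Data.Fin.Properties as Finₚ
  open import Data.Nat using (ℕ; zero; suc; _*_; _^_)
  open import Data.Product using (Σ; _×_; _,_; proj₁; proj₂)
  open import Data.Unit using (⊤; tt)
  open import Relation.Binary.PropositionalEquality hiding (J)

  infixr 7 _⊗_

  _⊗_ : FinGroup → FinGroup → FinGroup
  G ⊗ H = record
    { C = G.C × H.C
    ; _⊕_ = λ (x , y) (x' , y') → x G.⊕ x' , y H.⊕ y'
    ; 𝟘 = G.𝟘 , H.𝟘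
    ; ⊖_ = λ (x , y) → G.⊖ x , H.⊖ y
    ; isAbelianGroup = record
      { isGroup = record
        { isMonoid = record
          { isSemigroup = record
            { isMagma = record { isEquivalence = isEquivalence ; ∙-cong = cong₂ _ }
            ; assoc = λ (x , y) (x' , y') (x″ , y″) → cong₂ _,_ (G.assoc x x' x″) (H.assoc y y' y″) }
          ; identity = (λ (x , y) → cong₂ _,_ (G.identityˡ x) (H.identityˡ y)) , (λ (x , y) → cong₂ _,_ (G.identityʳ x) (H.identityʳ y)) }
        ; inverse = (λ (x , y) → cong₂ _,_ (G.inverseˡ x) (H.inverseˡ y)) , (λ (x , y) → cong₂ _,_ (G.inverseʳ x) (H.inverseʳ y))
        ; ⁻¹-cong = λ e → cong₂ _,_ (cong (λ w → G.⊖ proj₁ w) e) (cong (λ w → H.⊖ proj₂ w) e) }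
      ; comm = λ (x , y) (x' , y') → cong₂ _,_ (G.comm x x') (H.comm y y') }
    ; size = G.size * H.size
    ; enc = λ (x , y) → combine (G.enc x) (H.enc y)
    ; dec = λ i → G.dec (proj₁ (remQuot {G.size} H.size i)) , H.dec (proj₂ (remQuot {G.size} H.size i))
    ; dec-enc = λ (x , y) → trans (cong (λ w → G.dec (proj₁ w) , H.dec (proj₂ w)) (Finₚ.remQuot-combine (G.enc x) (H.enc y)))
                                  (cong₂ _,_ (G.dec-enc x) (H.dec-enc y))
    ; enc-dec = λ i → trans (cong₂ combine (G.enc-dec _) (H.enc-dec _)) (Finₚ.combine-remQuot {G.size} H.size i)
    }
    where
    module G = FinGroup G
    module H = FinGroup H

  𝟙 : FinGroup
  𝟙 = record
    { C = ⊤
    ; _⊕_ = λ _ _ → tt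
    ; 𝟘 = tt
    ; ⊖_ = λ _ → tt
    ; isAbelianGroup = record
      { isGroup = record
        { isMonoid = record
          { isSemigroup = record
            { isMagma = record { isEquivalence = isEquivalence ; ∙-cong = λ _ _ → refl }
            ; assoc = λ _ _ _ → refl }
          ; identity = (λ _ → refl) , (λ _ → refl) }
        ; inverse = (λ _ → refl) , (λ _ → refl)
        ; ⁻¹-cong = λ _ → refl }
      ; comm = λ _ _ → refl }
    ; size = 1
    ; enc = λ _ → zero
    ; dec = λ _ → tt
    ; dec-enc = λ _ → refl
    ; enc-dec = λ { zero → refl }
    }

  _^ᴳ_ : FinGroup → ℕ → FinGroup
  G ^ᴳ zero  = 𝟙
  G ^ᴳ suc n = G ⊗ G ^ᴳ n

  size-^ᴳ : ∀ G n → FinGroup.size (G ^ᴳ n) ≡ FinGroup.size G ^ n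
  size-^ᴳ G zero    = refl
  size-^ᴳ G (suc n) = cong (FinGroup.size G *_) (size-^ᴳ G n)

  Kills : ℕ → FinGroup → Set
  Kills m G = ∀ x → m · x ≡ 𝟘
    where open FinGroup G

  ·-⊗ : ∀ G H m x y → FinGroup._·_ (G ⊗ H) m (x , y) ≡ (FinGroup._·_ G m x , FinGroup._·_ H m y)
  ·-⊗ G H zero    x y = refl
  ·-⊗ G H (suc m) x y = cong (FinGroup._⊕_ (G ⊗ H) (x , y)) (·-⊗ G H m x y)

  kills-⊗ : ∀ m G H → Kills m G → Kills m H → Kills m (G ⊗ H)
  kills-⊗ m G H g h (x , y) = trans (·-⊗ G H m x y) (cong₂ _,_ (g x) (h y))

  kills-^ᴳ : ∀ m G n → Kills m G → Kills m (G ^ᴳ n)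
  kills-^ᴳ m G zero    g tt = refl
  kills-^ᴳ m G (suc n) g    = kills-⊗ m G (G ^ᴳ n) g (kills-^ᴳ m G n g)

  private
    variable
      I J : Set
      a b c a' b' c' : I → ℕ

    Ix : (I → ℕ) → Set
    Ix {I} a = Σ I (λ i → Fin (a i))

    -- The components of `α` and `α'` enter as variables with equations, so that the equalities of
    -- indexed pairs can be matched by `refl`.
    pair-≡ : ∀ {a : I → ℕ} {a' : J → ℕ} {i k j l} {α : Fin (a i * a' j)} {α' : Fin (a k * a' l)} {β β' γ γ'} →
             proj₁ (remQuot {a i} (a' j) α) ≡ β → proj₁ (remQuot {a k} (a' l) α') ≡ β' →
             proj₂ (remQuot {a i} (a' j) α) ≡ γ → proj₂ (remQuot {a k} (a' l) α') ≡ γ' →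
             _≡_ {A = Ix a} (i , β) (k , β') → _≡_ {A = Ix a'} (j , γ) (l , γ') →
             _≡_ {A = Ix {I × J} (λ (i , j) → a i * a' j)} ((i , j) , α) ((k , l) , α')
    pair-≡ {a = a} {a'} {i} {.i} {j} {.j} {α} {α'} e₁ e₂ e₃ e₄ refl refl = cong ((i , j) ,_)
      (trans (sym (Finₚ.combine-remQuot {a i} (a' j) α)) (trans (cong₂ combine (trans e₁ (sym e₂)) (trans e₃ (sym e₄)))
        (Finₚ.combine-remQuot {a i} (a' j) α')))

  _⊗ᶠ_ : ∀ {G H} → Family G I a b c → Family H J a' b' c' →
         Family (G ⊗ H) (I × J) (λ (i , j) → a i * a' j) (λ (i , j) → b i * b' j) (λ (i , j) → c i * c' j)
  _⊗ᶠ_ {a = a} {b = b} {c = c} {a' = a'} {b' = b'} {c' = c'} F F' = record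
    { x = λ (i , j) α β → F.x i (fst (a i) (a' j) α) (fst (b i) (b' j) β) , F'.x j (snd (a i) (a' j) α) (snd (b i) (b' j) β)
    ; y = λ (i , j) β γ → F.y i (fst (b i) (b' j) β) (fst (c i) (c' j) γ) , F'.y j (snd (b i) (b' j) β) (snd (c i) (c' j) γ)
    ; z = λ (i , j) γ α → F.z i (fst (c i) (c' j) γ) (fst (a i) (a' j) α) , F'.z j (snd (c i) (c' j) γ) (snd (a i) (a' j) α)
    ; triangle = λ (i , j) α β γ → cong₂ _,_ (F.triangle i _ _ _) (F'.triangle j _ _ _)
    ; matches = λ α β β″ γ γ″ α″ e →
        let (p₁ , p₂ , p₃) = F.matches _ _ _ _ _ _ (cong proj₁ e)
            (q₁ , q₂ , q₃) = F'.matches _ _ _ _ _ _ (cong proj₂ e)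
        in pair-≡ refl refl refl refl p₁ q₁ , pair-≡ refl refl refl refl p₂ q₂ , pair-≡ refl refl refl refl p₃ q₃
    }
    where
    module F = Family F
    module F' = Family F'
    fst : ∀ m n → Fin (m * n) → Fin m
    fst m n w = proj₁ (remQuot {m} n w)
    snd : ∀ m n → Fin (m * n) → Fin n
    snd m n w = proj₂ (remQuot {m} n w)

  𝟙ᶠ : Family 𝟙 ⊤ (λ _ → 1) (λ _ → 1) (λ _ → 1)
  𝟙ᶠ = record
    { x = λ _ _ _ → tt ; y = λ _ _ _ → tt ; z = λ _ _ _ → tt ; triangle = λ _ _ _ _ → refl
    ; matches = λ { zero zero zero zero zero zero _ → refl , refl , refl } }

  rotate : ∀ {G} → Family G I a b c → Family G I b c a
  rotate {G = G} F = record
    { x = F.y ; y = F.z ; z = F.x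
    ; triangle = λ i β γ α → trans (rotation (F.y i β γ) (F.z i γ α) (F.x i α β)) (F.triangle i α β γ)
    ; matches = λ β γ γ' α α' β' e →
        let (p₁ , p₂ , p₃) = F.matches α' β' β γ γ' α (trans (sym (rotation _ _ _)) e) in sym p₂ , p₃ , sym p₁
    }
    where
    module F = Family F
    open FinGroup G
    rotation : ∀ y z x → y ⊕ z ⊕ x ≡ x ⊕ y ⊕ z
    rotation y z x = trans (comm (y ⊕ z) x) (sym (assoc x y z))

  -- Along a type class the block dimensions are constant only propositionally; `ea`, `eb` and `ec`
  -- pass to literally constant dimensions, which the count requires.
  reindex : ∀ {G} {a b c : I → ℕ} {a' b' c' : J → ℕ} (f : J → I) → (∀ {j k} → f j ≡ f k → j ≡ k) →
            (∀ j → a' j ≡ a (f j)) → (∀ j → b' j ≡ b (f j)) → (∀ j → c' j ≡ c (f j)) →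
            Family G I a b c → Family G J a' b' c'
  reindex {I} {J} f injective ea eb ec F = record
    { x = λ j α β → F.x (f j) (subst Fin (ea j) α) (subst Fin (eb j) β)
    ; y = λ j β γ → F.y (f j) (subst Fin (eb j) β) (subst Fin (ec j) γ)
    ; z = λ j γ α → F.z (f j) (subst Fin (ec j) γ) (subst Fin (ea j) α)
    ; triangle = λ j α β γ → F.triangle (f j) _ _ _
    ; matches = λ α β β' γ γ' α' e → let (p₁ , p₂ , p₃) = F.matches _ _ _ _ _ _ e in
                  pull ea p₁ , pull eb p₂ , pull ec p₃
    }
    where
    module F = Family F
    component : ∀ {n : I → ℕ} {i} {α α' : Fin (n i)} → _≡_ {A = Ix n} (i , α) (i , α') → α ≡ α'
    component refl = refl
    pull : ∀ {n : I → ℕ} {n' : J → ℕ} (e : ∀ j → n' j ≡ n (f j)) {j k} {α : Fin (n' j)} {α' : Fin (n' k)} →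
           _≡_ {A = Ix n} (f j , subst Fin (e j) α) (f k , subst Fin (e k) α') → _≡_ {A = Ix n'} (j , α) (k , α')
    pull e {j} h with injective (cong proj₁ h)
    ... | refl = cong (j ,_) (subst-injective (e j) (component h))

  Words : Set → ℕ → Set
  Words I zero    = ⊤
  Words I (suc n) = I × Words I n

  prod : (I → ℕ) → ∀ n → Words I n → ℕ
  prod a zero    _       = 1
  prod a (suc n) (i , w) = a i * prod a n w

  _^ᶠ_ : ∀ {G} → Family G I a b c → ∀ n → Family (G ^ᴳ n) (Words I n) (prod a n) (prod b n) (prod c n)
  F ^ᶠ zero  = 𝟙ᶠ
  F ^ᶠ suc n = F ⊗ᶠ (F ^ᶠ n)

-- Words and their type classes.

module TypeClasses where

  open Chernoff using (Σ<; Σ<-cong)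
  open FunToFin using (funToFin-injective)
  open FamilyOperations using (Words; prod)
  open import Data.Fin as Fin using (Fin; zero; suc; fromℕ<; funToFin)
  import Data.Fin.Properties as Finₚ
  open import Data.List using (List; []; _∷_; map; allFin; filter; length; lookup; cartesianProduct; _++_)
  open import Data.List.Membership.Propositional.Properties using (∈-lookup)
  open import Data.List.Properties using (filter-accept; filter-reject; map-++)
  open import Data.List.Relation.Unary.All as All using (All; []; _∷_)
  open import Data.List.Relation.Unary.All.Properties using (all-filter)
  open import Data.List.Relation.Unary.AllPairs using (AllPairs; []; _∷_)
  open import Data.List.Relation.Unary.Unique.Propositional using (Unique)
  import Data.List.Relation.Unary.Unique.Propositional.Properties as Uniqueₚ
  open import Data.Nat
  open import Data.Nat.ListAction using (sum)
  open import Data.Nat.ListAction.Properties using (sum-++)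
  open import Data.Nat.Properties
  open import Data.Nat.Tactic.RingSolver using (solve-∀)
  open import Data.Product using (_,_; ∃-syntax)
  open import Data.Sum using (_⊎_; inj₁; inj₂)
  open import Data.Unit using (tt)
  open import Function using (_∘_)
  open import Relation.Nullary using (¬_; contradiction)
  open import Relation.Binary.PropositionalEquality
  open ≤-Reasoning

  private
    variable
      A B : Set
      k n : ℕ

  lookup-injective : ∀ {R : A → A → Set} → (∀ {x y} → R x y → R y x) → ∀ {xs} → AllPairs (λ x y → ¬ R x y) xs →
                     ∀ {i j} → R (lookup xs i) (lookup xs j) → i ≡ j
  lookup-injective sm (x∉ ∷ ap) {zero}  {zero}  h = refl
  lookup-injective sm (x∉ ∷ ap) {zero}  {suc j} h = contradiction h (All.lookup x∉ (∈-lookup j))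
  lookup-injective sm (x∉ ∷ ap) {suc i} {zero}  h = contradiction (sm h) (All.lookup x∉ (∈-lookup i))
  lookup-injective sm (x∉ ∷ ap) {suc i} {suc j} h = cong suc (lookup-injective sm ap h)

  unit : Fin k → Fin k → ℕ
  unit zero    zero    = 1
  unit zero    (suc i) = 0
  unit (suc j) zero    = 0
  unit (suc j) (suc i) = unit j i

  unit≤1 : (j i : Fin k) → unit j i ≤ 1
  unit≤1 zero    zero    = ≤-refl
  unit≤1 zero    (suc i) = z≤n
  unit≤1 (suc j) zero    = z≤n
  unit≤1 (suc j) (suc i) = unit≤1 j i

  counts : ∀ n → Words (Fin k) n → Fin k → ℕ
  counts zero    _       i = 0
  counts (suc n) (j , w) i = unit j i + counts n w i

  counts≤ : ∀ n (w : Words (Fin k) n) i → counts n w i ≤ n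
  counts≤ zero    _       i = z≤n
  counts≤ (suc n) (j , w) i = +-mono-≤ (unit≤1 j i) (counts≤ n w i)

  monomial : ∀ k → (Fin k → ℕ) → (Fin k → ℕ) → ℕ
  monomial zero    φ e = 1
  monomial (suc k) φ e = φ zero ^ e zero * monomial k (φ ∘ suc) (e ∘ suc)

  monomial-cong : ∀ k φ {e e'} → (∀ i → e i ≡ e' i) → monomial k φ e ≡ monomial k φ e'
  monomial-cong zero    φ h = refl
  monomial-cong (suc k) φ h = cong₂ _*_ (cong (φ zero ^_) (h zero)) (monomial-cong k (φ ∘ suc) (h ∘ suc))

  monomial-0 : ∀ k φ → monomial k φ (λ _ → 0) ≡ 1
  monomial-0 zero    φ = refl
  monomial-0 (suc k) φ = trans (*-identityˡ _) (monomial-0 k (φ ∘ suc))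

  monomial-unit : ∀ {k} φ (j : Fin k) e → monomial k φ (λ i → unit j i + e i) ≡ φ j * monomial k φ e
  monomial-unit φ zero    e = *-assoc (φ zero) (φ zero ^ e zero) _
  monomial-unit {suc k} φ (suc j) e = trans (cong (φ zero ^ e zero *_) (monomial-unit (φ ∘ suc) j (e ∘ suc)))
    (swap (φ zero ^ e zero) (φ (suc j)) _)
    where
    swap : ∀ x y z → x * (y * z) ≡ y * (x * z)
    swap = solve-∀

  prod-counts : ∀ φ n (w : Words (Fin k) n) → prod φ n w ≡ monomial k φ (counts n w)
  prod-counts {k} φ zero    _       = sym (monomial-0 k φ)
  prod-counts {k} φ (suc n) (j , w) = trans (cong (φ j *_) (prod-counts φ n w)) (sym (monomial-unit φ j (counts n w)))

  -- The type of a word is its vector of letter counts; for fixed `k` the number of types is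
  -- polynomial in `n`.
  class : ∀ k n → Words (Fin k) n → Fin (suc n ^ k)
  class k n w = funToFin (λ i → fromℕ< (s≤s (counts≤ n w i)))

  class-prod : ∀ φ n {w w' : Words (Fin k) n} → class k n w ≡ class k n w' → prod φ n w ≡ prod φ n w'
  class-prod {k} φ n {w} {w'} e = trans (prod-counts φ n w) (trans (monomial-cong k φ λ i →
    trans (sym (Finₚ.toℕ-fromℕ< _)) (trans (cong Fin.toℕ (funToFin-injective e i)) (Finₚ.toℕ-fromℕ< _))) (sym (prod-counts φ n w')))

  total : List A → (A → ℕ) → ℕ
  total xs f = sum (map f xs)

  total-× : ∀ (xs : List A) (ys : List B) (f : A → ℕ) (g : B → ℕ) →
            total (cartesianProduct xs ys) (λ (x , y) → f x * g y) ≡ total xs f * total ys g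
  total-× []       ys f g = refl
  total-× (x ∷ xs) ys f g = begin-equality
    sum (map F (map (x ,_) ys ++ cartesianProduct xs ys)) ≡⟨ cong sum (map-++ F (map (x ,_) ys) _) ⟩
    sum (map F (map (x ,_) ys) ++ map F (cartesianProduct xs ys)) ≡⟨ sum-++ (map F (map (x ,_) ys)) _ ⟩
    sum (map F (map (x ,_) ys)) + total (cartesianProduct xs ys) F ≡⟨ cong₂ _+_ (row ys) (total-× xs ys f g) ⟩
    f x * total ys g + total xs f * total ys g ≡⟨ *-distribʳ-+ (total ys g) (f x) _ ⟨
    (f x + total xs f) * total ys g ∎
    where
    F : _ → ℕ
    F (x , y) = f x * g y
    row : ∀ ys → sum (map F (map (x ,_) ys)) ≡ f x * total ys g
    row []       = sym (*-zeroʳ (f x))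
    row (y ∷ ys) = trans (cong (f x * g y +_) (row ys)) (sym (*-distribˡ-+ (f x) (g y) _))

  words : ∀ k n → List (Words (Fin k) n)
  words k zero    = tt ∷ []
  words k (suc n) = cartesianProduct (allFin k) (words k n)

  words-unique : ∀ k n → Unique (words k n)
  words-unique k zero    = [] ∷ []
  words-unique k (suc n) = Uniqueₚ.cartesianProduct⁺ (Uniqueₚ.allFin⁺ k) (words-unique k n)

  total-words : ∀ k n φ → total (words k n) (prod φ n) ≡ total (allFin k) φ ^ n
  total-words k zero    φ = refl
  total-words k (suc n) φ = trans (total-× (allFin k) (words k n) φ (prod φ n)) (cong (total (allFin k) φ *_) (total-words k n φ))

  Σ<-bump : ∀ {K} (j : Fin K) v {h h' : Fin K → ℕ} → h' j ≡ v + h j → (∀ t → t ≢ j → h' t ≡ h t) → Σ< K h' ≡ v + Σ< K h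
  Σ<-bump {suc K} zero v {h} {h'} on off = trans (cong₂ _+_ on (Σ<-cong K λ t → off (suc t) λ ())) (+-assoc v (h zero) _)
  Σ<-bump {suc K} (suc j) v {h} {h'} on off = trans (cong₂ _+_ (off zero λ ())
    (Σ<-bump j v on λ t ne → off (suc t) (ne ∘ Finₚ.suc-injective))) (swap (h zero) v _)
    where
    swap : ∀ x y z → x + (y + z) ≡ y + (x + z)
    swap = solve-∀

  Σ<-0 : ∀ K → Σ< K (λ _ → 0) ≡ 0
  Σ<-0 zero    = refl
  Σ<-0 (suc K) = Σ<-0 K

  module _ {K : ℕ} (κ : A → Fin K) where
    fibre : Fin K → List A → List A
    fibre t = filter (λ w → κ w Fin.≟ t)

    total-fibres : ∀ (f : A → ℕ) ws → total ws f ≡ Σ< K (λ t → total (fibre t ws) f)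
    total-fibres f []       = sym (Σ<-0 K)
    total-fibres f (w ∷ ws) = trans (cong (f w +_) (total-fibres f ws)) (sym (Σ<-bump (κ w) (f w)
      (cong (λ l → total l f) (filter-accept (λ w → κ w Fin.≟ _) refl))
      (λ t ne → cong (λ l → total l f) (filter-reject (λ w → κ w Fin.≟ t) (ne ∘ sym)))))

  largest-term : ∀ K (g : Fin (suc K) → ℕ) → ∃[ t ] Σ< (suc K) g ≤ suc K * g t
  largest-term zero    g = zero , ≤-refl
  largest-term (suc K) g with largest-term K (g ∘ suc)
  ... | t , h with ≤-total (g zero) (g (suc t))
  ...   | inj₁ le = suc t , +-mono-≤ le h
  ...   | inj₂ le = zero , +-monoʳ-≤ (g zero) (≤-trans h (*-monoʳ-≤ (suc K) le))

  total-const : ∀ (xs : List A) (f : A → ℕ) v → All (λ x → f x ≡ v) xs → total xs f ≡ length xs * v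
  total-const []       f v []       = refl
  total-const (x ∷ xs) f v (e ∷ es) = cong₂ _+_ e (total-const xs f v es)

  -- `same` holds for every weight `ψ`, so one class fixes the three block dimensions and the weight
  -- `φ` simultaneously.
  record TypeClass (k n : ℕ) (φ : Fin k → ℕ) (B : ℕ) : Set where
    field
      N         : ℕ
      word      : Fin N → Words (Fin k) n
      injective : ∀ {i j} → word i ≡ word j → i ≡ j
      w₀        : Words (Fin k) n
      same      : ∀ ψ i → prod ψ n (word i) ≡ prod ψ n w₀
      large     : total (allFin k) φ ^ n ≤ B * (N * prod φ n w₀)

  -- The heaviest of `B` fibres carries at least `1/B` of the total. If it is empty there is no word
  -- `w₀`, but then the total is zero; this is the first alternative.
  large-fibre : ∀ k n φ B → 0 < B → (κ : Words (Fin k) n → Fin B) →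
                (∀ ψ {w w'} → κ w ≡ κ w' → prod ψ n w ≡ prod ψ n w') → total (allFin k) φ ^ n ≡ 0 ⊎ TypeClass k n φ B
  large-fibre k n φ (suc K) _ κ κ-prod with largest-term K (λ t → total (fibre κ t (words k n)) (prod φ n))
  ... | t , h with fibre κ t (words k n) in eq
  ...   | []     = inj₁ (n≤0⇒n≡0 (begin
    total (allFin k) φ ^ n   ≡⟨ total-words k n φ ⟨
    total (words k n) (prod φ n) ≡⟨ total-fibres κ (prod φ n) (words k n) ⟩
    Σ< (suc K) (λ t → total (fibre κ t (words k n)) (prod φ n)) ≤⟨ h ⟩
    suc K * 0 ≡⟨ *-zeroʳ (suc K) ⟩
    0 ∎))
  ...   | w ∷ ws = inj₂ (record
    { N = length (w ∷ ws) ; word = lookup (w ∷ ws)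
    ; injective = lookup-injective {R = _≡_} sym unique
    ; w₀ = w
    ; same = λ ψ i → κ-prod ψ (trans (All.lookup classes (∈-lookup i)) (sym (All.head classes)))
    ; large = begin
        total (allFin k) φ ^ n   ≡⟨ total-words k n φ ⟨
        total (words k n) (prod φ n) ≡⟨ total-fibres κ (prod φ n) (words k n) ⟩
        Σ< (suc K) (λ t → total (fibre κ t (words k n)) (prod φ n)) ≤⟨ h ⟩
        suc K * total (w ∷ ws) (prod φ n)
          ≡⟨ cong (suc K *_) (total-const (w ∷ ws) (prod φ n) (prod φ n w) (All.map (λ e → κ-prod φ (trans e (sym (All.head classes)))) classes)) ⟩
        suc K * (length (w ∷ ws) * prod φ n w) ∎ })
    where
    unique : Unique (w ∷ ws)
    unique = subst Unique eq (Uniqueₚ.filter⁺ (λ w → κ w Fin.≟ t) (words-unique k n))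
    classes : All (λ w → κ w ≡ t) (w ∷ ws)
    classes = subst (All _) eq (all-filter (λ w → κ w Fin.≟ t) (words k n))

  type-class : ∀ k n φ → total (allFin k) φ ^ n ≡ 0 ⊎ TypeClass k n φ (suc n ^ k)
  type-class k n φ = large-fibre k n φ (suc n ^ k) (m^n>0 (suc n) k) (class k n) (λ ψ → class-prod ψ n)

-- From cubes to arbitrary families.

module Weighted where

  open Chernoff using (cube; cube-mono)
  open Families
  open FamilyOperations
  open Groups
  open Powers
  open Saving using (saving; uniform-family-bound)
  open TypeClasses
  open import Data.Fin as Fin using (Fin; zero; suc; combine; remQuot)
  import Data.Fin.Properties as Finₚ
  open import Data.List using (allFin)
  open import Data.Nat
  open import Data.Nat.Properties
  open import Data.Nat.Tactic.RingSolver using (solve-∀)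
  open import Data.Product using (_×_; _,_; proj₁; proj₂)
  open import Data.Sum using (inj₁; inj₂)
  open import Relation.Binary.PropositionalEquality
  open ≤-Reasoning

  prod-≤ : ∀ {I : Set} (a : I → ℕ) S → (∀ i → a i ≤ S) → ∀ n w → prod a n w ≤ S ^ n
  prod-≤ a S h zero    _       = ≤-refl
  prod-≤ a S h (suc n) (i , w) = *-mono-≤ (h i) (prod-≤ a S h n w)

  prod-* : ∀ {I : Set} (a b : I → ℕ) n w → prod a n w * prod b n w ≡ prod (λ i → a i * b i) n w
  prod-* a b zero    _       = refl
  prod-* a b (suc n) (i , w) = trans (swap (a i) (prod a n w) (b i) (prod b n w)) (cong (a i * b i *_) (prod-* a b n w))
    where
    swap : ∀ x y z w → x * y * (z * w) ≡ x * z * (y * w)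
    swap = solve-∀

  prod-weight : ∀ {I : Set} (φ v : I → ℕ) y e f → (∀ i → φ i ^ e ≤ y ^ e * v i ^ f) →
                ∀ n w → prod φ n w ^ e ≤ (y ^ n) ^ e * prod v n w ^ f
  prod-weight φ v y e f h zero    _       = ≤-reflexive (trans (^-zeroˡ e) (sym (cong₂ _*_ (^-zeroˡ e) (^-zeroˡ f))))
  prod-weight φ v y e f h (suc n) (i , w) = begin
    (φ i * prod φ n w) ^ e ≡⟨ ^-distribʳ-* (φ i) (prod φ n w) e ⟩
    φ i ^ e * prod φ n w ^ e ≤⟨ *-mono-≤ (h i) (prod-weight φ v y e f h n w) ⟩
    y ^ e * v i ^ f * ((y ^ n) ^ e * prod v n w ^ f)   ≡⟨ swap (y ^ e) (v i ^ f) ((y ^ n) ^ e) (prod v n w ^ f) ⟩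
    y ^ e * (y ^ n) ^ e * (v i ^ f * prod v n w ^ f)   ≡⟨ cong₂ _*_ (^-distribʳ-* y (y ^ n) e) (^-distribʳ-* (v i) (prod v n w) f) ⟨
    (y * y ^ n) ^ e * (v i * prod v n w) ^ f ∎
    where
    swap : ∀ x y z w → x * y * (z * w) ≡ x * z * (y * w)
    swap = solve-∀

  module _ {ℓ m k : ℕ} {G : FinGroup} {a b c : Fin k → ℕ} (1≤m : 1 ≤ m) (m≤ℓ : m ≤ ℓ) (kills : Kills m G)
           (F : Family G (Fin k) a b c) where
    private
      S h g : ℕ
      S = FinGroup.size G
      h = saving ℓ
      g = 3 * h

    -- The three rotations of a family make its blocks cubes when a, b, c are constant on the chosen words.
    cubes : ∀ {n N A B C} (w : Fin N → Words (Fin k) n) → (∀ {i j} → w i ≡ w j → i ≡ j) →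
            (∀ i → prod a n (w i) ≡ A) → (∀ i → prod b n (w i) ≡ B) → (∀ i → prod c n (w i) ≡ C) →
            Family ((G ^ᴳ n) ⊗ ((G ^ᴳ n) ⊗ (G ^ᴳ n))) (Fin (N * (N * N)))
                   (λ _ → A * (B * C)) (λ _ → A * (B * C)) (λ _ → A * (B * C))
    cubes {n} {N} {A} {B} {C} w injective ea eb ec = reindex f f-injective
      (λ j → sym (cong₂ _*_ (ea _) (cong₂ _*_ (eb _) (ec _))))
      (λ j → trans (rotate₁ A B C) (sym (cong₂ _*_ (eb _) (cong₂ _*_ (ec _) (ea _)))))
      (λ j → trans (rotate₂ A B C) (sym (cong₂ _*_ (ec _) (cong₂ _*_ (ea _) (eb _)))))
      (Fⁿ ⊗ᶠ (rotate Fⁿ ⊗ᶠ rotate (rotate Fⁿ)))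
      where
      Fⁿ : Family (G ^ᴳ n) (Words (Fin k) n) (prod a n) (prod b n) (prod c n)
      Fⁿ = F ^ᶠ n
      rotate₁ : ∀ A B C → A * (B * C) ≡ B * (C * A)
      rotate₁ = solve-∀
      rotate₂ : ∀ A B C → A * (B * C) ≡ C * (A * B)
      rotate₂ = solve-∀
      first : Fin (N * (N * N)) → Fin N
      first j = proj₁ (remQuot {N} (N * N) j)
      rest : Fin (N * (N * N)) → Fin (N * N)
      rest j = proj₂ (remQuot {N} (N * N) j)
      f : Fin (N * (N * N)) → Words (Fin k) n × (Words (Fin k) n × Words (Fin k) n)
      f j = w (first j) , (w (proj₁ (remQuot {N} N (rest j))) , w (proj₂ (remQuot {N} N (rest j))))
      f-injective : ∀ {i j} → f i ≡ f j → i ≡ j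
      f-injective {i} {j} e = trans (sym (Finₚ.combine-remQuot {N} (N * N) i)) (trans (cong₂ combine
        (injective (cong proj₁ e))
        (trans (sym (Finₚ.combine-remQuot {N} N (rest i))) (trans (cong₂ combine
          (injective (cong (λ z → proj₁ (proj₂ z)) e)) (injective (cong (λ z → proj₂ (proj₂ z)) e)))
          (Finₚ.combine-remQuot {N} N (rest j)))))
        (Finₚ.combine-remQuot {N} (N * N) j))

    -- With `M = A B C`, there are `N³` cubes of side `M` in a group of order `T = S ^ (3 n)`, so
    -- `(N³ M²) ^ (3 h) * T ≤ (12 T) ^ (3 h)`. Replacing the saved factor `T` by the smaller `M`
    -- raises the exponent of `M` from `2 g` to `2 g + 1`: this is the gain over exponent `2`.
    class-bound : ∀ {n N A B C} (w : Fin N → Words (Fin k) n) → (∀ {i j} → w i ≡ w j → i ≡ j) →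
      (∀ i → prod a n (w i) ≡ A) → (∀ i → prod b n (w i) ≡ B) → (∀ i → prod c n (w i) ≡ C) →
      A ≤ S ^ n → B ≤ S ^ n → C ≤ S ^ n →
      N ^ (3 * g) * (A * (B * C)) ^ (2 * g + 1) ≤ (12 * S ^ n) ^ (3 * g)
    class-bound {n} {N} {A} {B} {C} w injective ea eb ec lA lB lC = begin
      N ^ (3 * g) * M ^ (2 * g + 1) ≡⟨ regroup ⟩
      cube (N * (N * N) * (M * M)) ^ h * M ≤⟨ *-monoʳ-≤ (cube (N * (N * N) * (M * M)) ^ h) (*-mono-≤ lA (*-mono-≤ lB lC)) ⟩
      cube (N * (N * N) * (M * M)) ^ h * T ≡⟨ cong (cube (N * (N * N) * (M * M)) ^ h *_) size≡ ⟨
      cube (N * (N * N) * (M * M)) ^ h * FinGroup.size G' ≤⟨ uniform-family-bound G' 1≤m m≤ℓ kills' (cubes w injective ea eb ec) ⟩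
      cube (12 * FinGroup.size G') ^ h ≡⟨ cong (λ z → cube (12 * z) ^ h) size≡ ⟩
      cube (12 * T) ^ h ≤⟨ ^-monoˡ-≤ h (cube-mono (≤-trans (m≤n*m (12 * T) 144) (≤-reflexive (enlarge (S ^ n))))) ⟩
      cube (cube (12 * S ^ n)) ^ h ≡⟨ ninth (12 * S ^ n) ⟩
      (12 * S ^ n) ^ (3 * g) ∎
      where
      M T : ℕ
      M = A * (B * C)
      T = S ^ n * (S ^ n * S ^ n)
      G' : FinGroup
      G' = (G ^ᴳ n) ⊗ ((G ^ᴳ n) ⊗ (G ^ᴳ n))
      size≡ : FinGroup.size G' ≡ T
      size≡ = cong₂ _*_ (size-^ᴳ G n) (cong₂ _*_ (size-^ᴳ G n) (size-^ᴳ G n))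
      kills' : Kills m G'
      kills' = kills-⊗ m (G ^ᴳ n) ((G ^ᴳ n) ⊗ (G ^ᴳ n)) (kills-^ᴳ m G n kills) (kills-⊗ m (G ^ᴳ n) (G ^ᴳ n) (kills-^ᴳ m G n kills) (kills-^ᴳ m G n kills))
      enlarge : ∀ s → 144 * (12 * (s * (s * s))) ≡ 12 * s * (12 * s) * (12 * s)
      enlarge = solve-∀
      ninth : ∀ x → cube (cube x) ^ h ≡ x ^ (3 * g)
      ninth x = trans (cong (_^ h) (lemma x)) (trans (^-*-assoc x 9 h) (cong (x ^_) (*-assoc 3 3 h)))
        where
        lemma : ∀ x → x * x * x * (x * x * x) * (x * x * x) ≡ x * (x * (x * (x * (x * (x * (x * (x * (x * 1))))))))
        lemma = solve-∀
      regroup : N ^ (3 * g) * M ^ (2 * g + 1) ≡ cube (N * (N * N) * (M * M)) ^ h * M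
      regroup = begin-equality
        N ^ (3 * g) * M ^ (2 * g + 1) ≡⟨ cong₂ _*_ (cong (N ^_) (sym (*-assoc 3 3 h))) (trans (^-distribˡ-+-* M (2 * g) 1) (cong₂ _*_ (cong (M ^_) (sym (*-assoc 2 3 h))) (*-identityʳ M))) ⟩
        N ^ (9 * h) * (M ^ (6 * h) * M) ≡⟨ *-assoc (N ^ (9 * h)) (M ^ (6 * h)) M ⟨
        N ^ (9 * h) * M ^ (6 * h) * M ≡⟨ cong (_* M) (cong₂ _*_ (^-*-assoc N 9 h) (^-*-assoc M 6 h)) ⟨
        (N ^ 9) ^ h * (M ^ 6) ^ h * M ≡⟨ cong (_* M) (^-distribʳ-* (N ^ 9) (M ^ 6) h) ⟨
        (N ^ 9 * M ^ 6) ^ h * M ≡⟨ cong (λ z → z ^ h * M) (lemma N M) ⟩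
        cube (N * (N * N) * (M * M)) ^ h * M  ∎
        where
        lemma : ∀ N M → N * (N * (N * (N * (N * (N * (N * (N * (N * 1)))))))) * (M * (M * (M * (M * (M * (M * 1)))))) ≡
                N * (N * N) * (M * M) * (N * (N * N) * (M * M)) * (N * (N * N) * (M * M))
        lemma = solve-∀

    -- The fractions `φ i / y` are rational lower bounds for the `(2g + 1)/(3g)`-th powers of the
    -- volumes. The heaviest class for `φ` obeys `class-bound`, with a loss of `12 (n + 1) ^ k`,
    -- which `beats-polynomial` removes.
    weighted-bound : (∀ i → a i ≤ S) → (∀ i → b i ≤ S) → (∀ i → c i ≤ S) → .{{_ : NonZero (3 * g)}} →
      ∀ y (φ : Fin k → ℕ) → (∀ i → φ i ^ (3 * g) ≤ y ^ (3 * g) * (a i * (b i * c i)) ^ (2 * g + 1)) →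
      total (allFin k) φ ≤ y * S
    weighted-bound la lb lc y φ hφ = beats-polynomial 12 k λ n → step n (type-class k n φ)
      where
      X : ℕ
      X = total (allFin k) φ
      step : ∀ n → _ → X ^ n ≤ 12 * suc n ^ k * (y * S) ^ n
      step n (inj₁ X^n≡0) = ≤-trans (≤-reflexive X^n≡0) z≤n
      step n (inj₂ cl) = ^-cancelʳ-≤ (3 * g) (begin
        (X ^ n) ^ (3 * g) ≤⟨ ^-monoˡ-≤ (3 * g) large ⟩
        (L * (N * Φ)) ^ (3 * g) ≡⟨ trans (^-distribʳ-* L (N * Φ) (3 * g)) (cong (L ^ (3 * g) *_) (^-distribʳ-* N Φ (3 * g))) ⟩
        L ^ (3 * g) * (N ^ (3 * g) * Φ ^ (3 * g)) ≤⟨ *-monoʳ-≤ (L ^ (3 * g)) (*-monoʳ-≤ (N ^ (3 * g)) Φ≤) ⟩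
        L ^ (3 * g) * (N ^ (3 * g) * ((y ^ n) ^ (3 * g) * M ^ (2 * g + 1)))
          ≡⟨ cong (L ^ (3 * g) *_) (swap (N ^ (3 * g)) ((y ^ n) ^ (3 * g)) (M ^ (2 * g + 1))) ⟩
        L ^ (3 * g) * ((y ^ n) ^ (3 * g) * (N ^ (3 * g) * M ^ (2 * g + 1)))
          ≤⟨ *-monoʳ-≤ (L ^ (3 * g)) (*-monoʳ-≤ ((y ^ n) ^ (3 * g)) (class-bound word injective (same a) (same b) (same c)
               (prod-≤ a S la n w₀) (prod-≤ b S lb n w₀) (prod-≤ c S lc n w₀))) ⟩
        L ^ (3 * g) * ((y ^ n) ^ (3 * g) * (12 * S ^ n) ^ (3 * g))
          ≡⟨ trans (^-distribʳ-* L (y ^ n * (12 * S ^ n)) (3 * g)) (cong (L ^ (3 * g) *_) (^-distribʳ-* (y ^ n) (12 * S ^ n) (3 * g))) ⟨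
        (L * (y ^ n * (12 * S ^ n))) ^ (3 * g) ≡⟨ cong (_^ (3 * g)) (trans (collect L (y ^ n) (S ^ n)) (cong (12 * L *_) (sym (^-distribʳ-* y S n)))) ⟩
        (12 * L * (y * S) ^ n) ^ (3 * g) ∎)
        where
        open TypeClass cl
        L Φ M : ℕ
        L = suc n ^ k
        Φ = prod φ n w₀
        M = prod a n w₀ * (prod b n w₀ * prod c n w₀)
        swap : ∀ x y z → x * (y * z) ≡ y * (x * z)
        swap = solve-∀
        collect : ∀ L y s → L * (y * (12 * s)) ≡ 12 * L * (y * s)
        collect = solve-∀
        Φ≤ : Φ ^ (3 * g) ≤ (y ^ n) ^ (3 * g) * M ^ (2 * g + 1)
        Φ≤ = ≤-trans (prod-weight φ (λ i → a i * (b i * c i)) y (3 * g) (2 * g + 1) hφ n w₀)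
          (≤-reflexive (cong (λ z → (y ^ n) ^ (3 * g) * z ^ (2 * g + 1)) (sym
            (trans (cong (prod a n w₀ *_) (prod-* b c n w₀)) (prod-* a (λ i → b i * c i) n w₀)))))

-- The family of an STPP construction.

open import Defs

module Constructions (H : FiniteAbelianGroup) where

  import Algebra.Properties.AbelianGroup as AbelianGroupProperties
  import Algebra.Solver.CommutativeMonoid as CommutativeMonoidSolver
  open Families
  open FamilyOperations using (Kills)
  open Groups
  open TypeClasses using (lookup-injective)
  open import Data.Fin as Fin using (Fin; zero; suc)
  import Data.Fin.Properties as Finₚ
  open import Data.List using (lookup)
  open import Data.List.Relation.Unary.Any as Any using (Any)
  open import Data.List.Relation.Unary.Any.Properties using (lookup-index)
  import Data.List.Membership.Setoid.Properties as Membershipₚ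
  open import Data.Nat using (ℕ; zero; suc; _≤_)
  open import Data.Product using (Σ; _×_; _,_; proj₁)
  open import Relation.Binary.PropositionalEquality as ≡ using (_≡_; refl; cong; cong₂)
  open FiniteAbelianGroup H renaming (refl to ≈-refl)
  open AbelianGroupProperties grp using (x∙y⁻¹≈ε⇒x≈y)

  idx : Carrier → Fin order
  idx x = Any.index (complete x)

  el : Fin order → Carrier
  el = lookup elems

  el-idx : ∀ x → el (idx x) ≈ x
  el-idx x = sym (lookup-index (complete x))

  el-injective : ∀ {i j} → el i ≈ el j → i ≡ j
  el-injective = lookup-injective {R = _≈_} sym distinct

  idx-cong : ∀ {x y} → x ≈ y → idx x ≡ idx y
  idx-cong {x} {y} e = el-injective (trans (el-idx x) (trans e (sym (el-idx y))))

  idx-injective : ∀ {x y} → idx x ≡ idx y → x ≈ y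
  idx-injective {x} {y} e = trans (sym (el-idx x)) (trans (reflexive (cong el e)) (el-idx y))

  infixl 6 _⊞_

  _⊞_ : Fin order → Fin order → Fin order
  i ⊞ j = idx (el i +ᴴ el j)

  idx-+ : ∀ x y → idx x ⊞ idx y ≡ idx (x +ᴴ y)
  idx-+ x y = idx-cong (∙-cong (el-idx x) (el-idx y))

  idx-el : ∀ i → idx (el i) ≡ i
  idx-el i = el-injective (el-idx (el i))

  G : FinGroup
  G = record
    { C = Fin order
    ; _⊕_ = _⊞_
    ; 𝟘 = idx 0ᴴ
    ; ⊖_ = λ i → idx (-ᴴ el i)
    ; isAbelianGroup = record
      { isGroup = record
        { isMonoid = record
          { isSemigroup = record
            { isMagma = record { isEquivalence = ≡.isEquivalence ; ∙-cong = cong₂ _⊞_ }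
            ; assoc = λ i j k → idx-cong (trans (∙-cong (el-idx _) ≈-refl) (trans (assoc _ _ _) (∙-cong ≈-refl (sym (el-idx _))))) }
          ; identity = (λ i → ≡.trans (idx-cong (trans (∙-cong (el-idx 0ᴴ) ≈-refl) (identityˡ _))) (idx-el i))
                     , (λ i → ≡.trans (idx-cong (trans (∙-cong ≈-refl (el-idx 0ᴴ)) (identityʳ _))) (idx-el i)) }
        ; inverse = (λ i → idx-cong (trans (∙-cong (el-idx _) ≈-refl) (inverseˡ _)))
                  , (λ i → idx-cong (trans (∙-cong ≈-refl (el-idx _)) (inverseʳ _)))
        ; ⁻¹-cong = cong (λ i → idx (-ᴴ el i)) }
      ; comm = λ i j → idx-cong (comm _ _) }
    ; size = order
    ; enc = λ i → i
    ; dec = λ i → i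
    ; dec-enc = λ _ → refl
    ; enc-dec = λ _ → refl
    }

  kills : ∀ {m} → (∀ x → m ·ᴴ x ≈ 0ᴴ) → Kills m G
  kills {m} h i = ≡.trans (multiple m) (idx-cong (h (el i)))
    where
    open FinGroup G using (_·_)
    multiple : ∀ m → m · i ≡ idx (m ·ᴴ el i)
    multiple zero    = refl
    multiple (suc m) = ≡.trans (cong₂ _⊞_ (≡.sym (idx-el i)) (multiple m)) (idx-+ (el i) (m ·ᴴ el i))

  nth : (X : Subset) → Fin (size X) → Carrier
  nth X = lookup (members X)

  nth-injective : ∀ X {i j} → nth X i ≈ nth X j → i ≡ j
  nth-injective X = lookup-injective {R = _≈_} sym (nodup X)

  nth-∈ : ∀ X i → _∈S X (nth X i)
  nth-∈ X i = Membershipₚ.∈-lookup setoid (members X) i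

  size≤order : ∀ X → size X ≤ order
  size≤order X = Finₚ.injective⇒≤ {f = λ i → idx (nth X i)} λ e → nth-injective X (idx-injective e)

  module _ {k : ℕ} (S : STPP k) where
    open STPP S

    difference : ∀ X Y (i : Fin (size X)) (j : Fin (size Y)) → (nth X i -ᴴ nth Y j) ∈ X - Y
    difference X Y i j = nth X i , nth Y j , nth-∈ X i , nth-∈ Y j , ≈-refl

    -- The left side is the sum in `separate`, the right side the one in `tpp`. Negatives are
    -- independent variables here, so associativity and commutativity suffice.
    telescope : ∀ a b c b' c' a' → ((a -ᴴ b) +ᴴ (b' -ᴴ c)) +ᴴ (c' -ᴴ a') ≈ ((a -ᴴ a') +ᴴ (b' -ᴴ b)) +ᴴ (c' -ᴴ c)
    telescope a b c b' c' a' = solve 6 (λ a b̄ b' c̄ c' ā' →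
        ((a ⊕ b̄) ⊕ (b' ⊕ c̄)) ⊕ (c' ⊕ ā') ⊜ ((a ⊕ ā') ⊕ (b' ⊕ b̄)) ⊕ (c' ⊕ c̄)) ≈-refl a (-ᴴ b) b' (-ᴴ c) c' (-ᴴ a')
      where open CommutativeMonoidSolver commutativeMonoid

    -- `separate` makes the three blocks equal; inside one block `telescope` and the triple product
    -- property make the entries equal.
    family : Family G (Fin k) (λ i → size (A i)) (λ i → size (B i)) (λ i → size (C i))
    family = record
      { x = λ i α β → idx (nth (A i) α -ᴴ nth (B i) β)
      ; y = λ i β γ → idx (nth (B i) β -ᴴ nth (C i) γ)
      ; z = λ i γ α → idx (nth (C i) γ -ᴴ nth (A i) α)
      ; triangle = λ i α β γ → ≡.trans (sum₃ _ _ _) (idx-cong (trans (telescope _ _ _ _ _ _)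
          (trans (∙-cong (∙-cong (inverseʳ _) (inverseʳ _)) (inverseʳ _)) (trans (identityʳ _) (identityˡ _)))))
      ; matches = matches
      }
      where
      sum₃ : ∀ u v w → (idx u ⊞ idx v) ⊞ idx w ≡ idx ((u +ᴴ v) +ᴴ w)
      sum₃ u v w = ≡.trans (cong (_⊞ idx w) (idx-+ u v)) (idx-+ (u +ᴴ v) w)
      matches : ∀ {i j l} α β β' γ γ' α' →
        (idx (nth (A i) α -ᴴ nth (B i) β) ⊞ idx (nth (B j) β' -ᴴ nth (C j) γ)) ⊞ idx (nth (C l) γ' -ᴴ nth (A l) α') ≡ idx 0ᴴ →
        _≡_ {A = Σ (Fin k) (λ i → Fin (size (A i)))} (i , α) (l , α') ×
        _≡_ {A = Σ (Fin k) (λ i → Fin (size (B i)))} (i , β) (j , β') ×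
        _≡_ {A = Σ (Fin k) (λ i → Fin (size (C i)))} (j , γ) (l , γ')
      matches {i} {j} {l} α β β' γ γ' α' e with idx-injective (≡.trans (≡.sym (sum₃ _ _ _)) e)
      ... | zero-sum with separate i j l _ _ _ (difference (A i) (B i) α β) (difference (B j) (C j) β' γ) (difference (C l) (A l) γ' α') zero-sum
      ... | refl , refl with proj₁ (tpp i _ _ _ (difference (A i) (A i) α α') (difference (B i) (B i) β' β) (difference (C i) (C i) γ' γ))
                                  (trans (sym (telescope _ _ _ _ _ _)) zero-sum)
      ... | a≈0 , b≈0 , c≈0 =
        cong (i ,_) (nth-injective (A i) (x∙y⁻¹≈ε⇒x≈y _ _ a≈0)) ,
        cong (i ,_) (≡.sym (nth-injective (B i) (x∙y⁻¹≈ε⇒x≈y _ _ b≈0))) ,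
        cong (i ,_) (≡.sym (nth-injective (C i) (x∙y⁻¹≈ε⇒x≈y _ _ c≈0)))

-- From rational lower cuts to inequalities of naturals.

module Rationals where

  import Algebra.Properties.CommutativeSemigroup as CommutativeSemigroupProperties
  open import Algebra.Bundles using (CommutativeMonoid)
  open import Defs using (powℚ; ℕtoℚ; sumℚ; BelowPow)
  open Powers
  open TypeClasses using (total)
  open import Data.Fin using (Fin; zero; suc)
  open import Data.Integer as ℤ using (ℤ; +_; -[1+_])
  import Data.Integer.Properties as ℤₚ
  open import Data.List using (allFin)
  open import Data.List.Properties using (map-tabulate)
  open import Data.Nat as ℕ using (ℕ; zero; suc; NonZero)
  open import Data.Nat.Coprimality using (Coprime)
  open import Data.Nat.ListAction using (sum)
  import Data.Nat.Properties as ℕₚ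
  open import Data.Nat.Tactic.RingSolver using (solve-∀)
  open import Data.Product using (Σ; _×_; _,_; proj₁; proj₂; ∃-syntax)
  open import Data.Rational as ℚ using (ℚ; mkℚ; toℚᵘ; _*_; _+_; _≤_)
  open import Data.Rational.Properties
  import Data.Rational.Unnormalised as ℚᵘ
  import Data.Rational.Unnormalised.Properties as ℚᵘₚ
  open import Data.Sum using (inj₁; inj₂)
  open import Function using (_∘_; id)
  open import Relation.Binary.PropositionalEquality

  toℚᵘ-ℕtoℚ : ∀ n → toℚᵘ (ℕtoℚ n) ℚᵘ.≃ ℚᵘ.mkℚᵘ (+ n) 0
  toℚᵘ-ℕtoℚ n = toℚᵘ-fromℚᵘ (ℚᵘ.mkℚᵘ (+ n) 0)

  ℕtoℚ-* : ∀ a b → ℕtoℚ (a ℕ.* b) ≡ ℕtoℚ a * ℕtoℚ b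
  ℕtoℚ-* a b = toℚᵘ-injective (begin
    toℚᵘ (ℕtoℚ (a ℕ.* b)) ≈⟨ toℚᵘ-ℕtoℚ (a ℕ.* b) ⟩
    ℚᵘ.mkℚᵘ (+ (a ℕ.* b)) 0 ≡⟨ cong (λ z → ℚᵘ.mkℚᵘ z 0) (ℤₚ.pos-* a b) ⟩
    ℚᵘ.mkℚᵘ (+ a) 0 ℚᵘ.* ℚᵘ.mkℚᵘ (+ b) 0   ≈⟨ ℚᵘₚ.*-cong (toℚᵘ-ℕtoℚ a) (toℚᵘ-ℕtoℚ b) ⟨
    toℚᵘ (ℕtoℚ a) ℚᵘ.* toℚᵘ (ℕtoℚ b) ≈⟨ toℚᵘ-homo-* (ℕtoℚ a) (ℕtoℚ b) ⟨
    toℚᵘ (ℕtoℚ a * ℕtoℚ b) ∎)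
    where open ℚᵘₚ.≃-Reasoning

  ℕtoℚ-+ : ∀ a b → ℕtoℚ (a ℕ.+ b) ≡ ℕtoℚ a + ℕtoℚ b
  ℕtoℚ-+ a b = toℚᵘ-injective (begin
    toℚᵘ (ℕtoℚ (a ℕ.+ b)) ≈⟨ toℚᵘ-ℕtoℚ (a ℕ.+ b) ⟩
    ℚᵘ.mkℚᵘ (+ (a ℕ.+ b)) 0 ≡⟨ cong (λ z → ℚᵘ.mkℚᵘ z 0) (cong₂ ℤ._+_ (ℤₚ.*-identityʳ (+ a)) (ℤₚ.*-identityʳ (+ b))) ⟨
    ℚᵘ.mkℚᵘ (+ a) 0 ℚᵘ.+ ℚᵘ.mkℚᵘ (+ b) 0   ≈⟨ ℚᵘₚ.+-cong (toℚᵘ-ℕtoℚ a) (toℚᵘ-ℕtoℚ b) ⟨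
    toℚᵘ (ℕtoℚ a) ℚᵘ.+ toℚᵘ (ℕtoℚ b) ≈⟨ toℚᵘ-homo-+ (ℕtoℚ a) (ℕtoℚ b) ⟨
    toℚᵘ (ℕtoℚ a + ℕtoℚ b) ∎)
    where open ℚᵘₚ.≃-Reasoning

  ℕtoℚ-mono : ∀ {a b} → a ℕ.≤ b → ℕtoℚ a ≤ ℕtoℚ b
  ℕtoℚ-mono {a} {b} a≤b = toℚᵘ-cancel-≤ (ℚᵘₚ.≤-respˡ-≃ (ℚᵘₚ.≃-sym (toℚᵘ-ℕtoℚ a)) (ℚᵘₚ.≤-respʳ-≃ (ℚᵘₚ.≃-sym (toℚᵘ-ℕtoℚ b))
    (ℚᵘ.*≤* (subst₂ ℤ._≤_ (sym (ℤₚ.*-identityʳ (+ a))) (sym (ℤₚ.*-identityʳ (+ b))) (ℤ.+≤+ a≤b)))))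

  ℕtoℚ-reflect : ∀ {a b} → ℕtoℚ a ≤ ℕtoℚ b → a ℕ.≤ b
  ℕtoℚ-reflect {a} {b} h with ℚᵘₚ.≤-respˡ-≃ (toℚᵘ-ℕtoℚ a) (ℚᵘₚ.≤-respʳ-≃ (toℚᵘ-ℕtoℚ b) (toℚᵘ-mono-≤ h))
  ... | ℚᵘ.*≤* l = ℤₚ.drop‿+≤+ (subst₂ ℤ._≤_ (ℤₚ.*-identityʳ (+ a)) (ℤₚ.*-identityʳ (+ b)) l)

  ℕtoℚ-nonNegative : ∀ n → ℚ.NonNegative (ℕtoℚ n)
  ℕtoℚ-nonNegative n = ℚ.nonNegative (ℕtoℚ-mono {0} {n} ℕ.z≤n)

  *-monoʳ-ℕtoℚ : ∀ n {p q} → p ≤ q → p * ℕtoℚ n ≤ q * ℕtoℚ n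
  *-monoʳ-ℕtoℚ n = *-monoʳ-≤-nonNeg (ℕtoℚ n) {{ℕtoℚ-nonNegative n}}

  clear : ∀ p d .(c : Coprime p (suc d)) → mkℚ (+ p) d c * ℕtoℚ (suc d) ≡ ℕtoℚ p
  clear p d c = toℚᵘ-injective (begin
    toℚᵘ (mkℚ (+ p) d _ * ℕtoℚ (suc d)) ≈⟨ toℚᵘ-homo-* (mkℚ (+ p) d _) (ℕtoℚ (suc d)) ⟩
    ℚᵘ.mkℚᵘ (+ p) d ℚᵘ.* toℚᵘ (ℕtoℚ (suc d)) ≈⟨ ℚᵘₚ.*-cong (ℚᵘₚ.≃-refl {ℚᵘ.mkℚᵘ (+ p) d}) (toℚᵘ-ℕtoℚ (suc d)) ⟩
    ℚᵘ.mkℚᵘ (+ p) d ℚᵘ.* ℚᵘ.mkℚᵘ (+ suc d) 0 ≈⟨ ℚᵘ.*≡* (trans (ℤₚ.*-identityʳ (+ p ℤ.* + suc d)) (cong (λ z → + p ℤ.* + z) (sym (ℕₚ.*-identityʳ (suc d))))) ⟩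
    ℚᵘ.mkℚᵘ (+ p) 0 ≈⟨ toℚᵘ-ℕtoℚ p ⟨
    toℚᵘ (ℕtoℚ p) ∎)
    where open ℚᵘₚ.≃-Reasoning

  powℚ-clear : ∀ q p y → q * ℕtoℚ y ≡ ℕtoℚ p → ∀ n → powℚ q n * ℕtoℚ (y ℕ.^ n) ≡ ℕtoℚ (p ℕ.^ n)
  powℚ-clear q p y e zero    = *-identityˡ (ℕtoℚ 1)
  powℚ-clear q p y e (suc n) = begin
    q * powℚ q n * ℕtoℚ (y ℕ.* y ℕ.^ n) ≡⟨ cong (q * powℚ q n *_) (ℕtoℚ-* y (y ℕ.^ n)) ⟩
    q * powℚ q n * (ℕtoℚ y * ℕtoℚ (y ℕ.^ n)) ≡⟨ interchange q (powℚ q n) (ℕtoℚ y) (ℕtoℚ (y ℕ.^ n)) ⟩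
    q * ℕtoℚ y * (powℚ q n * ℕtoℚ (y ℕ.^ n)) ≡⟨ cong₂ _*_ e (powℚ-clear q p y e n) ⟩
    ℕtoℚ p * ℕtoℚ (p ℕ.^ n) ≡⟨ ℕtoℚ-* p (p ℕ.^ n) ⟨
    ℕtoℚ (p ℕ.* p ℕ.^ n) ∎
    where
    open ≡-Reasoning
    open CommutativeSemigroupProperties (CommutativeMonoid.commutativeSemigroup *-1-commutativeMonoid) using (interchange)

  -- A fraction with `q ≤ p / y ≤ x ^ (f / e)`, denominators cleared.
  record Approximation (q : ℚ) (x e f : ℕ) : Set where
    field
      p y       : ℕ
      y>0       : NonZero y
      above     : q * ℕtoℚ y ≤ ℕtoℚ p
      power     : p ℕ.^ e ℕ.≤ y ℕ.^ e ℕ.* x ℕ.^ f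

  -- The exponent arrives in lowest terms as `n / d` and is wanted as `f / e`: raising to the power
  -- `e` and extracting `d`-th roots passes from one to the other.
  approximate : ∀ {q x n d e f} .{{_ : NonZero d}} .{{_ : NonZero e}} → n ℕ.* e ≡ f ℕ.* d →
                BelowPow q x n d → Approximation q x e f
  -- A nonpositive `q` is replaced by `0`; `e` must be positive because `0 ^ 0 = 1`.
  approximate {q} {x} {e = suc e} ne≡fd (inj₁ q≤0) = record
    { p = 0 ; y = 1 ; y>0 = _ ; above = ≤-trans (≤-reflexive (*-identityʳ q)) q≤0 ; power = ℕ.z≤n }
  approximate {mkℚ -[1+ _ ] _ _} ne≡fd (inj₂ (ℚ.*≤* () , _))
  approximate {q@(mkℚ (+ p) y-1 c)} {x} {n} {d} {e} {f} ne≡fd (inj₂ (_ , h)) = record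
    { p = p ; y = y ; y>0 = _ ; above = ≤-reflexive (clear p y-1 c) ; power = ^-cancelʳ-≤ d (begin
        (p ℕ.^ e) ℕ.^ d ≡⟨ exchange p e d ⟩
        (p ℕ.^ d) ℕ.^ e ≤⟨ ℕₚ.^-monoˡ-≤ e cleared ⟩
        (x ℕ.^ n ℕ.* y ℕ.^ d) ℕ.^ e ≡⟨ ^-distribʳ-* (x ℕ.^ n) (y ℕ.^ d) e ⟩
        (x ℕ.^ n) ℕ.^ e ℕ.* (y ℕ.^ d) ℕ.^ e  ≡⟨ cong₂ ℕ._*_ (trans (ℕₚ.^-*-assoc x n e) (trans (cong (x ℕ.^_) ne≡fd) (sym (ℕₚ.^-*-assoc x f d)))) (exchange y d e) ⟩
        (x ℕ.^ f) ℕ.^ d ℕ.* (y ℕ.^ e) ℕ.^ d  ≡⟨ ℕₚ.*-comm ((x ℕ.^ f) ℕ.^ d) _ ⟩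
        (y ℕ.^ e) ℕ.^ d ℕ.* (x ℕ.^ f) ℕ.^ d  ≡⟨ ^-distribʳ-* (y ℕ.^ e) (x ℕ.^ f) d ⟨
        (y ℕ.^ e ℕ.* x ℕ.^ f) ℕ.^ d ∎) }
    where
    open ℕₚ.≤-Reasoning
    y : ℕ
    y = suc y-1
    exchange : ∀ x a b → (x ℕ.^ a) ℕ.^ b ≡ (x ℕ.^ b) ℕ.^ a
    exchange x a b = trans (ℕₚ.^-*-assoc x a b) (trans (cong (x ℕ.^_) (ℕₚ.*-comm a b)) (sym (ℕₚ.^-*-assoc x b a)))
    cleared : p ℕ.^ d ℕ.≤ x ℕ.^ n ℕ.* y ℕ.^ d
    cleared = ℕtoℚ-reflect (≤-trans (≤-reflexive (sym (powℚ-clear q p y (clear p y-1 c) d)))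
      (≤-trans (*-monoʳ-ℕtoℚ (y ℕ.^ d) h) (≤-reflexive (sym (ℕtoℚ-* (x ℕ.^ n) (y ℕ.^ d))))))

  scale : ∀ {q x e f} c → .{{NonZero c}} → Approximation q x e f → Approximation q x e f
  scale {q} {x} {e} {f} c app = record
    { p = p ℕ.* c ; y = y ℕ.* c ; y>0 = ℕₚ.m*n≢0 y c {{y>0}}
    ; above = ≤-trans (≤-reflexive (trans (cong (q *_) (ℕtoℚ-* y c)) (sym (*-assoc q (ℕtoℚ y) (ℕtoℚ c)))))
                (≤-trans (*-monoʳ-ℕtoℚ c above) (≤-reflexive (sym (ℕtoℚ-* p c))))
    ; power = begin
        (p ℕ.* c) ℕ.^ e ≡⟨ ^-distribʳ-* p c e ⟩
        p ℕ.^ e ℕ.* c ℕ.^ e ≤⟨ ℕₚ.*-monoˡ-≤ (c ℕ.^ e) power ⟩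
        y ℕ.^ e ℕ.* x ℕ.^ f ℕ.* c ℕ.^ e ≡⟨ swap (y ℕ.^ e) (x ℕ.^ f) (c ℕ.^ e) ⟩
        y ℕ.^ e ℕ.* c ℕ.^ e ℕ.* x ℕ.^ f ≡⟨ cong (ℕ._* x ℕ.^ f) (^-distribʳ-* y c e) ⟨
        (y ℕ.* c) ℕ.^ e ℕ.* x ℕ.^ f ∎ }
    where
    open Approximation app
    open ℕₚ.≤-Reasoning
    swap : ∀ a b c → a ℕ.* b ℕ.* c ≡ a ℕ.* c ℕ.* b
    swap = solve-∀

  Common : ∀ k → (Fin k → ℚ) → (Fin k → ℕ) → ℕ → ℕ → ℕ → Set
  Common k q x e f Y = ∀ i → Σ (Approximation (q i) (x i) e f) λ app → Approximation.y app ≡ Y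

  common-denominator : ∀ k q x e f → (∀ i → Approximation (q i) (x i) e f) → ∃[ Y ] NonZero Y × Common k q x e f Y
  common-denominator zero    q x e f h = 1 , _ , λ ()
  common-denominator (suc k) q x e f h with common-denominator k (q ∘ suc) (x ∘ suc) e f (h ∘ suc)
  ... | Y , Y>0 , common = y ℕ.* Y , ℕₚ.m*n≢0 y Y {{y>0}} {{Y>0}} ,
    λ { zero    → scale Y {{Y>0}} (h zero) , refl
      ; (suc i) → scale y {{y>0}} (proj₁ (common i)) , trans (cong (ℕ._* y) (proj₂ (common i))) (ℕₚ.*-comm Y y) }
    where open Approximation (h zero)

  total-suc : ∀ k (φ : Fin (suc k) → ℕ) → total (allFin (suc k)) φ ≡ φ zero ℕ.+ total (allFin k) (φ ∘ suc)
  total-suc k φ = cong (φ zero ℕ.+_) (cong sum (trans (map-tabulate suc φ) (sym (map-tabulate id (φ ∘ suc)))))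

  sum-above : ∀ k q (φ : Fin k → ℕ) Y → (∀ i → q i * ℕtoℚ Y ≤ ℕtoℚ (φ i)) → sumℚ k q * ℕtoℚ Y ≤ ℕtoℚ (total (allFin k) φ)
  sum-above zero    q φ Y h = ≤-reflexive (*-zeroˡ (ℕtoℚ Y))
  sum-above (suc k) q φ Y h = ≤-trans (≤-reflexive (*-distribʳ-+ (ℕtoℚ Y) (q zero) _))
    (≤-trans (+-mono-≤ (h zero) (sum-above k (q ∘ suc) (φ ∘ suc) Y (h ∘ suc)))
      (≤-reflexive (trans (sym (ℕtoℚ-+ (φ zero) _)) (cong ℕtoℚ (sym (total-suc k φ))))))

  sum-bound : ∀ k (x : Fin k → ℕ) e f B →
    (∀ Y (φ : Fin k → ℕ) → (∀ i → φ i ℕ.^ e ℕ.≤ Y ℕ.^ e ℕ.* x i ℕ.^ f) → total (allFin k) φ ℕ.≤ Y ℕ.* B) →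
    ∀ q → (∀ i → Approximation (q i) (x i) e f) → sumℚ k q ≤ ℕtoℚ B
  sum-bound k x e f B bound q h with common-denominator k q x e f h
  ... | Y , Y>0 , common = *-cancelʳ-≤-pos (ℕtoℚ Y) {{positiveY}} (≤-trans
      (sum-above k q φ Y (λ i → subst (λ y → q i * ℕtoℚ y ≤ ℕtoℚ (φ i)) (proj₂ (common i)) (above (proj₁ (common i)))))
      (≤-trans (ℕtoℚ-mono (bound Y φ λ i → subst (λ y → φ i ℕ.^ e ℕ.≤ y ℕ.^ e ℕ.* x i ℕ.^ f) (proj₂ (common i)) (power (proj₁ (common i)))))
        (≤-reflexive (trans (cong ℕtoℚ (ℕₚ.*-comm Y B)) (ℕtoℚ-* B Y)))))
    where
    open Approximation using (above; power)
    φ : Fin k → ℕ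
    φ i = Approximation.p (proj₁ (common i))
    positiveY : ℚ.Positive (ℕtoℚ Y)
    positiveY = normalize-pos Y 1 {{_}} {{Y>0}}

-- The exponent `2 + 1/g` and its admissibility.

module ThirdExponent where

  open import Defs
  open Rationals using (approximate; sum-bound)
  open Saving using (saving; accumulate)
  open Weighted using (weighted-bound)
  open import Data.Integer as ℤ using (+_)
  import Data.Integer.Properties as ℤₚ
  open import Data.Nat as ℕ using (ℕ; zero; suc; NonZero)
  import Data.Nat.Properties as ℕₚ
  open import Data.Nat.Tactic.RingSolver using (solve-∀)
  open import Data.Product using (_,_)
  open import Data.Rational as ℚ using (ℚ; 0ℚ; toℚᵘ)
  import Data.Rational.Properties as ℚₚ
  import Data.Rational.Unnormalised as ℚᵘ
  import Data.Rational.Unnormalised.Properties as ℚᵘₚ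
  open import Relation.Binary.PropositionalEquality

  saving>0 : ∀ ℓ → NonZero (saving ℓ)
  saving>0 ℓ = ℕ.>-nonZero (positive ℓ)
    where
    positive : ∀ L → 0 ℕ.< accumulate (suc ℓ ℕ.^ ℓ) L
    positive zero    = ℕₚ.≤-refl
    positive (suc L) = ℕₚ.≤-trans (positive L) (ℕₚ.m≤n+m _ _)

  3saving≢0 : ∀ ℓ → NonZero (3 ℕ.* saving ℓ)
  3saving≢0 ℓ = ℕₚ.m*n≢0 3 (saving ℓ) {{_}} {{saving>0 ℓ}}

  module Exponent (g : ℕ) {{_ : NonZero g}} where
    ε c : ℚ
    ε = + 1 ℚ./ g
    c = (+ 2 ℚ./ 1) ℚ.+ ε

    ε>0 : 0ℚ ℚ.< ε
    ε>0 = ℚₚ.positive⁻¹ ε {{ℚₚ.normalize-pos 1 g}}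

    c≥0 : 0ℚ ℚ.≤ c
    c≥0 = ℚₚ.≤-trans (ℚₚ.<⇒≤ ε>0) (ℚₚ.≤-trans (ℚₚ.≤-reflexive (sym (ℚₚ.+-identityˡ ε))) (ℚₚ.+-monoˡ-≤ ε {0ℚ} {+ 2 ℚ./ 1} (ℚₚ.nonNegative⁻¹ (+ 2 ℚ./ 1))))

  open Exponent

  -- The exponent c / 3 is (2g + 1) / (3g), possibly before reduction to lowest terms.
  third-fraction : ∀ g {{_ : NonZero g}} →
    ℤ.∣ ℚ.numerator (third (c g)) ∣ ℕ.* (3 ℕ.* g) ≡ (2 ℕ.* g ℕ.+ 1) ℕ.* ℚ.denominatorℕ (third (c g))
  third-fraction g@(suc k) with third (c g) in eq
  ... | r@(ℚ.mkℚ n d-1 _) = begin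
    ℤ.∣ n ∣ ℕ.* (3 ℕ.* g) ≡⟨ cong (ℤ.∣ n ∣ ℕ.*_) (lemma₁ g) ⟩
    ℤ.∣ n ∣ ℕ.* (1 ℕ.* g ℕ.* 3) ≡⟨ ℤₚ.abs-* n (+ (1 ℕ.* g ℕ.* 3)) ⟨
    ℤ.∣ n ℤ.* + (1 ℕ.* g ℕ.* 3) ∣ ≡⟨ cong ℤ.∣_∣ equation ⟩
    ℤ.∣ (+ 2 ℤ.* + g ℤ.+ + 1 ℤ.* + 1) ℤ.* + 1 ℤ.* + suc d-1 ∣ ≡⟨ cong (λ z → ℤ.∣ z ℤ.* + suc d-1 ∣) (trans (ℤₚ.*-identityʳ _) (cong (ℤ._+ + 1) (sym (ℤₚ.pos-* 2 g)))) ⟩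
    ℤ.∣ + (2 ℕ.* g ℕ.+ 1) ℤ.* + suc d-1 ∣ ≡⟨ ℤₚ.abs-* (+ (2 ℕ.* g ℕ.+ 1)) (+ suc d-1) ⟩
    (2 ℕ.* g ℕ.+ 1) ℕ.* suc d-1 ∎
    where
    open ≡-Reasoning
    lemma₁ : ∀ g → 3 ℕ.* g ≡ 1 ℕ.* g ℕ.* 3
    lemma₁ = solve-∀
    unreduced : ℚᵘ.ℚᵘ
    unreduced = (ℚᵘ.mkℚᵘ (+ 2) 0 ℚᵘ.+ ℚᵘ.mkℚᵘ (+ 1) k) ℚᵘ.* ℚᵘ.mkℚᵘ (+ 1) 2
    fraction : toℚᵘ (third (c g)) ℚᵘ.≃ unreduced
    fraction = ℚᵘₚ.≃-trans (ℚₚ.toℚᵘ-homo-* (c g) (+ 1 ℚ./ 3)) (ℚᵘₚ.*-cong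
      (ℚᵘₚ.≃-trans (ℚₚ.toℚᵘ-homo-+ (+ 2 ℚ./ 1) (ε g)) (ℚᵘₚ.+-cong (ℚₚ.toℚᵘ-fromℚᵘ (ℚᵘ.mkℚᵘ (+ 2) 0)) (ℚₚ.toℚᵘ-fromℚᵘ (ℚᵘ.mkℚᵘ (+ 1) k))))
      (ℚₚ.toℚᵘ-fromℚᵘ (ℚᵘ.mkℚᵘ (+ 1) 2)))
    equation : n ℤ.* + (1 ℕ.* g ℕ.* 3) ≡ (+ 2 ℤ.* + g ℤ.+ + 1 ℤ.* + 1) ℤ.* + 1 ℤ.* + suc d-1
    equation with subst (λ r → toℚᵘ r ℚᵘ.≃ unreduced) eq fraction
    ... | ℚᵘ.*≡* e = e

  admissible : ∀ {ℓ} (H : FiniteAbelianGroup) → FiniteAbelianGroup.ExponentAtMost H ℓ → ∀ k (S : FiniteAbelianGroup.STPP H k) →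
               Admissible H k S (c (3 ℕ.* saving ℓ) {{3saving≢0 ℓ}})
  admissible {ℓ} H (m , 1≤m , m≤ℓ , killed) k S q below =
    sum-bound k volume (3 ℕ.* g) (2 ℕ.* g ℕ.+ 1) order bound q λ i → approximate {n = ℤ.∣ ℚ.numerator (third (c g)) ∣} (third-fraction g) (below i)
    where
    open FiniteAbelianGroup H
    open STPP S
    open Constructions H
    g : ℕ
    g = 3 ℕ.* saving ℓ
    instance
      g≢0 : NonZero g
      g≢0 = 3saving≢0 ℓ
      3g≢0 : NonZero (3 ℕ.* g)
      3g≢0 = ℕₚ.m*n≢0 3 g
    bound : ∀ y φ → (∀ i → φ i ℕ.^ (3 ℕ.* g) ℕ.≤ y ℕ.^ (3 ℕ.* g) ℕ.* volume i ℕ.^ (2 ℕ.* g ℕ.+ 1)) → _ ℕ.≤ y ℕ.* order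
    bound y φ h = weighted-bound 1≤m m≤ℓ (kills {m} killed) (family S)
      (λ i → size≤order (A i)) (λ i → size≤order (B i)) (λ i → size≤order (C i)) y φ
      (λ i → subst (λ v → φ i ℕ.^ (3 ℕ.* g) ℕ.≤ y ℕ.^ (3 ℕ.* g) ℕ.* v ℕ.^ (2 ℕ.* g ℕ.+ 1)) (ℕₚ.*-assoc (size (A i)) (size (B i)) (size (C i))) (h i))

open import Defs
open import Data.Nat using (ℕ)
open import Data.Integer using (+_)
open import Data.Rational using (ℚ; 0ℚ; _<_; _+_; _/_)
open import Data.Product using (Σ; _×_; ∃; ∃-syntax)
import Data.Nat as N
open import Data.Product using (_,_)
open import Data.Rational.Properties using (<⇒≤)
open Saving using (saving)
open ThirdExponent

theoremB : ∀ (ℓ : ℕ) → 1 N.≤ ℓ →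
    ∃[ ε ] (0ℚ < ε ×
    (∀ (H : FiniteAbelianGroup) → FiniteAbelianGroup.ExponentAtMost H ℓ →
    ∀ (k : ℕ) (S : FiniteAbelianGroup.STPP H k) →
    TauAtLeast H k S ((+ 2 / 1) + ε)))
-- The exponent `2 + 1/g` is itself admissible, so one witness serves every `c` below it.
theoremB ℓ _ = Exponent.ε g , Exponent.ε>0 g , λ H e k S c c<t → Exponent.c g , <⇒≤ c<t , Exponent.c≥0 g , admissible H e k S
  where
  g : ℕ
  g = 3 N.* saving ℓ
  instance
    g≢0 : N.NonZero g
    g≢0 = 3saving≢0 ℓ
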